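{- Let $n$ be an even positive integer. Let $\omega=\exp(\frac{\pi}{4}\mathbf i)$ and $\xi=\exp(\frac{\pi}{n}\mathbf i)$, where $\mathbf i^2=-1$. Then the irreducible complex matrix representations of $T_{8n}$ (up to equivalence, without repetition) are the following: (1) for $j\in\{0,2,4,6\}$, $\rho_{1j}: a\mapsto 1,\ b\mapsto\omega^j$; and for $j\in\{1,3,5,7\}$, $\rho_{1j}: a\mapsto -1,\ b\mapsto\omega^{j-1}$; (2) for $k\in\{2,4,\dots,n-2\}$, $\rho_{2k}: a\mapsto\begin{pmatrix}\xi^k&0\\0&\xi^{ -k}\end{pmatrix},\ b\mapsto\begin{pmatrix}0&1\\1&0\end{pmatrix}$; and for $k\in\{1,3,\dots,n-1\}$, $\rho_{2k}: a\mapsto\begin{pmatrix}\xi^k&0\\0&\xi^{ -k}\end{pmatrix},\ b\mapsto\begin{pmatrix}0&\mathbf i\\1&0\end{pmatrix}$; (3) for $h\in\{2,4,\dots,n-2\}$, $\rho_{3h}: a\mapsto\begin{pmatrix}\xi^h&0\\0&\xi^{ -h}\end{pmatrix},\ b\mapsto\begin{pmatrix}0&-1\\1&0\end{pmatrix}$; and for $h\in\{1,3,\dots,n-1\}$, $\rho_{3h}: a\mapsto\begin{pmatrix}\xi^h&0\\0&\xi^{ -h}\end{pmatrix},\ b\mapsto\begin{pmatrix}0&-\mathbf i\\1&0\end{pmatrix}$.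
   Context: $T_{8n}=\langle a,b\mid a^{2n}=b^8=e,\ a^n=b^4,\ b^{ -1}ab=a^{ -1}\rangle$ is a group of order $8n$. A matrix representation of a finite group $G$ is a homomorphism $G\to\mathrm{GL}(m,\mathbb C)$; two are equivalent if they are conjugate by an invertible matrix. -}

module Defs where

open import Level using (Level; 0ℓ; _⊔_) renaming (suc to lsuc)
open import Algebra.Bundles using (Group; CommutativeRing)
open import Algebra.Apartness.Bundles using (HeytingField; HeytingCommutativeRing)
open import Algebra.Morphism.Structures using (module GroupMorphisms)
open import Algebra.Structures using (IsCommutativeRing)
import Algebra.Apartness.Properties.HeytingCommutativeRing
import Algebra.Definitions.RawMonoid
import Algebra.Properties.Ring
import Algebra.Properties.Semiring.Exp
import Algebra.Properties.Semiring.Sum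
import Algebra.Solver.Ring.NaturalCoefficients.Default
open import Data.Bool.Base using (Bool; if_then_else_)
open import Data.Fin.Base using (Fin; zero; suc; toℕ)
import Data.Fin.Properties as Fin
open import Data.Nat.Base as ℕ using (ℕ; zero; suc; NonZero; _!)
open import Data.Nat.Divisibility using (_∣?_)
import Data.Nat.Properties as ℕ
open import Data.Product.Base using (∃-syntax; _×_; _,_; proj₁; proj₂)
open import Data.Sum.Base using (_⊎_; inj₁; inj₂; [_,_]′)
open import Data.Vec.Functional using (Vector; []; _∷_)
open import Relation.Binary.Core using (Rel)
open import Relation.Binary.PropositionalEquality.Core using (_≡_)
open import Relation.Binary.Structures using (IsStrictPartialOrder; IsEquivalence)
import Relation.Binary.Reasoning.Setoid
open import Relation.Nullary.Decidable.Core using (does)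
open import Relation.Nullary.Negation.Core using (contradiction)
open import Relation.Unary using (Pred)

private
  variable
    c ℓ ℓ₁ ℓ₂ : Level

module Presentation (X : Set) where

  infixl 7 _∙_
  infixr 8 _^_
  infix  9 _⁻¹

  data Word : Set where
    gen : X → Word
    ε   : Word
    _∙_ : Word → Word → Word
    _⁻¹ : Word → Word

  _^_ : Word → ℕ → Word
  w ^ zero  = ε
  w ^ suc n = w ∙ w ^ n

  module _ (R : Rel Word 0ℓ) where

    infix 4 _∼_

    -- The least group congruence on words that contains R.
    data _∼_ : Rel Word 0ℓ where
      relator   : ∀ {u v} → R u v → u ∼ v
      refl      : ∀ {u} → u ∼ u
      sym       : ∀ {u v} → u ∼ v → v ∼ u
      trans     : ∀ {u v w} → u ∼ v → v ∼ w → u ∼ w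
      ∙-cong    : ∀ {u u′ v v′} → u ∼ u′ → v ∼ v′ → u ∙ v ∼ u′ ∙ v′
      ⁻¹-cong   : ∀ {u v} → u ∼ v → u ⁻¹ ∼ v ⁻¹
      assoc     : ∀ u v w → (u ∙ v) ∙ w ∼ u ∙ (v ∙ w)
      identityˡ : ∀ u → ε ∙ u ∼ u
      identityʳ : ∀ u → u ∙ ε ∼ u
      inverseˡ  : ∀ u → u ⁻¹ ∙ u ∼ ε
      inverseʳ  : ∀ u → u ∙ u ⁻¹ ∼ ε

    ⟨_∣_⟩ : Group 0ℓ 0ℓ
    ⟨_∣_⟩ = record
      { Carrier = Word ; _≈_ = _∼_ ; _∙_ = _∙_ ; ε = ε ; _⁻¹ = _⁻¹
      ; isGroup = record
        { isMonoid = record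
          { isSemigroup = record
            { isMagma = record
              { isEquivalence = record { refl = refl ; sym = sym ; trans = trans }
              ; ∙-cong = ∙-cong
              }
            ; assoc = assoc
            }
          ; identity = identityˡ , identityʳ
          }
        ; inverse = inverseˡ , inverseʳ
        ; ⁻¹-cong = ⁻¹-cong
        }
      }

data Gen : Set where
  ‵a ‵b : Gen

open Presentation Gen public using (Word; gen; ⟨_∣_⟩)

a b : Word
a = gen ‵a
b = gen ‵b

module _ where

  open Presentation Gen using (ε; _∙_; _^_; _⁻¹)

  data T₈ₙ-Relator (n : ℕ) : Rel Word 0ℓ where
    a²ⁿ=e     : T₈ₙ-Relator n (a ^ (2 ℕ.* n)) ε
    b⁸=e      : T₈ₙ-Relator n (b ^ 8) ε
    aⁿ=b⁴     : T₈ₙ-Relator n (a ^ n) (b ^ 4)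
    b⁻¹ab=a⁻¹ : T₈ₙ-Relator n (b ⁻¹ ∙ a ∙ b) (a ⁻¹)

T₈ₙ : ℕ → Group 0ℓ 0ℓ
T₈ₙ n = ⟨_∣_⟩ (T₈ₙ-Relator n)

module Matrices (R : CommutativeRing c ℓ) where

  open CommutativeRing R hiding (zero)
  open Algebra.Properties.Semiring.Sum semiring
  open Relation.Binary.Reasoning.Setoid setoid

  Matrix : ℕ → Set c
  Matrix m = Vector (Vector Carrier m) m

  infix  4 _≈ᴹ_
  infixl 7 _*ᴹ_ _*ⱽ_

  _≈ᴹ_ : ∀ {m} → Rel (Matrix m) ℓ
  A ≈ᴹ B = ∀ i j → A i j ≈ B i j

  1ᴹ : ∀ {m} → Matrix m
  1ᴹ i j = if does (i Fin.≟ j) then 1# else 0#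

  _*ᴹ_ : ∀ {m} → Matrix m → Matrix m → Matrix m
  _*ᴹ_ {m} A B i k = ∑[ j < m ] (A i j * B j k)

  _*ⱽ_ : ∀ {m} → Matrix m → Vector Carrier m → Vector Carrier m
  _*ⱽ_ {m} A v i = ∑[ j < m ] (A i j * v j)

  ≈ᴹ-isEquivalence : ∀ {m} → IsEquivalence (_≈ᴹ_ {m})
  ≈ᴹ-isEquivalence = record
    { refl  = λ i j → refl
    ; sym   = λ p i j → sym (p i j)
    ; trans = λ p q i j → trans (p i j) (q i j)
    }

  private
    sum-zero : ∀ {m} (f : Vector Carrier m) → (∀ i → f i ≈ 0#) → sum f ≈ 0#
    sum-zero {m} f f≈0 = trans (sum-cong-≋ f≈0) (sum-replicate-zero m)

    sum-δˡ : ∀ {m} i (f : Vector Carrier m) → ∑[ j < m ] (1ᴹ i j * f j) ≈ f i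
    sum-δˡ zero f = begin
      1# * f zero + _ ≈⟨ +-cong (*-identityˡ _) (sum-zero (λ j → 0# * f (suc j)) λ j → zeroˡ _) ⟩
      f zero + 0#     ≈⟨ +-identityʳ _ ⟩
      f zero          ∎
    sum-δˡ (suc i) f = begin
      0# * f zero + _ ≈⟨ +-cong (zeroˡ _) (sum-δˡ i (λ j → f (suc j))) ⟩
      0# + f (suc i)  ≈⟨ +-identityˡ _ ⟩
      f (suc i)       ∎

    sum-δʳ : ∀ {m} k (f : Vector Carrier m) → ∑[ j < m ] (f j * 1ᴹ j k) ≈ f k
    sum-δʳ zero f = begin
      f zero * 1# + _ ≈⟨ +-cong (*-identityʳ _) (sum-zero (λ j → f (suc j) * 0#) λ j → zeroʳ _) ⟩
      f zero + 0#     ≈⟨ +-identityʳ _ ⟩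
      f zero          ∎
    sum-δʳ (suc k) f = begin
      f zero * 0# + _ ≈⟨ +-cong (zeroʳ _) (sum-δʳ k (λ j → f (suc j))) ⟩
      0# + f (suc k)  ≈⟨ +-identityˡ _ ⟩
      f (suc k)       ∎

  *ᴹ-cong : ∀ {m} {A A′ B B′ : Matrix m} → A ≈ᴹ A′ → B ≈ᴹ B′ → A *ᴹ B ≈ᴹ A′ *ᴹ B′
  *ᴹ-cong p q i k = sum-cong-≋ (λ j → *-cong (p i j) (q j k))

  *ᴹ-identityˡ : ∀ {m} (A : Matrix m) → 1ᴹ *ᴹ A ≈ᴹ A
  *ᴹ-identityˡ A i k = sum-δˡ i (λ j → A j k)

  *ᴹ-identityʳ : ∀ {m} (A : Matrix m) → A *ᴹ 1ᴹ ≈ᴹ A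
  *ᴹ-identityʳ A i k = sum-δʳ k (λ j → A i j)

  *ᴹ-assoc : ∀ {m} (A B C : Matrix m) → (A *ᴹ B) *ᴹ C ≈ᴹ A *ᴹ (B *ᴹ C)
  *ᴹ-assoc {m} A B C i l = begin
    ∑[ k < m ] (∑[ j < m ] (A i j * B j k) * C k l)   ≈⟨ sum-cong-≋ (λ k → *-distribʳ-sum (C k l) (λ j → A i j * B j k)) ⟩
    ∑[ k < m ] ∑[ j < m ] (A i j * B j k * C k l)     ≈⟨ ∑-comm (λ k j → A i j * B j k * C k l) ⟩
    ∑[ j < m ] ∑[ k < m ] (A i j * B j k * C k l)     ≈⟨ sum-cong-≋ (λ j → sum-cong-≋ (λ k → *-assoc (A i j) (B j k) (C k l))) ⟩
    ∑[ j < m ] ∑[ k < m ] (A i j * (B j k * C k l))   ≈⟨ sum-cong-≋ (λ j → *-distribˡ-sum (A i j) (λ k → B j k * C k l)) ⟨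
    ∑[ j < m ] (A i j * ∑[ k < m ] (B j k * C k l))   ∎

  record InvertibleMatrix (m : ℕ) : Set (c ⊔ ℓ) where
    field
      matrix   : Matrix m
      inverse  : Matrix m
      inverseˡ : inverse *ᴹ matrix ≈ᴹ 1ᴹ
      inverseʳ : matrix *ᴹ inverse ≈ᴹ 1ᴹ

  open InvertibleMatrix public using (matrix)

  private
    open module ≈ᴹ {m} = IsEquivalence (≈ᴹ-isEquivalence {m})
      using () renaming (refl to reflᴹ; sym to symᴹ; trans to transᴹ)

    *ᴹ-cancel : ∀ {m} (A B B′ A′ : Matrix m) → B *ᴹ B′ ≈ᴹ 1ᴹ → A *ᴹ A′ ≈ᴹ 1ᴹ →
                (A *ᴹ B) *ᴹ (B′ *ᴹ A′) ≈ᴹ 1ᴹ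
    *ᴹ-cancel A B B′ A′ p q =
      transᴹ (*ᴹ-assoc A B _)
     (transᴹ (*ᴹ-cong (reflᴹ {x = A})
               (transᴹ (symᴹ (*ᴹ-assoc B B′ A′))
               (transᴹ (*ᴹ-cong p (reflᴹ {x = A′})) (*ᴹ-identityˡ A′))))
              q)

    open InvertibleMatrix

    _∙ᴳ_ : ∀ {m} → InvertibleMatrix m → InvertibleMatrix m → InvertibleMatrix m
    A ∙ᴳ B = record
      { matrix   = matrix A *ᴹ matrix B
      ; inverse  = inverse B *ᴹ inverse A
      ; inverseˡ = *ᴹ-cancel (inverse B) (inverse A) (matrix A) (matrix B) (inverseˡ A) (inverseˡ B)
      ; inverseʳ = *ᴹ-cancel (matrix A) (matrix B) (inverse B) (inverse A) (inverseʳ B) (inverseʳ A)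
      }

    1ᴳ : ∀ {m} → InvertibleMatrix m
    1ᴳ = record
      { matrix = 1ᴹ ; inverse = 1ᴹ
      ; inverseˡ = *ᴹ-identityˡ 1ᴹ ; inverseʳ = *ᴹ-identityˡ 1ᴹ }

    _⁻¹ᴳ : ∀ {m} → InvertibleMatrix m → InvertibleMatrix m
    A ⁻¹ᴳ = record
      { matrix = inverse A ; inverse = matrix A
      ; inverseˡ = inverseʳ A ; inverseʳ = inverseˡ A }

    inverse-unique : ∀ {m} (A B : InvertibleMatrix m) →
                     matrix A ≈ᴹ matrix B → inverse A ≈ᴹ inverse B
    inverse-unique A B p =
      transᴹ (symᴹ (*ᴹ-identityʳ (inverse A)))
     (transᴹ (*ᴹ-cong (reflᴹ {x = inverse A})
               (transᴹ (symᴹ (inverseʳ B)) (*ᴹ-cong (symᴹ p) (reflᴹ {x = inverse B}))))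
     (transᴹ (symᴹ (*ᴹ-assoc (inverse A) (matrix A) (inverse B)))
     (transᴹ (*ᴹ-cong (inverseˡ A) (reflᴹ {x = inverse B})) (*ᴹ-identityˡ (inverse B)))))

  GL : ℕ → Group (c ⊔ ℓ) ℓ
  GL m = record
    { Carrier = InvertibleMatrix m
    ; _≈_ = λ A B → matrix A ≈ᴹ matrix B
    ; _∙_ = _∙ᴳ_ ; ε = 1ᴳ ; _⁻¹ = _⁻¹ᴳ
    ; isGroup = record
      { isMonoid = record
        { isSemigroup = record
          { isMagma = record
            { isEquivalence = record { refl = reflᴹ ; sym = symᴹ ; trans = transᴹ }
            ; ∙-cong = *ᴹ-cong
            }
          ; assoc = λ A B C → *ᴹ-assoc (matrix A) (matrix B) (matrix C)
          }
        ; identity = (λ A → *ᴹ-identityˡ (matrix A)) , (λ A → *ᴹ-identityʳ (matrix A))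
        }
      ; inverse = inverseˡ , inverseʳ
      ; ⁻¹-cong = λ {A} {B} → inverse-unique A B
      }
    }

module Representations (K : HeytingField c ℓ₁ ℓ₂) (G : Group 0ℓ 0ℓ) where

  open HeytingField K
  open HeytingCommutativeRing heytingCommutativeRing using (commutativeRing)
  open Matrices commutativeRing
  private module G = Group G

  record Representation (m : ℕ) : Set (c ⊔ ℓ₁) where
    field
      ⟦_⟧ : G.Carrier → InvertibleMatrix m
      isGroupHomomorphism :
        GroupMorphisms.IsGroupHomomorphism G.rawGroup (Group.rawGroup (GL m)) ⟦_⟧

    act : G.Carrier → Matrix m
    act g = matrix ⟦ g ⟧

  open Representation public

  record IsInvariantSubspace {m} (ρ : Representation m) (W : Pred (Vector Carrier m) (c ⊔ ℓ₁)) :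
                             Set (c ⊔ ℓ₁) where
    field
      resp-≈    : ∀ {v w} → (∀ i → v i ≈ w i) → W v → W w
      0-closed  : W (λ _ → 0#)
      +-closed  : ∀ {v w} → W v → W w → W (λ i → v i + w i)
      *-closed  : ∀ x {v} → W v → W (λ i → x * v i)
      invariant : ∀ g {v} → W v → W (act ρ g *ⱽ v)

  -- Apartness is the constructive reading of v ≠ 0, and "0 and the whole
  -- space are the only invariant subspaces" is read as "an invariant subspace
  -- with a nonzero vector is the whole space".
  record IsIrreducible {m} (ρ : Representation m) : Set (lsuc (c ⊔ ℓ₁) ⊔ ℓ₂) where
    field
      nonZero : NonZero m
      simple  : ∀ W → IsInvariantSubspace ρ W →
                ∀ v → W v → (∃[ i ] v i # 0#) → ∀ w → W w

  infix 4 _≅_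

  -- Representations of different degrees are never equivalent.
  data _≅_ {m} (ρ : Representation m) : ∀ {m′} → Representation m′ → Set (c ⊔ ℓ₁) where
    conjugate : ∀ {σ : Representation m} (P : InvertibleMatrix m) →
                (∀ g → matrix P *ᴹ act ρ g ≈ᴹ act σ g *ᴹ matrix P) → ρ ≅ σ

  record IsCompleteListOfIrreducibles {I : Set} {deg : I → ℕ}
           (ρ : ∀ i → Representation (deg i)) : Set (lsuc (c ⊔ ℓ₁) ⊔ ℓ₂) where
    field
      irreducible        : ∀ i → IsIrreducible (ρ i)
      without-repetition : ∀ i j → ρ i ≅ ρ j → i ≡ j
      complete           : ∀ {m} (σ : Representation m) → IsIrreducible σ → ∃[ i ] σ ≅ ρ i

module RingIdentities (R : CommutativeRing c ℓ) where

  private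
    open Algebra.Solver.Ring.NaturalCoefficients.Default (CommutativeRing.commutativeSemiring R)
      using (solve; _:+_; _:*_; _:=_)

    -- The variable m stands for -1, which the semiring solver does not know.
    module SemiringIdentities where

      open CommutativeRing R using (_+_; _*_; _≈_; refl)

      assoc-re : ∀ m a b c d e f → (a * c + m * (b * d)) * e + m * ((a * d + b * c) * f)
                                 ≈ a * (c * e + m * (d * f)) + m * (b * (c * f + d * e))
      assoc-re = solve 7 (λ m a b c d e f →
        (a :* c :+ m :* (b :* d)) :* e :+ m :* ((a :* d :+ b :* c) :* f) :=
        a :* (c :* e :+ m :* (d :* f)) :+ m :* (b :* (c :* f :+ d :* e))) refl

      assoc-im : ∀ m a b c d e f → (a * c + m * (b * d)) * f + (a * d + b * c) * e
                                 ≈ a * (c * f + d * e) + b * (c * e + m * (d * f))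
      assoc-im = solve 7 (λ m a b c d e f →
        (a :* c :+ m :* (b :* d)) :* f :+ (a :* d :+ b :* c) :* e :=
        a :* (c :* f :+ d :* e) :+ b :* (c :* e :+ m :* (d :* f))) refl

      comm-im : ∀ a b c d → a * d + b * c ≈ c * b + d * a
      comm-im = solve 4 (λ a b c d → a :* d :+ b :* c := c :* b :+ d :* a) refl

      distrib-re : ∀ m a b c d e f → a * (c + e) + m * (b * (d + f))
                                   ≈ (a * c + m * (b * d)) + (a * e + m * (b * f))
      distrib-re = solve 7 (λ m a b c d e f →
        a :* (c :+ e) :+ m :* (b :* (d :+ f)) :=
        (a :* c :+ m :* (b :* d)) :+ (a :* e :+ m :* (b :* f))) refl

      distrib-im : ∀ a b c d e f → a * (d + f) + b * (c + e)
                                 ≈ (a * d + b * c) + (a * f + b * e)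
      distrib-im = solve 6 (λ a b c d e f →
        a :* (d :+ f) :+ b :* (c :+ e) :=
        (a :* d :+ b :* c) :+ (a :* f :+ b :* e)) refl

  open CommutativeRing R
  open Algebra.Properties.Ring ring using (-1*x≈-x; -‿distribʳ-*; -‿distribˡ-*; -‿involutive)

  private
    -≈-1* : ∀ {x y} → x + - y ≈ x + - 1# * y
    -≈-1* {x} {y} = +-congˡ (sym (-1*x≈-x y))

  zy*x≈z*xy : ∀ z x y → z * y * x ≈ z * (x * y)
  zy*x≈z*xy z x y = trans (*-assoc z y x) (*-congˡ (*-comm y x))

  assoc-re : ∀ a b c d e f → (a * c - b * d) * e - (a * d + b * c) * f
                           ≈ a * (c * e - d * f) - b * (c * f + d * e)
  assoc-re a b c d e f =
    trans (trans -≈-1* (+-congʳ (*-congʳ -≈-1*)))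
   (trans (SemiringIdentities.assoc-re (- 1#) a b c d e f)
          (sym (trans -≈-1* (+-congʳ (*-congˡ -≈-1*)))))

  assoc-im : ∀ a b c d e f → (a * c - b * d) * f + (a * d + b * c) * e
                           ≈ a * (c * f + d * e) + b * (c * e - d * f)
  assoc-im a b c d e f =
    trans (+-congʳ (*-congʳ -≈-1*))
   (trans (SemiringIdentities.assoc-im (- 1#) a b c d e f)
          (sym (+-congˡ (*-congˡ -≈-1*))))

  comm-re : ∀ a b c d → a * c - b * d ≈ c * a - d * b
  comm-re a b c d = +-cong (*-comm a c) (-‿cong (*-comm b d))

  comm-im : ∀ a b c d → a * d + b * c ≈ c * b + d * a
  comm-im = SemiringIdentities.comm-im

  distrib-re : ∀ a b c d e f → a * (c + e) - b * (d + f)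
                             ≈ (a * c - b * d) + (a * e - b * f)
  distrib-re a b c d e f =
    trans -≈-1*
   (trans (SemiringIdentities.distrib-re (- 1#) a b c d e f)
          (sym (+-cong -≈-1* -≈-1*)))

  distrib-im : ∀ a b c d e f → a * (d + f) + b * (c + e)
                             ≈ (a * d + b * c) + (a * f + b * e)
  distrib-im = SemiringIdentities.distrib-im

  inverse-re : ∀ n a b → (n * a) * a - (n * - b) * b ≈ n * (a * a + b * b)
  inverse-re n a b =
    trans (+-cong (*-assoc n a a)
            (trans (-‿distribˡ-* (n * - b) b)
            (trans (*-congʳ (trans (-‿distribʳ-* n (- b)) (*-congˡ (-‿involutive b))))
                   (*-assoc n b b))))
          (sym (distribˡ n (a * a) (b * b)))

  inverse-im : ∀ n a b → (n * a) * b + (n * - b) * a ≈ 0#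
  inverse-im n a b =
    trans (+-congˡ (trans (*-congʳ (sym (-‿distribʳ-* n b)))
                   (trans (sym (-‿distribˡ-* (n * b) a)) (-‿cong nba≈nab))))
          (-‿inverseʳ (n * a * b))
    where
    nba≈nab : n * b * a ≈ n * a * b
    nba≈nab = trans (zy*x≈z*xy n a b) (sym (*-assoc n a b))

-- The axioms of a Cauchy complete Archimedean ordered field, in a form that is
-- meaningful constructively; classically ℝ is the only model up to isomorphism.
record RealNumbers : Set₁ where
  field
    heytingField : HeytingField 0ℓ 0ℓ 0ℓ

  open HeytingField heytingField public

  infix 4 _<_

  field
    _<_                  : Rel Carrier 0ℓ
    isStrictPartialOrder : IsStrictPartialOrder _≈_ _<_
    <⇒#                  : ∀ {x y} → x < y → x # y
    #⇒<⊎>                : ∀ {x y} → x # y → x < y ⊎ y < x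
    +-monoˡ-<            : ∀ z {x y} → x < y → x + z < y + z
    *-positive           : ∀ {x y} → 0# < x → 0# < y → 0# < x * y

  open IsStrictPartialOrder isStrictPartialOrder public
    using (<-resp-≈; <-respʳ-≈; <-respˡ-≈) renaming (irrefl to <-irrefl; trans to <-trans)

  open HeytingCommutativeRing heytingCommutativeRing public using (commutativeRing)

  open Algebra.Definitions.RawMonoid (CommutativeRing.+-rawMonoid commutativeRing) public
    using () renaming (_×_ to _·_)

  -- |s k - l| → 0, the absolute value being unfolded into two inequalities.
  _⟶_ : (ℕ → Carrier) → Carrier → Set
  s ⟶ l = ∀ ε → 0# < ε → ∃[ N ] ∀ k → N ℕ.≤ k → (s k - l < ε) × (l - s k < ε)

  IsCauchy : (ℕ → Carrier) → Set
  IsCauchy s = ∀ ε → 0# < ε → ∃[ N ] ∀ j k → N ℕ.≤ j → N ℕ.≤ k → s j - s k < ε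

  field
    archimedean : ∀ x → ∃[ k ] x < k · 1#
    complete    : ∀ s → IsCauchy s → ∃[ l ] s ⟶ l

module OrderedFieldProperties (ℛ : RealNumbers) where

  open RealNumbers ℛ
  open Algebra.Apartness.Properties.HeytingCommutativeRing
    (HeytingField.heytingCommutativeRing heytingField) public

  private
    open CommutativeRing commutativeRing using (ring)
    open Algebra.Properties.Ring ring
      using (-‿distribˡ-*; -‿distribʳ-*; -‿involutive)
    open RingIdentities commutativeRing using (zy*x≈z*xy)

    x+y-y≈x : ∀ x y → x + y - y ≈ x
    x+y-y≈x x y = trans (+-assoc x y (- y)) (trans (+-congˡ (-‿inverseʳ y)) (+-identityʳ x))

    x+y-x≈y : ∀ x y → x + y - x ≈ y
    x+y-x≈y x y = trans (+-congʳ (+-comm x y)) (x+y-y≈x y x)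

  #0⇒invertible : ∀ {x} → x # 0# → ∃[ y ] y * x ≈ 1#
  #0⇒invertible {x} x#0 with #⇒invertible x#0
  ... | y , y*x≈1 , _ = y , trans (*-congˡ (sym (x-0≈x x))) y*x≈1

  invertible⇒#0 : ∀ {x} y → y * x ≈ 1# → x # 0#
  invertible⇒#0 {x} y y*x≈1 = invertibleˡ⇒# (y , trans (*-congˡ (x-0≈x x)) y*x≈1)

  #⇒-#0 : ∀ {x y} → x # y → x - y # 0#
  #⇒-#0 x#y with #⇒invertible x#y
  ... | z , z*[x-y]≈1 , _ = invertible⇒#0 z z*[x-y]≈1

  -#0⇒# : ∀ {x y} → x - y # 0# → x # y
  -#0⇒# x-y#0 = invertibleˡ⇒# (#0⇒invertible x-y#0)

  *#0⇒#0ˡ : ∀ {x y} → x * y # 0# → x # 0#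
  *#0⇒#0ˡ {x} {y} xy#0 with #0⇒invertible xy#0
  ... | z , z*xy≈1 = invertible⇒#0 (z * y) (trans (zy*x≈z*xy z x y) z*xy≈1)

  +#0⇒#0 : ∀ {x y} → x + y # 0# → x # 0# ⊎ y # 0#
  +#0⇒#0 {x} {y} x+y#0 with #-cotrans x+y#0 y
  ... | inj₁ x+y#y = inj₁ (#-congʳ (x+y-y≈x x y) (#⇒-#0 x+y#y))
  ... | inj₂ y#0   = inj₂ y#0

  -‿#0 : ∀ {x} → - x # 0# → x # 0#
  -‿#0 {x} -x#0 with #0⇒invertible -x#0
  ... | y , y*-x≈1 = invertible⇒#0 (- y)
    (trans (sym (-‿distribˡ-* y x)) (trans (-‿distribʳ-* y x) y*-x≈1))

  <-cotrans : ∀ {x y} → x < y → ∀ z → x < z ⊎ z < y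
  <-cotrans x<y z with #-cotrans (<⇒# x<y) z
  ... | inj₁ x#z = [ inj₁ , (λ z<x → inj₂ (<-trans z<x x<y)) ]′ (#⇒<⊎> x#z)
  ... | inj₂ z#y = [ inj₂ , (λ y<z → inj₁ (<-trans x<y y<z)) ]′ (#⇒<⊎> z#y)

  0<-x : ∀ {x} → x < 0# → 0# < - x
  0<-x {x} x<0 = <-respˡ-≈ (-‿inverseʳ x) (<-respʳ-≈ (+-identityˡ (- x)) (+-monoˡ-< (- x) x<0))

  0<x² : ∀ {x} → x # 0# → 0# < x * x
  0<x² {x} x#0 with #⇒<⊎> x#0
  ... | inj₂ 0<x = *-positive 0<x 0<x
  ... | inj₁ x<0 = <-respʳ-≈ -x*-x≈x*x (*-positive (0<-x x<0) (0<-x x<0))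
    where
    -x*-x≈x*x : - x * - x ≈ x * x
    -x*-x≈x*x = trans (sym (-‿distribˡ-* x (- x)))
      (trans (-‿cong (sym (-‿distribʳ-* x x))) (-‿involutive (x * x)))

  0<p+x² : ∀ {p} → 0# < p → ∀ x → 0# < p + x * x
  0<p+x² {p} 0<p x with <-cotrans 0<p (p + x * x)
  ... | inj₁ 0<p+x² = 0<p+x²
  ... | inj₂ p+x²<p = contradiction (<-trans x²<0 (0<x² (*#0⇒#0ˡ (<⇒# x²<0)))) (<-irrefl refl)
    where
    x²<0 : x * x < 0#
    x²<0 = <-respˡ-≈ (x+y-x≈y p (x * x)) (<-respʳ-≈ (-‿inverseʳ p) (+-monoˡ-< (- p) p+x²<p))

  0<1 : 0# < 1#
  0<1 = <-respʳ-≈ (*-identityˡ 1#) (0<x² 1#0)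

  0<suc : ∀ k → 0# < suc k · 1#
  0<suc zero    = <-respʳ-≈ (sym (+-identityʳ 1#)) 0<1
  0<suc (suc k) = <-trans (0<suc k) (<-respˡ-≈ (+-identityˡ _) (+-monoˡ-< _ 0<1))

  recip : ∀ k .{{_ : NonZero k}} → ∃[ y ] y * (k · 1#) ≈ 1#
  recip (suc k) = #0⇒invertible (#-sym (<⇒# (0<suc k)))

  infixl 7 _/_

  _/_ : Carrier → ∀ k .{{_ : NonZero k}} → Carrier
  x / k = x * proj₁ (recip k)

module ComplexInverses (ℛ : RealNumbers) where

  open RealNumbers ℛ
  open OrderedFieldProperties ℛ

  0<|z|² : ∀ a b → a # 0# ⊎ b # 0# → 0# < a * a + b * b
  0<|z|² a b (inj₁ a#0) = 0<p+x² (0<x² a#0) b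
  0<|z|² a b (inj₂ b#0) = <-respʳ-≈ (+-comm _ _) (0<p+x² (0<x² b#0) a)

  inverse : ∀ a b → a # 0# ⊎ b # 0# → ∃[ n ] n * (a * a + b * b) ≈ 1#
  inverse a b p = #0⇒invertible (#-sym (<⇒# (0<|z|² a b p)))

  -- The hypothesis is the real part of (c + di) (a + bi) = 1.
  #0 : ∀ a b c d → c * a + - (d * b) ≈ 1# → a # 0# ⊎ b # 0#
  #0 a b c d eq with +#0⇒#0 (#-congʳ (sym eq) 1#0)
  ... | inj₁ ca#0  = inj₁ (*#0⇒#0ˡ (#-congʳ (*-comm c a) ca#0))
  ... | inj₂ -db#0 = inj₂ (*#0⇒#0ˡ (#-congʳ (*-comm d b) (-‿#0 -db#0)))

module ComplexNumbers (ℛ : RealNumbers) where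

  private
    open module ℝ = RealNumbers ℛ using (_⟶_) renaming (Carrier to ℝ)
    module Identities = RingIdentities ℝ.commutativeRing
    module Inverses = ComplexInverses ℛ
    open Algebra.Properties.Ring (CommutativeRing.ring ℝ.commutativeRing) using (-0#≈0#)
  open OrderedFieldProperties ℛ

  infix 6 _+i_

  record ℂ : Set where
    constructor _+i_
    field
      re : ℝ
      im : ℝ

  open ℂ public

  infix  8 -_
  infixl 7 _*_
  infixl 6 _+_
  infix  4 _≈_ _#_

  _≈_ : Rel ℂ 0ℓ
  z ≈ w = (re z ℝ.≈ re w) × (im z ℝ.≈ im w)

  _#_ : Rel ℂ 0ℓ
  z # w = (re z ℝ.# re w) ⊎ (im z ℝ.# im w)

  _+_ _*_ : ℂ → ℂ → ℂ
  z + w = (re z ℝ.+ re w) +i (im z ℝ.+ im w)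
  z * w = (re z ℝ.* re w ℝ.- im z ℝ.* im w) +i (re z ℝ.* im w ℝ.+ im z ℝ.* re w)

  -_ : ℂ → ℂ
  - z = (ℝ.- re z) +i (ℝ.- im z)

  0# 1# 𝐢 : ℂ
  0# = ℝ.0# +i ℝ.0#
  1# = ℝ.1# +i ℝ.0#
  𝐢  = ℝ.0# +i ℝ.1#

  isCommutativeRing : IsCommutativeRing _≈_ _+_ _*_ -_ 0# 1#
  isCommutativeRing = record
    { isRing = record
      { +-isAbelianGroup = record
        { isGroup = record
          { isMonoid = record
            { isSemigroup = record
              { isMagma = record
                { isEquivalence = record
                  { refl  = ℝ.refl , ℝ.refl
                  ; sym   = λ (p , q) → ℝ.sym p , ℝ.sym q
                  ; trans = λ (p , q) (r , s) → ℝ.trans p r , ℝ.trans q s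
                  }
                ; ∙-cong = λ (p , q) (r , s) → ℝ.+-cong p r , ℝ.+-cong q s
                }
              ; assoc = λ _ _ _ → ℝ.+-assoc _ _ _ , ℝ.+-assoc _ _ _
              }
            ; identity = (λ _ → ℝ.+-identityˡ _ , ℝ.+-identityˡ _)
                       , (λ _ → ℝ.+-identityʳ _ , ℝ.+-identityʳ _)
            }
          ; inverse = (λ _ → ℝ.-‿inverseˡ _ , ℝ.-‿inverseˡ _)
                    , (λ _ → ℝ.-‿inverseʳ _ , ℝ.-‿inverseʳ _)
          ; ⁻¹-cong = λ (p , q) → ℝ.-‿cong p , ℝ.-‿cong q
          }
        ; comm = λ _ _ → ℝ.+-comm _ _ , ℝ.+-comm _ _
        }
      ; *-cong = λ (p , q) (r , s) →
            ℝ.+-cong (ℝ.*-cong p r) (ℝ.-‿cong (ℝ.*-cong q s))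
          , ℝ.+-cong (ℝ.*-cong p s) (ℝ.*-cong q r)
      ; *-assoc = λ (a +i b) (c +i d) (e +i f) → assoc-re a b c d e f , assoc-im a b c d e f
      ; *-identity = (λ z → 1*z≈z z) , (λ z → ≈-trans (*-comm z 1#) (1*z≈z z))
      ; distrib = (λ z w v → *-distribˡ z w v)
                , (λ z w v → ≈-trans (*-comm (w + v) z)
                            (≈-trans (*-distribˡ z w v)
                            (ℝ.+-cong (proj₁ (*-comm z w)) (proj₁ (*-comm z v))
                            , ℝ.+-cong (proj₂ (*-comm z w)) (proj₂ (*-comm z v)))))
      }
    ; *-comm = *-comm
    }
    where
    open Identities

    ≈-trans : ∀ {z w v} → z ≈ w → w ≈ v → z ≈ v
    ≈-trans (p , q) (r , s) = ℝ.trans p r , ℝ.trans q s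

    *-comm : ∀ z w → z * w ≈ w * z
    *-comm (a +i b) (c +i d) = comm-re a b c d , comm-im a b c d

    1*z≈z : ∀ z → 1# * z ≈ z
    1*z≈z (a +i b) =
        ℝ.trans (ℝ.+-cong (ℝ.*-identityˡ a) (ℝ.trans (ℝ.-‿cong (ℝ.zeroˡ b)) -0#≈0#)) (ℝ.+-identityʳ a)
      , ℝ.trans (ℝ.+-cong (ℝ.*-identityˡ b) (ℝ.zeroˡ a)) (ℝ.+-identityʳ b)

    *-distribˡ : ∀ z w v → z * (w + v) ≈ z * w + z * v
    *-distribˡ (a +i b) (c +i d) (e +i f) = distrib-re a b c d e f , distrib-im a b c d e f

  ℂ-commutativeRing : CommutativeRing 0ℓ 0ℓ
  ℂ-commutativeRing = record { isCommutativeRing = isCommutativeRing }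

  ℂ-heytingField : HeytingField 0ℓ 0ℓ 0ℓ
  ℂ-heytingField = record
    { Carrier = ℂ ; _≈_ = _≈_ ; _#_ = _#_ ; _+_ = _+_ ; _*_ = _*_ ; -_ = -_ ; 0# = 0# ; 1# = 1#
    ; isHeytingField = record
      { isHeytingCommutativeRing = record
        { isCommutativeRing   = isCommutativeRing
        ; isApartnessRelation = record
          { irrefl  = λ (p , q) → [ ℝ.#-irrefl p , ℝ.#-irrefl q ]′
          ; sym     = [ (λ p → inj₁ (ℝ.#-sym p)) , (λ q → inj₂ (ℝ.#-sym q)) ]′
          ; cotrans = cotrans
          }
        ; #⇒invertible = λ {z} {w} → #⇒invertible′ z w
        ; invertible⇒# = λ {z} {w} → invertible⇒#′ z w
        }
      ; tight = λ z w →
            (λ ¬z#w → proj₁ (ℝ.tight _ _) (λ p → ¬z#w (inj₁ p))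
                    , proj₁ (ℝ.tight _ _) (λ q → ¬z#w (inj₂ q)))
          , (λ (p , q) → [ ℝ.#-irrefl p , ℝ.#-irrefl q ]′)
      }
    }
    where
    open CommutativeRing ℂ-commutativeRing using (_-_; *-comm; trans)
    open import Algebra.Definitions _≈_ using (Invertible)

    cotrans : ∀ {z w} → z # w → ∀ v → z # v ⊎ v # w
    cotrans (inj₁ p) v = [ (λ r → inj₁ (inj₁ r)) , (λ r → inj₂ (inj₁ r)) ]′ (ℝ.#-cotrans p (re v))
    cotrans (inj₂ q) v = [ (λ r → inj₁ (inj₂ r)) , (λ r → inj₂ (inj₂ r)) ]′ (ℝ.#-cotrans q (im v))

    #⇒invertible′ : ∀ z w → z # w → Invertible 1# _*_ (z - w)
    #⇒invertible′ z w z#w = let u = z - w in invertible u ([ (λ p → inj₁ (#⇒-#0 p)) , (λ q → inj₂ (#⇒-#0 q)) ]′ z#w)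
      where
      invertible : ∀ u → u # 0# → Invertible 1# _*_ u
      invertible (a +i b) u#0 with Inverses.inverse a b u#0
      ... | n , n*|u|²≈1 = v , v*u≈1 , trans (*-comm (a +i b) v) v*u≈1
        where
        v : ℂ
        v = (n ℝ.* a) +i (n ℝ.* ℝ.- b)

        v*u≈1 : v * (a +i b) ≈ 1#
        v*u≈1 = ℝ.trans (Identities.inverse-re n a b) n*|u|²≈1 , Identities.inverse-im n a b

    invertible⇒#′ : ∀ z w → Invertible 1# _*_ (z - w) → z # w
    invertible⇒#′ z w (v , (v*u≈1 , _) , _) =
      [ (λ p → inj₁ (-#0⇒# p)) , (λ q → inj₂ (-#0⇒# q)) ]′
        (Inverses.#0 _ _ (re v) (im v) v*u≈1)

  open CommutativeRing ℂ-commutativeRing public using (semiring)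
  open Algebra.Properties.Semiring.Exp semiring public using (_^_)
  open Algebra.Properties.Semiring.Sum semiring public using (sum-syntax)

  _⟶ℂ_ : (ℕ → ℂ) → ℂ → Set
  s ⟶ℂ l = ((λ k → re (s k)) ⟶ re l) × ((λ k → im (s k)) ⟶ im l)

  expTerm : ℂ → ℕ → ℂ
  expTerm z k = (re (z ^ k) / k !) +i (im (z ^ k) / k !)
    where instance _ = k ℕ.!≢0

  -- w = exp z: the series ∑ zᵏ / k! converges to w.
  IsExp : ℂ → ℂ → Set
  IsExp z w = (λ N → ∑[ k < N ] expTerm z (toℕ k)) ⟶ℂ w

  -- s = sin t, since exp (𝐢 t) = cos t + 𝐢 sin t.
  IsSin : ℝ → ℝ → Set
  IsSin t s = ∃[ c ] IsExp (ℝ.0# +i t) (c +i s)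

  -- π is the least positive zero of sin; apartness is the constructive reading
  -- of sin t ≠ 0 for 0 < t < π.
  record IsPi (π : ℝ) : Set where
    field
      positive : ℝ.0# ℝ.< π
      zero-sin : IsSin π ℝ.0#
      least    : ∀ t s → ℝ.0# ℝ.< t → t ℝ.< π → IsSin t s → s ℝ.# ℝ.0#

even : ℕ → Bool
even k = does (2 ∣? k)

-- ρ₁ j is the one-dimensional representation ρ₁ⱼ; ρ₂ k and ρ₃ k are ρ₂ₖ and ρ₃ₖ,
-- where even and odd indices together range over 1, …, n - 1 since n is even.
-- The bounds are irrelevant so that labels are equal when their indices are.
data Label (n : ℕ) : Set where
  ρ₁    : Fin 8 → Label n
  ρ₂ ρ₃ : (k : ℕ) → .(1 ℕ.≤ k) → .(k ℕ.< n) → Label n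

degree : ∀ {n} → Label n → ℕ
degree (ρ₁ _)     = 1
degree (ρ₂ _ _ _) = 2
degree (ρ₃ _ _ _) = 2

module _ (ℛ : RealNumbers) where

  open ComplexNumbers ℛ
  open Matrices ℂ-commutativeRing

  module _ (ω ξ ξ⁻¹ : ℂ) where

    image-a : ∀ {n} (l : Label n) → Matrix (degree l)
    image-a (ρ₁ j)     = ((if even (toℕ j) then 1# else - 1#) ∷ []) ∷ []
    image-a (ρ₂ k _ _) = (ξ ^ k ∷ 0# ∷ []) ∷ (0# ∷ ξ⁻¹ ^ k ∷ []) ∷ []
    image-a (ρ₃ h _ _) = (ξ ^ h ∷ 0# ∷ []) ∷ (0# ∷ ξ⁻¹ ^ h ∷ []) ∷ []

    image-b : ∀ {n} (l : Label n) → Matrix (degree l)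
    image-b (ρ₁ j)     = ((if even (toℕ j) then ω ^ toℕ j else ω ^ (toℕ j ℕ.∸ 1)) ∷ []) ∷ []
    image-b (ρ₂ k _ _) = (0# ∷ (if even k then 1# else 𝐢) ∷ []) ∷ (1# ∷ 0# ∷ []) ∷ []
    image-b (ρ₃ h _ _) = (0# ∷ (if even h then - 1# else - 𝐢) ∷ []) ∷ (1# ∷ 0# ∷ []) ∷ []

{-# OPTIONS --safe #-}
module Submission where

-- Completeness. If σ is irreducible of degree m, then a has an eigenvector v with eigenvalue ξᵏ
-- (a discrete Fourier transform of the orbit of a basis vector under a), and since b⁴ = aⁿ one may
-- also take v to be an eigenvector of the central element b². If a v = ± v, then splitting v under b
-- gives a common eigenvector; otherwise v and b v span a copy of ρ₂ₖ or ρ₃ₖ, after replacing v by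
-- b v if k > n. In both cases this is a nonzero intertwiner V from an irreducible ρ to σ. Its image
-- is everything and its kernel is zero, so V has a two-sided inverse C, and m = tr (V C) = tr (C V)
-- is the degree of ρ. Traces of a, b and b² tell the representations apart.
--
-- Roots of unity. The only analytic input is exp z exp w = exp (z + w), by Mertens' argument with
-- the geometric majorant C 4⁻ᵏ of zᵏ / k!. It makes ξʲ = exp (𝐢 π j / n), which is not real for
-- 0 < j < n because π is the least zero of sin, while ξⁿ is real with square 1. Since n is even,
-- ξⁿ = 1 would make exp (𝐢 π / 2) a square root of 1, so ξⁿ = -1.

open import Defs
open import Level using (Level; 0ℓ)
open import Algebra.Apartness.Bundles using (HeytingField; HeytingCommutativeRing)
import Algebra.Apartness.Properties.HeytingCommutativeRing
open import Algebra.Bundles using (CommutativeRing; Group; RawRing)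
open import Algebra.Morphism.Structures using (module GroupMorphisms)
import Algebra.Properties.CommutativeSemiring.Exp
import Algebra.Properties.Monoid.Mult
import Algebra.Properties.Ring
import Algebra.Properties.Semiring.Mult
import Algebra.Properties.Semiring.Mult.TCOptimised
import Algebra.Properties.Semiring.Sum
import Algebra.Solver.Ring
open import Algebra.Solver.Ring.AlmostCommutativeRing using (fromCommutativeRing; _-Raw-AlmostCommutative⟶_)
import Algebra.Solver.Ring.NaturalCoefficients.Default
open import Data.Bool.Base using (true; false; if_then_else_)
open import Data.Bool.Properties using (if-float)
open import Data.Fin.Base using (Fin; zero; suc; toℕ)
open import Data.Fin.Patterns using (0F; 1F; 2F; 3F; 4F; 5F; 6F; 7F)
import Data.Fin.Properties as Fin
open import Data.Maybe.Base using (Maybe; just; nothing)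
open import Data.Nat.Base as ℕ using (ℕ; zero; suc; NonZero; _!)
open import Data.Nat.Divisibility using (_∣_; divides; _∣?_; ∣m+n∣m⇒∣n; ∣⇒≤)
import Data.Nat.Properties as ℕ
open import Data.Product.Base using (_×_; _,_; ∃-syntax; Σ-syntax; proj₁; proj₂)
open import Data.Sum.Base using (_⊎_; inj₁; inj₂; [_,_]′)
open import Data.Vec.Functional using (Vector; []; _∷_)
open import Function.Base using (_∘_; const)
open import Relation.Binary.Core using (Rel)
open import Relation.Binary.Definitions using (tri<; tri≈; tri>)
open import Relation.Binary.PropositionalEquality.Core as ≡ using (_≡_)
import Relation.Binary.Reasoning.Setoid
open import Relation.Nullary.Decidable using (yes; no; dec-true; dec-false; recompute)
open import Relation.Nullary.Negation.Core using (¬_; contradiction)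

-- Equality of real or complex numbers has no decision procedure here, and this shapes every
-- existence proof: a vector cannot be tested for being zero. Nonzero vectors are extracted from
-- sums instead. A sum apart from 0 has a summand apart from 0, so as soon as a nonzero vector is a
-- combination of candidates (its Fourier components under a, or M v + s v and M v - s v where M²
-- acts as s²), one of the candidates is nonzero. For the same reason σ is never given a basis
-- adapted to a, and degrees are compared through traces. The classification is algebra over a
-- Heyting field with elements ξ, ω and 𝑖, where primitivity of a root of unity means that its
-- powers below the order are apart from 1. Analysis only supplies these hypotheses. There the
-- obstacle is that π is known solely as the least positive zero of sin, so everything about roots
-- of unity must come from values of sin between 0 and π, the functional equation and complex
-- conjugation.

private
  variable
    c ℓ : Level

-- A ring solver with integer coefficients.

module DifferenceSolver (R : CommutativeRing c ℓ) where

  open CommutativeRing R hiding (zero)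
  open Algebra.Properties.Ring ring
  open Algebra.Properties.Semiring.Mult.TCOptimised semiring
    using (×1-homo-*) renaming (_×_ to _·_; ×-homo-+ to ·-homo-+; 1+× to 1+·)
  open Relation.Binary.Reasoning.Setoid setoid

  -- The solver compares coefficients syntactically, so sums and products are
  -- brought to a form with one component zero.
  reduce : ℕ → ℕ → ℕ × ℕ
  reduce zero    n       = zero , n
  reduce (suc m) zero    = suc m , zero
  reduce (suc m) (suc n) = reduce m n

  -- The pair (m , n) stands for the integer m - n.
  Differences : RawRing 0ℓ 0ℓ
  Differences = record
    { Carrier = ℕ × ℕ
    ; _≈_ = _≡_
    ; _+_ = λ (a , b) (c , d) → reduce (a ℕ.+ c) (b ℕ.+ d)
    ; _*_ = λ (a , b) (c , d) → reduce (a ℕ.* c ℕ.+ b ℕ.* d) (a ℕ.* d ℕ.+ b ℕ.* c)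
    ; -_ = λ (a , b) → b , a
    ; 0# = 0 , 0
    ; 1# = 1 , 0
    }

  -- The case distinction makes the value of (1 , 0) definitionally 1#.
  ⟦_⟧ : ℕ × ℕ → Carrier
  ⟦ a , zero ⟧  = a · 1#
  ⟦ a , suc b ⟧ = a · 1# - suc b · 1#

  private
    module S = Algebra.Solver.Ring.NaturalCoefficients.Default commutativeSemiring
    open S using (_:+_; _:*_; _:=_)

    ⟦⟧-difference : ∀ a b → ⟦ a , b ⟧ ≈ a · 1# - b · 1#
    ⟦⟧-difference a zero    = sym (trans (+-congˡ -0#≈0#) (+-identityʳ _))
    ⟦⟧-difference a (suc b) = refl

    x-y≈x+-1y : ∀ {x y} → x - y ≈ x + - 1# * y
    x-y≈x+-1y = +-congˡ (sym (-1*x≈-x _))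

    -1*-1≈1 : - 1# * - 1# ≈ 1#
    -1*-1≈1 = trans (-1*x≈-x (- 1#)) (-‿involutive 1#)

    interchange : ∀ x y z w → (x + z) - (y + w) ≈ (x - y) + (z - w)
    interchange x y z w = trans x-y≈x+-1y (trans (lemma (- 1#) x y z w) (sym (+-cong x-y≈x+-1y x-y≈x+-1y)))
      where
      lemma : ∀ m x y z w → (x + z) + m * (y + w) ≈ (x + m * y) + (z + m * w)
      lemma = S.solve 5 (λ m x y z w → (x :+ z) :+ m :* (y :+ w) := (x :+ m :* y) :+ (z :+ m :* w)) refl

    -- The semiring solver sees -1 as a variable m. Expanding (x - y)(z - w) produces m², so the
    -- coefficient 1 of y w is first rewritten as (-1)(-1).
    *-difference : ∀ x y z w → (x * z + y * w) - (x * w + y * z) ≈ (x - y) * (z - w)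
    *-difference x y z w = begin
      (x * z + y * w) - (x * w + y * z)                    ≈⟨ x-y≈x+-1y ⟩
      (x * z + y * w) + - 1# * (x * w + y * z)             ≈⟨ +-congʳ (+-congˡ (*-identityˡ _)) ⟨
      (x * z + 1# * (y * w)) + - 1# * (x * w + y * z)      ≈⟨ +-congʳ (+-congˡ (*-congʳ -1*-1≈1)) ⟨
      (x * z + - 1# * - 1# * (y * w)) + - 1# * (x * w + y * z) ≈⟨ lemma (- 1#) x y z w ⟩
      (x + - 1# * y) * (z + - 1# * w)                      ≈⟨ *-cong x-y≈x+-1y x-y≈x+-1y ⟨
      (x - y) * (z - w)                                    ∎
      where
      lemma : ∀ m x y z w → (x * z + m * m * (y * w)) + m * (x * w + y * z) ≈ (x + m * y) * (z + m * w)
      lemma = S.solve 5 (λ m x y z w →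
        (x :* z :+ m :* m :* (y :* w)) :+ m :* (x :* w :+ y :* z) := (x :+ m :* y) :* (z :+ m :* w)) refl

    ⟦⟧-reduce : ∀ a b → ⟦ reduce a b ⟧ ≈ a · 1# - b · 1#
    ⟦⟧-reduce zero    b       = ⟦⟧-difference zero b
    ⟦⟧-reduce (suc a) zero    = ⟦⟧-difference (suc a) zero
    ⟦⟧-reduce (suc a) (suc b) = begin
      ⟦ reduce a b ⟧                       ≈⟨ ⟦⟧-reduce a b ⟩
      a · 1# - b · 1#                      ≈⟨ +-identityˡ _ ⟨
      0# + (a · 1# - b · 1#)               ≈⟨ +-congʳ (-‿inverseʳ 1#) ⟨
      (1# - 1#) + (a · 1# - b · 1#)        ≈⟨ interchange 1# 1# (a · 1#) (b · 1#) ⟨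
      (1# + a · 1#) - (1# + b · 1#)        ≈⟨ +-cong (1+· a 1#) (-‿cong (1+· b 1#)) ⟨
      suc a · 1# - suc b · 1#              ∎

    morphism : Differences -Raw-AlmostCommutative⟶ fromCommutativeRing R
    morphism = record
      { ⟦_⟧ = ⟦_⟧
      ; +-homo = λ (a , b) (c , d) → begin
          ⟦ reduce (a ℕ.+ c) (b ℕ.+ d) ⟧              ≈⟨ ⟦⟧-reduce (a ℕ.+ c) (b ℕ.+ d) ⟩
          (a ℕ.+ c) · 1# - (b ℕ.+ d) · 1#             ≈⟨ +-cong (·-homo-+ 1# a c) (-‿cong (·-homo-+ 1# b d)) ⟩
          (a · 1# + c · 1#) - (b · 1# + d · 1#)       ≈⟨ interchange _ _ _ _ ⟩
          (a · 1# - b · 1#) + (c · 1# - d · 1#)       ≈⟨ +-cong (⟦⟧-difference a b) (⟦⟧-difference c d) ⟨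
          ⟦ a , b ⟧ + ⟦ c , d ⟧                       ∎
      ; *-homo = λ (a , b) (c , d) → begin
          ⟦ reduce (a ℕ.* c ℕ.+ b ℕ.* d) (a ℕ.* d ℕ.+ b ℕ.* c) ⟧ ≈⟨ ⟦⟧-reduce (a ℕ.* c ℕ.+ b ℕ.* d) (a ℕ.* d ℕ.+ b ℕ.* c) ⟩
          (a ℕ.* c ℕ.+ b ℕ.* d) · 1# - (a ℕ.* d ℕ.+ b ℕ.* c) · 1#
            ≈⟨ +-cong (·-homo-+* a c b d) (-‿cong (·-homo-+* a d b c)) ⟩
          (a · 1# * (c · 1#) + b · 1# * (d · 1#)) - (a · 1# * (d · 1#) + b · 1# * (c · 1#)) ≈⟨ *-difference _ _ _ _ ⟩
          (a · 1# - b · 1#) * (c · 1# - d · 1#)       ≈⟨ *-cong (⟦⟧-difference a b) (⟦⟧-difference c d) ⟨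
          ⟦ a , b ⟧ * ⟦ c , d ⟧                       ∎
      ; -‿homo = λ (a , b) → begin
          ⟦ b , a ⟧            ≈⟨ ⟦⟧-difference b a ⟩
          b · 1# - a · 1#      ≈⟨ ⁻¹-anti-homo‿- (a · 1#) (b · 1#) ⟨
          - (a · 1# - b · 1#)  ≈⟨ -‿cong (⟦⟧-difference a b) ⟨
          - ⟦ a , b ⟧          ∎
      ; 0-homo = refl
      ; 1-homo = refl
      }
      where
      ·-homo-+* : ∀ a c b d → (a ℕ.* c ℕ.+ b ℕ.* d) · 1# ≈ a · 1# * (c · 1#) + b · 1# * (d · 1#)
      ·-homo-+* a c b d =
        trans (·-homo-+ 1# (a ℕ.* c) (b ℕ.* d)) (+-cong (×1-homo-* a c) (×1-homo-* b d))

    _≟_ : ∀ p q → Maybe (⟦ p ⟧ ≈ ⟦ q ⟧)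
    (a , b) ≟ (c , d) with a ℕ.+ d ℕ.≟ c ℕ.+ b
    ... | yes a+d≡c+b = just (begin
      ⟦ a , b ⟧                            ≈⟨ ⟦⟧-difference a b ⟩
      a · 1# - b · 1#                      ≈⟨ shift (a · 1#) (b · 1#) (d · 1#) ⟩
      (a · 1# + d · 1#) - (b · 1# + d · 1#)  ≈⟨ +-cong (·-homo-+ 1# a d) (-‿cong (+-comm (d · 1#) (b · 1#))) ⟨
      (a ℕ.+ d) · 1# - (d · 1# + b · 1#)    ≡⟨ ≡.cong (λ k → k · 1# - (d · 1# + b · 1#)) a+d≡c+b ⟩
      (c ℕ.+ b) · 1# - (d · 1# + b · 1#)    ≈⟨ +-congʳ (·-homo-+ 1# c b) ⟩
      (c · 1# + b · 1#) - (d · 1# + b · 1#) ≈⟨ shift (c · 1#) (d · 1#) (b · 1#) ⟨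
      c · 1# - d · 1#                      ≈⟨ ⟦⟧-difference c d ⟨
      ⟦ c , d ⟧                            ∎)
      where
      shift : ∀ x y z → x - y ≈ (x + z) - (y + z)
      shift x y z = sym (trans (interchange x y z z) (trans (+-congˡ (-‿inverseʳ z)) (+-identityʳ _)))
    ... | no _ = nothing

  open Algebra.Solver.Ring Differences (fromCommutativeRing R) morphism _≟_ public
    using (solve; con; _:+_; _:*_; _:-_; :-_; _:=_)

-- Apartness in Heyting fields.

module HeytingFieldProperties (K : HeytingField 0ℓ 0ℓ 0ℓ) where

  open HeytingField K hiding (zero)
  open HeytingCommutativeRing heytingCommutativeRing using (commutativeRing)
  open Algebra.Apartness.Properties.HeytingCommutativeRing heytingCommutativeRing
  open Algebra.Properties.Semiring.Sum (CommutativeRing.semiring commutativeRing) using (sum)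
  open DifferenceSolver commutativeRing using (solve; _:+_; _:-_; _:=_)
  open Relation.Binary.Reasoning.Setoid setoid

  #0⇒invertible : ∀ {x} → x # 0# → ∃[ y ] y * x ≈ 1#
  #0⇒invertible {x} x#0 with #⇒invertible x#0
  ... | y , y*x≈1 , _ = y , trans (*-congˡ (sym (x-0≈x x))) y*x≈1

  invertible⇒#0 : ∀ {x} y → y * x ≈ 1# → x # 0#
  invertible⇒#0 {x} y y*x≈1 = invertibleˡ⇒# (y , trans (*-congˡ (x-0≈x x)) y*x≈1)

  #⇒-#0 : ∀ {x y} → x # y → x - y # 0#
  #⇒-#0 x#y with #⇒invertible x#y
  ... | z , z*[x-y]≈1 , _ = invertible⇒#0 z z*[x-y]≈1

  *#0⇒#0ʳ : ∀ x {y} → x * y # 0# → y # 0#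
  *#0⇒#0ʳ x {y} xy#0 with #0⇒invertible xy#0
  ... | z , z*xy≈1 = invertible⇒#0 (z * x) (trans (*-assoc z x y) z*xy≈1)

  +#0⇒#0 : ∀ {x y} → x + y # 0# → x # 0# ⊎ y # 0#
  +#0⇒#0 {x} {y} x+y#0 with #-cotrans x+y#0 y
  ... | inj₂ y#0   = inj₂ y#0
  ... | inj₁ x+y#y = inj₁ (#-congʳ (x+y-y≈x x y) (#⇒-#0 x+y#y))
    where
    x+y-y≈x : ∀ x y → x + y - y ≈ x
    x+y-y≈x = solve 2 (λ x y → x :+ y :- y := x) refl

  -- Cotransitivity locates the summand. This is the source of all nonzero vectors below, in place
  -- of a case distinction on equality with 0.
  sum#0⇒∃#0 : ∀ {n} (f : Vector Carrier n) → sum f # 0# → ∃[ i ] f i # 0#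
  sum#0⇒∃#0 {zero}  f 0#0 = contradiction 0#0 (#-irrefl refl)
  sum#0⇒∃#0 {suc n} f ∑f#0 with +#0⇒#0 ∑f#0
  ... | inj₁ f₀#0 = zero , f₀#0
  ... | inj₂ ∑#0 with sum#0⇒∃#0 (f ∘ suc) ∑#0
  ...   | i , fᵢ#0 = suc i , fᵢ#0

  ¬#⇒≈ : ∀ {x y} → ¬ x # y → x ≈ y
  ¬#⇒≈ = proj₁ (tight _ _)

  #⇒≉ : ∀ {x y} → x # y → ¬ x ≈ y
  #⇒≉ x#y x≈y = #-irrefl x≈y x#y

  #0∧*≈0⇒≈0 : ∀ {x y} → x # 0# → x * y ≈ 0# → y ≈ 0#
  #0∧*≈0⇒≈0 {x} {y} x#0 xy≈0 with #0⇒invertible x#0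
  ... | z , zx≈1 = begin
    y            ≈⟨ *-identityˡ y ⟨
    1# * y       ≈⟨ *-congʳ zx≈1 ⟨
    z * x * y    ≈⟨ *-assoc z x y ⟩
    z * (x * y)  ≈⟨ *-congˡ xy≈0 ⟩
    z * 0#       ≈⟨ zeroʳ z ⟩
    0#           ∎

-- Rectangular matrices and traces.

module RectangularMatrices (R : CommutativeRing 0ℓ 0ℓ) where

  open CommutativeRing R hiding (zero)
  open Matrices R
  open Algebra.Properties.Semiring.Sum semiring
  open Algebra.Properties.Monoid.Mult +-monoid using () renaming (_×_ to _·_)
  open Relation.Binary.Reasoning.Setoid setoid

  private
    variable
      k l m n : ℕ

  infixl 7 _⊗_ _⊛_
  infix  4 _≋_ _≋ⱽ_

  Mat : ℕ → ℕ → Set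
  Mat m n = Vector (Vector Carrier n) m

  _≋_ : Mat m n → Mat m n → Set
  A ≋ B = ∀ i j → A i j ≈ B i j

  _≋ⱽ_ : Vector Carrier m → Vector Carrier m → Set
  v ≋ⱽ w = ∀ i → v i ≈ w i

  _⊗_ : Mat l m → Mat m n → Mat l n
  _⊗_ {m = m} A B i k = ∑[ j < m ] (A i j * B j k)

  _⊛_ : Mat m n → Vector Carrier n → Vector Carrier m
  _⊛_ {n = n} A v i = ∑[ j < n ] (A i j * v j)

  ⊗-cong : {A A′ : Mat l m} {B B′ : Mat m n} → A ≋ A′ → B ≋ B′ → A ⊗ B ≋ A′ ⊗ B′
  ⊗-cong p q i k = sum-cong-≋ (λ j → *-cong (p i j) (q j k))

  ⊗-congˡ : (A : Mat l m) {B B′ : Mat m n} → B ≋ B′ → A ⊗ B ≋ A ⊗ B′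
  ⊗-congˡ A q i k = sum-cong-≋ (λ j → *-congˡ (q j k))

  ⊗-congʳ : {A A′ : Mat l m} (B : Mat m n) → A ≋ A′ → A ⊗ B ≋ A′ ⊗ B
  ⊗-congʳ B p i k = sum-cong-≋ (λ j → *-congʳ (p i j))

  ⊛-congˡ : (A : Mat m n) {v w : Vector Carrier n} → v ≋ⱽ w → A ⊛ v ≋ⱽ A ⊛ w
  ⊛-congˡ A p i = sum-cong-≋ (λ j → *-congˡ (p j))

  ⊛-congʳ : {A B : Mat m n} (v : Vector Carrier n) → A ≋ B → A ⊛ v ≋ⱽ B ⊛ v
  ⊛-congʳ v p i = sum-cong-≋ (λ j → *-congʳ (p i j))

  ⊗-assoc : (A : Mat k l) (B : Mat l m) (C : Mat m n) → (A ⊗ B) ⊗ C ≋ A ⊗ (B ⊗ C)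
  ⊗-assoc {l = l} {m = m} A B C i z = begin
    ∑[ y < m ] (∑[ x < l ] (A i x * B x y) * C y z)   ≈⟨ sum-cong-≋ (λ y → *-distribʳ-sum (C y z) (λ x → A i x * B x y)) ⟩
    ∑[ y < m ] ∑[ x < l ] (A i x * B x y * C y z)     ≈⟨ ∑-comm (λ y x → A i x * B x y * C y z) ⟩
    ∑[ x < l ] ∑[ y < m ] (A i x * B x y * C y z)     ≈⟨ sum-cong-≋ (λ x → sum-cong-≋ (λ y → *-assoc (A i x) (B x y) (C y z))) ⟩
    ∑[ x < l ] ∑[ y < m ] (A i x * (B x y * C y z))   ≈⟨ sum-cong-≋ (λ x → *-distribˡ-sum (A i x) (λ y → B x y * C y z)) ⟨
    ∑[ x < l ] (A i x * ∑[ y < m ] (B x y * C y z))   ∎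

  ⊛-assoc : (A : Mat l m) (B : Mat m n) (v : Vector Carrier n) → (A ⊗ B) ⊛ v ≋ⱽ A ⊛ (B ⊛ v)
  ⊛-assoc A B v i = ⊗-assoc A B (λ j (_ : Fin 1) → v j) i zero

  -- The square case for a matrix with constant rows or columns.
  ⊛-identityˡ : (v : Vector Carrier m) → 1ᴹ ⊛ v ≋ⱽ v
  ⊛-identityˡ v i = *ᴹ-identityˡ (λ j _ → v j) i i

  ⊗-identityˡ : (A : Mat m n) → 1ᴹ ⊗ A ≋ A
  ⊗-identityˡ A i k = ⊛-identityˡ (λ j → A j k) i

  ⊗-identityʳ : (A : Mat m n) → A ⊗ 1ᴹ ≋ A
  ⊗-identityʳ A i k = *ᴹ-identityʳ (λ _ j → A i j) k k

  ⊛-+ : (A : Mat m n) (v w : Vector Carrier n) → A ⊛ (λ j → v j + w j) ≋ⱽ (λ i → (A ⊛ v) i + (A ⊛ w) i)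
  ⊛-+ A v w i = trans (sum-cong-≋ (λ j → distribˡ (A i j) (v j) (w j)))
                        (∑-distrib-+ (λ j → A i j * v j) (λ j → A i j * w j))

  ⊛-* : (A : Mat m n) (x : Carrier) (v : Vector Carrier n) → A ⊛ (λ j → x * v j) ≋ⱽ (λ i → x * (A ⊛ v) i)
  ⊛-* A x v i = trans (sum-cong-≋ swap) (sym (*-distribˡ-sum x (λ j → A i j * v j)))
    where
    swap : ∀ j → A i j * (x * v j) ≈ x * (A i j * v j)
    swap j = trans (sym (*-assoc _ _ _)) (trans (*-congʳ (*-comm _ _)) (*-assoc _ _ _))

  ⊛-zero : (A : Mat m n) → A ⊛ const 0# ≋ⱽ const 0#
  ⊛-zero {n = n} A i = trans (sum-cong-≋ (λ j → zeroʳ (A i j))) (sum-replicate-zero n)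

  trace : Matrix m → Carrier
  trace {m} A = ∑[ i < m ] A i i

  trace-cong : {A B : Matrix m} → A ≋ B → trace A ≈ trace B
  trace-cong p = sum-cong-≋ (λ i → p i i)

  trace-comm : (A : Mat m n) (B : Mat n m) → trace (A ⊗ B) ≈ trace (B ⊗ A)
  trace-comm A B =
    trans (∑-comm (λ i j → A i j * B j i)) (sum-cong-≋ (λ j → sum-cong-≋ (λ i → *-comm (A i j) (B j i))))

  trace-1ᴹ : ∀ m → trace (1ᴹ {m}) ≈ m · 1#
  trace-1ᴹ zero    = refl
  trace-1ᴹ (suc m) = +-congˡ (trace-1ᴹ m)

-- Intertwiners and Schur's lemma.

module Schur (K : HeytingField 0ℓ 0ℓ 0ℓ) (G : Group 0ℓ 0ℓ) where

  open HeytingField K hiding (zero)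
  open HeytingCommutativeRing heytingCommutativeRing using (commutativeRing)
  open HeytingFieldProperties K
  open Matrices commutativeRing
  open RectangularMatrices commutativeRing
  open Representations K G
  open DifferenceSolver commutativeRing using (solve; con; _:+_; _:*_; :-_; _:=_)
  open Algebra.Properties.Monoid.Mult (CommutativeRing.+-monoid commutativeRing)
    using () renaming (_×_ to _·_)
  open Algebra.Properties.Ring (CommutativeRing.ring commutativeRing) using (+-cancelˡ)
  open Relation.Binary.Reasoning.Setoid setoid
  private module G = Group G

  module _ {m} (ρ : Representation m) where
    open GroupMorphisms.IsGroupHomomorphism (isGroupHomomorphism ρ)

    act-cong : ∀ {g h} → g G.≈ h → act ρ g ≋ act ρ h
    act-cong = ⟦⟧-cong

    act-∙ : ∀ g h → act ρ (g G.∙ h) ≋ act ρ g ⊗ act ρ h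
    act-∙ = homo

    act-ε : act ρ G.ε ≋ 1ᴹ
    act-ε = ε-homo

    act-inverseˡ : ∀ g → act ρ (g G.⁻¹) ⊗ act ρ g ≋ 1ᴹ
    act-inverseˡ g i j = begin
      (act ρ (g G.⁻¹) ⊗ act ρ g) i j  ≈⟨ act-∙ (g G.⁻¹) g i j ⟨
      act ρ (g G.⁻¹ G.∙ g) i j        ≈⟨ act-cong (G.inverseˡ g) i j ⟩
      act ρ G.ε i j                   ≈⟨ act-ε i j ⟩
      1ᴹ i j                          ∎

    act-inverseʳ : ∀ g → act ρ g ⊗ act ρ (g G.⁻¹) ≋ 1ᴹ
    act-inverseʳ g i j = begin
      (act ρ g ⊗ act ρ (g G.⁻¹)) i j  ≈⟨ act-∙ g (g G.⁻¹) i j ⟨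
      act ρ (g G.∙ g G.⁻¹) i j        ≈⟨ act-cong (G.inverseʳ g) i j ⟩
      act ρ G.ε i j                   ≈⟨ act-ε i j ⟩
      1ᴹ i j                          ∎

  -- Stated for a single group element: the property is checked on the two generators and then
  -- carried to all words by the closure lemmas for the unit, products and inverses.
  Intertwines : ∀ {d m} → Representation d → Representation m → Mat m d → G.Carrier → Set
  Intertwines ρ σ V g = V ⊗ act ρ g ≋ act σ g ⊗ V

  module _ {d m} (ρ : Representation d) (σ : Representation m) (V : Mat m d) where

    intertwines-ε : Intertwines ρ σ V G.ε
    intertwines-ε i j = begin
      (V ⊗ act ρ G.ε) i j  ≈⟨ ⊗-congˡ V (act-ε ρ) i j ⟩
      (V ⊗ 1ᴹ) i j         ≈⟨ ⊗-identityʳ V i j ⟩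
      V i j                ≈⟨ ⊗-identityˡ V i j ⟨
      (1ᴹ ⊗ V) i j         ≈⟨ ⊗-congʳ V (act-ε σ) i j ⟨
      (act σ G.ε ⊗ V) i j  ∎

    intertwines-∙ : ∀ {g h} → Intertwines ρ σ V g → Intertwines ρ σ V h → Intertwines ρ σ V (g G.∙ h)
    intertwines-∙ {g} {h} p q i j = begin
      (V ⊗ act ρ (g G.∙ h)) i j        ≈⟨ ⊗-congˡ V (act-∙ ρ g h) i j ⟩
      (V ⊗ (act ρ g ⊗ act ρ h)) i j    ≈⟨ ⊗-assoc V (act ρ g) (act ρ h) i j ⟨
      (V ⊗ act ρ g ⊗ act ρ h) i j      ≈⟨ ⊗-congʳ (act ρ h) p i j ⟩
      (act σ g ⊗ V ⊗ act ρ h) i j      ≈⟨ ⊗-assoc (act σ g) V (act ρ h) i j ⟩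
      (act σ g ⊗ (V ⊗ act ρ h)) i j    ≈⟨ ⊗-congˡ (act σ g) q i j ⟩
      (act σ g ⊗ (act σ h ⊗ V)) i j    ≈⟨ ⊗-assoc (act σ g) (act σ h) V i j ⟨
      (act σ g ⊗ act σ h ⊗ V) i j      ≈⟨ ⊗-congʳ V (act-∙ σ g h) i j ⟨
      (act σ (g G.∙ h) ⊗ V) i j        ∎

    intertwines-⁻¹ : ∀ {g} → Intertwines ρ σ V g → Intertwines ρ σ V (g G.⁻¹)
    intertwines-⁻¹ {g} p i j = begin
      (V ⊗ ρ⁻) i j                       ≈⟨ ⊗-identityˡ (V ⊗ ρ⁻) i j ⟨
      (1ᴹ ⊗ (V ⊗ ρ⁻)) i j                ≈⟨ ⊗-congʳ (V ⊗ ρ⁻) (act-inverseˡ σ g) i j ⟨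
      (σ⁻ ⊗ act σ g ⊗ (V ⊗ ρ⁻)) i j      ≈⟨ ⊗-assoc σ⁻ (act σ g) (V ⊗ ρ⁻) i j ⟩
      (σ⁻ ⊗ (act σ g ⊗ (V ⊗ ρ⁻))) i j    ≈⟨ ⊗-congˡ σ⁻ (⊗-assoc (act σ g) V ρ⁻) i j ⟨
      (σ⁻ ⊗ (act σ g ⊗ V ⊗ ρ⁻)) i j      ≈⟨ ⊗-congˡ σ⁻ (⊗-congʳ ρ⁻ p) i j ⟨
      (σ⁻ ⊗ (V ⊗ act ρ g ⊗ ρ⁻)) i j      ≈⟨ ⊗-congˡ σ⁻ (⊗-assoc V (act ρ g) ρ⁻) i j ⟩
      (σ⁻ ⊗ (V ⊗ (act ρ g ⊗ ρ⁻))) i j    ≈⟨ ⊗-congˡ σ⁻ (⊗-congˡ V (act-inverseʳ ρ g)) i j ⟩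
      (σ⁻ ⊗ (V ⊗ 1ᴹ)) i j                ≈⟨ ⊗-congˡ σ⁻ (⊗-identityʳ V) i j ⟩
      (σ⁻ ⊗ V) i j                       ∎
      where
      ρ⁻ = act ρ (g G.⁻¹)
      σ⁻ = act σ (g G.⁻¹)

  ≅⇒trace : ∀ {d m} {ρ : Representation d} {σ : Representation m} → ρ ≅ σ →
            ∀ g → trace (act ρ g) ≈ trace (act σ g)
  ≅⇒trace {ρ = ρ} {σ = σ} (conjugate P p) g = begin
    trace (act ρ g)                                ≈⟨ trace-cong (⊗-identityˡ (act ρ g)) ⟨
    trace (1ᴹ ⊗ act ρ g)                           ≈⟨ trace-cong (⊗-congʳ (act ρ g) P⁻¹P≋1) ⟨
    trace (P⁻¹ ⊗ matrix P ⊗ act ρ g)               ≈⟨ trace-cong (⊗-assoc P⁻¹ (matrix P) (act ρ g)) ⟩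
    trace (P⁻¹ ⊗ (matrix P ⊗ act ρ g))             ≈⟨ trace-cong (⊗-congˡ P⁻¹ (p g)) ⟩
    trace (P⁻¹ ⊗ (act σ g ⊗ matrix P))             ≈⟨ trace-comm P⁻¹ (act σ g ⊗ matrix P) ⟩
    trace (act σ g ⊗ matrix P ⊗ P⁻¹)               ≈⟨ trace-cong (⊗-assoc (act σ g) (matrix P) P⁻¹) ⟩
    trace (act σ g ⊗ (matrix P ⊗ P⁻¹))             ≈⟨ trace-cong (⊗-congˡ (act σ g) PP⁻¹≋1) ⟩
    trace (act σ g ⊗ 1ᴹ)                           ≈⟨ trace-cong (⊗-identityʳ (act σ g)) ⟩
    trace (act σ g)                                ∎
    where open InvertibleMatrix P renaming (inverse to P⁻¹; inverseˡ to P⁻¹P≋1; inverseʳ to PP⁻¹≋1)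

  module _ (suc·1#0 : ∀ k → suc k · 1# # 0#) where

    -- Characteristic zero makes the trace of an identity matrix determine its size.
    ·1-injective : ∀ m n → m · 1# ≈ n · 1# → m ≡ n
    ·1-injective zero    zero    _   = ≡.refl
    ·1-injective zero    (suc n) 0≈n = contradiction (sym 0≈n) (#⇒≉ (suc·1#0 n))
    ·1-injective (suc m) zero    m≈0 = contradiction m≈0 (#⇒≉ (suc·1#0 m))
    ·1-injective (suc m) (suc n) m≈n = ≡.cong suc (·1-injective m n (+-cancelˡ 1# _ _ m≈n))

    inverses⇒≡ : ∀ {m d} (V : Mat m d) (C : Mat d m) → V ⊗ C ≋ 1ᴹ → C ⊗ V ≋ 1ᴹ → m ≡ d
    inverses⇒≡ {m} {d} V C VC≋1 CV≋1 = ·1-injective m d (begin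
      m · 1#         ≈⟨ trace-1ᴹ m ⟨
      trace (1ᴹ {m}) ≈⟨ trace-cong VC≋1 ⟨
      trace (V ⊗ C)  ≈⟨ trace-comm V C ⟩
      trace (C ⊗ V)  ≈⟨ trace-cong CV≋1 ⟩
      trace (1ᴹ {d}) ≈⟨ trace-1ᴹ d ⟩
      d · 1#         ∎)

    module _ {d m} {ρ : Representation d} {σ : Representation m} (V : Mat m d)
             (V-intertwines : ∀ g → Intertwines ρ σ V g) where

      private
        Image : Vector Carrier m → Set
        Image x = ∃[ c ] x ≋ⱽ V ⊛ c

        Kernel : Vector Carrier d → Set
        Kernel c = V ⊛ c ≋ⱽ const 0#

        V⊛ρ : ∀ g c → V ⊛ (act ρ g ⊛ c) ≋ⱽ act σ g ⊛ (V ⊛ c)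
        V⊛ρ g c i = begin
          (V ⊛ (act ρ g ⊛ c)) i  ≈⟨ ⊛-assoc V (act ρ g) c i ⟨
          (V ⊗ act ρ g ⊛ c) i    ≈⟨ ⊛-congʳ c (V-intertwines g) i ⟩
          (act σ g ⊗ V ⊛ c) i    ≈⟨ ⊛-assoc (act σ g) V c i ⟩
          (act σ g ⊛ (V ⊛ c)) i  ∎

        Image-invariant : IsInvariantSubspace σ Image
        Image-invariant = record
          { resp-≈    = λ v≈w (c , p) → c , λ i → trans (sym (v≈w i)) (p i)
          ; 0-closed  = const 0# , λ i → sym (⊛-zero V i)
          ; +-closed  = λ (c , p) (d , q) → (λ j → c j + d j) , λ i →
              trans (+-cong (p i) (q i)) (sym (⊛-+ V c d i))
          ; *-closed  = λ x (c , p) → (λ j → x * c j) , λ i → trans (*-congˡ (p i)) (sym (⊛-* V x c i))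
          ; invariant = λ g (c , p) → act ρ g ⊛ c , λ i →
              trans (⊛-congˡ (act σ g) p i) (sym (V⊛ρ g c i))
          }

        Kernel-invariant : IsInvariantSubspace ρ Kernel
        Kernel-invariant = record
          { resp-≈    = λ v≈w p i → trans (sym (⊛-congˡ V v≈w i)) (p i)
          ; 0-closed  = ⊛-zero V
          ; +-closed  = λ {v} {w} p q i → trans (⊛-+ V v w i) (trans (+-cong (p i) (q i)) (+-identityʳ 0#))
          ; *-closed  = λ x {v} p i → trans (⊛-* V x v i) (trans (*-congˡ (p i)) (zeroʳ x))
          ; invariant = λ g {v} p i →
              trans (V⊛ρ g v i) (trans (⊛-congˡ (act σ g) p i) (⊛-zero (act σ g) i))
          }

        column : ∀ j → V ⊛ (λ i → 1ᴹ i j) ≋ⱽ (λ i → V i j)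
        column j i = ⊗-identityʳ V i j

      schur : IsIrreducible ρ → IsIrreducible σ → (∃[ i ] ∃[ j ] V i j # 0#) → σ ≅ ρ
      schur ρ-irreducible σ-irreducible (i₀ , j₀ , Vᵢⱼ#0) = equivalent (inverses⇒≡ V C VC≋1 CV≋1)
        where
        surjective : ∀ x → Image x
        surjective = IsIrreducible.simple σ-irreducible Image Image-invariant (λ i → V i j₀)
          ((λ i → 1ᴹ i j₀) , λ i → sym (column j₀ i)) (i₀ , Vᵢⱼ#0)

        injective : ∀ {c} → Kernel c → ∀ j → c j ≈ 0#
        -- A kernel vector with an entry apart from 0 would make the kernel everything; the basis
        -- vector of index `j₀` would then be killed, although column `j₀` of V has an entry apart
        -- from 0. Tightness turns this refutation into equality with 0.
        injective {c} Vc≈0 j = ¬#⇒≈ λ cⱼ#0 → #⇒≉ Vᵢⱼ#0 (trans (sym (column j₀ i₀))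
          (IsIrreducible.simple ρ-irreducible Kernel Kernel-invariant c Vc≈0 (j , cⱼ#0) (λ i → 1ᴹ i j₀) i₀))

        C : Mat d m
        -- The columns of C are the preimages of the basis vectors that surjectivity provides.
        C j k = proj₁ (surjective (λ i → 1ᴹ i k)) j

        VC≋1 : V ⊗ C ≋ 1ᴹ
        VC≋1 i k = sym (proj₂ (surjective (λ i → 1ᴹ i k)) i)

        CV≋1 : C ⊗ V ≋ 1ᴹ
        -- The columns of C V - 1 lie in the kernel of V, because V (C V - 1) = (V C) V - V = 0.
        CV≋1 j k = begin
          (C ⊗ V) j k                               ≈⟨ split ((C ⊗ V) j k) (1ᴹ j k) ⟩
          ((C ⊗ V) j k + - 1# * 1ᴹ j k) + 1ᴹ j k    ≈⟨ +-congʳ (injective difference j) ⟩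
          0# + 1ᴹ j k                               ≈⟨ +-identityˡ _ ⟩
          1ᴹ j k                                    ∎
          where
          split : ∀ x y → x ≈ (x + - 1# * y) + y
          split = solve 2 (λ x y → x := (x :+ :- con (1 , 0) :* y) :+ y) refl

          cancel : ∀ x → x + - 1# * x ≈ 0#
          cancel = solve 1 (λ x → x :+ :- con (1 , 0) :* x := con (0 , 0)) refl

          difference : Kernel (λ i → (C ⊗ V) i k + - 1# * 1ᴹ i k)
          difference i = begin
            (V ⊛ (λ i → (C ⊗ V) i k + - 1# * 1ᴹ i k)) i     ≈⟨ ⊛-+ V (λ i → (C ⊗ V) i k) (λ i → - 1# * 1ᴹ i k) i ⟩
            (V ⊗ (C ⊗ V)) i k + (V ⊛ (λ i → - 1# * 1ᴹ i k)) i ≈⟨ +-cong (sym (⊗-assoc V C V i k)) (⊛-* V (- 1#) (λ i → 1ᴹ i k) i) ⟩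
            (V ⊗ C ⊗ V) i k + - 1# * (V ⊗ 1ᴹ) i k             ≈⟨ +-cong (⊗-congʳ V VC≋1 i k) (*-congˡ (⊗-identityʳ V i k)) ⟩
            (1ᴹ ⊗ V) i k + - 1# * V i k                       ≈⟨ +-congʳ (⊗-identityˡ V i k) ⟩
            V i k + - 1# * V i k                              ≈⟨ cancel (V i k) ⟩
            0#                                                ∎

        equivalent : m ≡ d → σ ≅ ρ
        -- `_≅_` relates only representations of the same degree, so the degrees must be identified
        -- before C can be used as the conjugating matrix.
        equivalent ≡.refl = conjugate P λ g i j → begin
          (C ⊗ act σ g) i j              ≈⟨ ⊗-identityʳ (C ⊗ act σ g) i j ⟨
          (C ⊗ act σ g ⊗ 1ᴹ) i j         ≈⟨ ⊗-congˡ (C ⊗ act σ g) VC≋1 i j ⟨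
          (C ⊗ act σ g ⊗ (V ⊗ C)) i j    ≈⟨ ⊗-assoc (C ⊗ act σ g) V C i j ⟨
          (C ⊗ act σ g ⊗ V ⊗ C) i j      ≈⟨ ⊗-congʳ C (⊗-assoc C (act σ g) V) i j ⟩
          (C ⊗ (act σ g ⊗ V) ⊗ C) i j    ≈⟨ ⊗-congʳ C (⊗-congˡ C (V-intertwines g)) i j ⟨
          (C ⊗ (V ⊗ act ρ g) ⊗ C) i j    ≈⟨ ⊗-congʳ C (⊗-assoc C V (act ρ g)) i j ⟨
          (C ⊗ V ⊗ act ρ g ⊗ C) i j      ≈⟨ ⊗-congʳ C (⊗-congʳ (act ρ g) CV≋1) i j ⟩
          (1ᴹ ⊗ act ρ g ⊗ C) i j         ≈⟨ ⊗-congʳ C (⊗-identityˡ (act ρ g)) i j ⟩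
          (act ρ g ⊗ C) i j              ∎
          where
          P : InvertibleMatrix d
          P = record { matrix = C ; inverse = V ; inverseˡ = VC≋1 ; inverseʳ = CV≋1 }

-- Homomorphisms out of a presented group.

module WordEvaluation {X : Set} (H : Group c ℓ) (f : X → Group.Carrier H) where

  open Group H
  open Algebra.Properties.Monoid.Mult monoid using () renaming (_×_ to _·_)
  private module P = Presentation X

  eval : P.Word → Carrier
  eval (P.gen x) = f x
  eval P.ε       = ε
  eval (u P.∙ v) = eval u ∙ eval v
  eval (u P.⁻¹)  = eval u ⁻¹

  eval-^ : ∀ w k → eval (w P.^ k) ≡ k · eval w
  eval-^ w zero    = ≡.refl
  eval-^ w (suc k) = ≡.cong (eval w ∙_) (eval-^ w k)

  module _ {R : Rel P.Word 0ℓ} (relators : ∀ {u v} → R u v → eval u ≈ eval v) where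

    eval-cong : ∀ {u v} → P._∼_ R u v → eval u ≈ eval v
    eval-cong (P.relator r)    = relators r
    eval-cong P.refl           = refl
    eval-cong (P.sym p)        = sym (eval-cong p)
    eval-cong (P.trans p q)    = trans (eval-cong p) (eval-cong q)
    eval-cong (P.∙-cong p q)   = ∙-cong (eval-cong p) (eval-cong q)
    eval-cong (P.⁻¹-cong p)    = ⁻¹-cong (eval-cong p)
    eval-cong (P.assoc u v w)  = assoc (eval u) (eval v) (eval w)
    eval-cong (P.identityˡ u)  = identityˡ (eval u)
    eval-cong (P.identityʳ u)  = identityʳ (eval u)
    eval-cong (P.inverseˡ u)   = inverseˡ (eval u)
    eval-cong (P.inverseʳ u)   = inverseʳ (eval u)

    eval-isGroupHomomorphism :
      GroupMorphisms.IsGroupHomomorphism (Group.rawGroup (P.⟨_∣_⟩ R)) rawGroup eval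
    eval-isGroupHomomorphism = record
      { isMonoidHomomorphism = record
        { isMagmaHomomorphism = record
          { isRelHomomorphism = record { cong = eval-cong }
          ; homo = λ _ _ → refl
          }
        ; ε-homo = refl
        }
      ; ⁻¹-homo = λ _ → refl
      }

module T₈ₙ-Homomorphisms (n : ℕ) (H : Group c ℓ) (x y : Group.Carrier H) where

  open Group H
  open Algebra.Properties.Monoid.Mult monoid using () renaming (_×_ to _·_; ×-homo-+ to ·-homo-+)
  open Relation.Binary.Reasoning.Setoid setoid

  assign : Gen → Carrier
  assign ‵a = x
  assign ‵b = y

  open WordEvaluation H assign public

  module _ (nx≈4y : n · x ≈ 4 · y) (8y≈ε : 8 · y ≈ ε) (xy≈yx⁻¹ : x ∙ y ≈ y ∙ x ⁻¹) where

    -- The first relator holds by a²ⁿ = b⁴ b⁴ = b⁸ = e. The conjugation relation is taken in the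
    -- form ab = ba⁻¹, which can be compared entry by entry for explicit matrices.
    T₈ₙ-relators : ∀ {u v} → T₈ₙ-Relator n u v → eval u ≈ eval v
    T₈ₙ-relators a²ⁿ=e = begin
      eval (Presentation._^_ Gen a (2 ℕ.* n))  ≡⟨ eval-^ a (2 ℕ.* n) ⟩
      (n ℕ.+ (n ℕ.+ 0)) · x    ≡⟨ ≡.cong (λ k → (n ℕ.+ k) · x) (ℕ.+-identityʳ n) ⟩
      (n ℕ.+ n) · x            ≈⟨ ·-homo-+ x n n ⟩
      n · x ∙ n · x            ≈⟨ ∙-cong nx≈4y nx≈4y ⟩
      4 · y ∙ 4 · y            ≈⟨ ·-homo-+ y 4 4 ⟨
      8 · y                    ≈⟨ 8y≈ε ⟩
      ε                        ∎
    T₈ₙ-relators b⁸=e = 8y≈ε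
    T₈ₙ-relators aⁿ=b⁴ = trans (reflexive (eval-^ a n)) nx≈4y
    T₈ₙ-relators b⁻¹ab=a⁻¹ = begin
      y ⁻¹ ∙ x ∙ y       ≈⟨ assoc (y ⁻¹) x y ⟩
      y ⁻¹ ∙ (x ∙ y)     ≈⟨ ∙-congˡ xy≈yx⁻¹ ⟩
      y ⁻¹ ∙ (y ∙ x ⁻¹)  ≈⟨ assoc (y ⁻¹) y (x ⁻¹) ⟨
      y ⁻¹ ∙ y ∙ x ⁻¹    ≈⟨ ∙-congʳ (inverseˡ y) ⟩
      ε ∙ x ⁻¹           ≈⟨ identityˡ (x ⁻¹) ⟩
      x ⁻¹               ∎

-- `even` is a divisibility test and does not reduce on a variable; its value is therefore delivered
-- together with the half that rewrites exponents.
even-or-odd : ∀ k → (even k ≡ true × ∃[ q ] k ≡ q ℕ.* 2) ⊎ (even k ≡ false × ∃[ q ] k ≡ suc (q ℕ.* 2))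
even-or-odd k with parity k
  where
  parity : ∀ k → ∃[ q ] (k ≡ q ℕ.* 2 ⊎ k ≡ suc (q ℕ.* 2))
  parity zero    = 0 , inj₁ ≡.refl
  parity (suc k) with parity k
  ... | q , inj₁ k≡2q   = q , inj₂ (≡.cong suc k≡2q)
  ... | q , inj₂ k≡1+2q = suc q , inj₁ (≡.cong suc k≡1+2q)
... | q , inj₁ k≡2q   = inj₁ (dec-true (2 ∣? k) (divides q k≡2q) , q , k≡2q)
... | q , inj₂ k≡1+2q = inj₂ (dec-false (2 ∣? k) 2∤k , q , k≡1+2q)
  where
  2∤k : ¬ 2 ∣ k
  2∤k 2∣k = contradiction (∣⇒≤ (∣m+n∣m⇒∣n {2} {q ℕ.* 2} {1}
    (≡.subst (2 ∣_) (≡.trans k≡1+2q (ℕ.+-comm 1 (q ℕ.* 2))) 2∣k) (divides q ≡.refl))) λ { (ℕ.s≤s ()) }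

-- Powers and geometric sums.

module RangeSums (R : CommutativeRing 0ℓ 0ℓ) where

  open CommutativeRing R hiding (zero)
  open Algebra.Properties.Semiring.Sum semiring
  open Algebra.Properties.CommutativeSemiring.Exp commutativeSemiring
  open Relation.Binary.Reasoning.Setoid setoid

  1^n≈1 : ∀ n → 1# ^ n ≈ 1#
  1^n≈1 zero    = refl
  1^n≈1 (suc n) = trans (*-identityˡ _) (1^n≈1 n)

  ^-inverse : ∀ {x y} → x * y ≈ 1# → ∀ k → x ^ k * y ^ k ≈ 1#
  ^-inverse {x} {y} xy≈1 k = trans (sym (^-distrib-* x y k)) (trans (^-congˡ k xy≈1) (1^n≈1 k))

  ^-comm : ∀ x j k → (x ^ j) ^ k ≈ (x ^ k) ^ j
  ^-comm x j k = trans (^-assocʳ x j k) (trans (^-congʳ x (ℕ.*-comm j k)) (sym (^-assocʳ x k j)))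

  sum-snoc : ∀ (f : ℕ → Carrier) N → ∑[ j < suc N ] f (toℕ j) ≈ ∑[ j < N ] f (toℕ j) + f N
  sum-snoc f zero    = +-comm (f 0) 0#
  sum-snoc f (suc N) = trans (+-congˡ (sum-snoc (f ∘ suc) N)) (sym (+-assoc (f 0) _ _))

  -- Shifting the index gives S = y S because yᴺ = 1, hence x S = S. The factor involves the inverse
  -- x of y because `fourier` sums powers of η while apartness from 1 is known for powers of ζ.
  geometric-sum≈0 : ∀ N {x y} → x * y ≈ 1# → y ^ N ≈ 1# → (x - 1#) * (∑[ k < N ] (y ^ toℕ k)) ≈ 0#
  geometric-sum≈0 N {x} {y} xy≈1 yᴺ≈1 = begin
    (x - 1#) * S     ≈⟨ expand x S ⟩
    x * S - S        ≈⟨ +-congʳ (*-congˡ S≈yS) ⟩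
    x * (y * S) - S  ≈⟨ +-congʳ (trans (sym (*-assoc x y S)) (trans (*-congʳ xy≈1) (*-identityˡ S))) ⟩
    S - S            ≈⟨ -‿inverseʳ S ⟩
    0#               ∎
    where
    open DifferenceSolver R using (solve; con; _:*_; _:+_; _:-_; _:=_)
    S = ∑[ k < N ] (y ^ toℕ k)

    expand : ∀ x s → (x - 1#) * s ≈ x * s - s
    expand = solve 2 (λ x s → (x :- con (1 , 0)) :* s := x :* s :- s) refl

    s+1-1≈s : ∀ s → (s + 1#) - 1# ≈ s
    s+1-1≈s = solve 1 (λ s → (s :+ con (1 , 0)) :- con (1 , 0) := s) refl

    1+s-1≈s : ∀ s → (1# + s) - 1# ≈ s
    1+s-1≈s = solve 1 (λ s → (con (1 , 0) :+ s) :- con (1 , 0) := s) refl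

    S≈yS : S ≈ y * S
    S≈yS = begin
      S                                    ≈⟨ s+1-1≈s S ⟨
      (S + 1#) - 1#                        ≈⟨ +-congʳ (+-congˡ yᴺ≈1) ⟨
      (S + y ^ N) - 1#                     ≈⟨ +-congʳ (sum-snoc (y ^_) N) ⟨
      (1# + ∑[ k < N ] (y * y ^ toℕ k)) - 1#  ≈⟨ 1+s-1≈s (∑[ k < N ] (y * y ^ toℕ k)) ⟩
      ∑[ k < N ] (y * y ^ toℕ k)              ≈⟨ *-distribˡ-sum y (λ (k : Fin N) → y ^ toℕ k) ⟨
      y * S                                   ∎

-- Eigenvectors of operators of finite order.

module Eigenvectors (K : HeytingField 0ℓ 0ℓ 0ℓ) where

  open HeytingField K hiding (zero)
  open HeytingCommutativeRing heytingCommutativeRing using (commutativeRing)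
  open CommutativeRing commutativeRing using (commutativeSemiring; semiring; +-monoid)
  open Algebra.Apartness.Properties.HeytingCommutativeRing heytingCommutativeRing
    using (#-congʳ; x#0y#0→xy#0)
  open Algebra.Properties.Semiring.Sum semiring
  open Algebra.Properties.CommutativeSemiring.Exp commutativeSemiring
  open Algebra.Properties.Monoid.Mult +-monoid using () renaming (_×_ to _·_)
  open HeytingFieldProperties K
  open RectangularMatrices commutativeRing
  open RangeSums commutativeRing
  open DifferenceSolver commutativeRing using (solve; con; _:+_; _:*_; _:-_; :-_; _:=_)
  open Relation.Binary.Reasoning.Setoid setoid

  NonZeroⱽ : ∀ {m} → Vector Carrier m → Set
  NonZeroⱽ v = ∃[ i ] v i # 0#

  Eigenvector : ∀ {m} → Mat m m → Carrier → Vector Carrier m → Set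
  Eigenvector M s v = M ⊛ v ≋ⱽ λ i → s * v i

  NonZeroⱽ-preimage : ∀ {m n} (M : Mat m n) v → NonZeroⱽ (M ⊛ v) → NonZeroⱽ v
  NonZeroⱽ-preimage M v (i , Mvᵢ#0) with sum#0⇒∃#0 (λ j → M i j * v j) Mvᵢ#0
  ... | j , Mᵢⱼvⱼ#0 = j , *#0⇒#0ʳ (M i j) Mᵢⱼvⱼ#0

  -- v is a scalar multiple of the sum of its components ∑ⱼ ζ⁻ʲᵏ uⱼ for k < N,
  -- where uⱼ = Mʲ v, and these are eigenvectors of M.
  fourier : ∀ {m} (M : Mat m m) N .{{_ : NonZero N}} ζ η → ζ * η ≈ 1# → ζ ^ N ≈ 1# →
            (∀ j → 0 ℕ.< j → j ℕ.< N → ζ ^ j - 1# # 0#) → N · 1# # 0# →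
            (u : ℕ → Vector Carrier m) → (∀ j → M ⊛ u j ≋ⱽ u (suc j)) → u N ≋ⱽ u 0 →
            NonZeroⱽ (u 0) →
            ∃[ k ] ∃[ v ] k ℕ.< N × Eigenvector M (ζ ^ k) v × NonZeroⱽ v
  fourier {m} M (suc N) ζ η ζη≈1 ζᴺ≈1 ζʲ#1 N#0 u Mu≈u uᴺ≈u⁰ (i , uᵢ#0) =
    toℕ (proj₁ some) , component (toℕ (proj₁ some)) , Fin.toℕ<n (proj₁ some) ,
    component-eigen (toℕ (proj₁ some)) , i , proj₂ some
    where
    component : ℕ → Vector Carrier m
    component k i = ∑[ j < suc N ] (u (toℕ j) i * (η ^ k) ^ toℕ j)

    η^suc : ∀ k → (η ^ k) ^ suc N ≈ 1#
    η^suc k = begin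
      (η ^ k) ^ suc N                ≈⟨ ^-comm η k (suc N) ⟩
      (η ^ suc N) ^ k                ≈⟨ ^-congˡ k (*-identityˡ _) ⟨
      (1# * η ^ suc N) ^ k           ≈⟨ ^-congˡ k (*-congʳ ζᴺ≈1) ⟨
      (ζ ^ suc N * η ^ suc N) ^ k    ≈⟨ ^-congˡ k (^-inverse ζη≈1 (suc N)) ⟩
      1# ^ k                         ≈⟨ 1^n≈1 k ⟩
      1#                             ∎

    component-eigen : ∀ k → Eigenvector M (ζ ^ k) (component k)
    component-eigen k i = begin
      (M ⊛ component k) i    ≈⟨ ⊛-assoc M (λ i j → u (toℕ {suc N} j) i) (λ j → t ^ toℕ j) i ⟨
      ∑[ j < suc N ] ((M ⊛ u (toℕ j)) i * t ^ toℕ j)   ≈⟨ sum-cong-≋ {n = suc N} (λ j → *-congʳ {t ^ toℕ j} (Mu≈u (toℕ j) i)) ⟩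
      ∑[ j < suc N ] (u (suc (toℕ j)) i * t ^ toℕ j)   ≈⟨ sum-cong-≋ {n = suc N} (λ j → shift (u (suc (toℕ j)) i) (toℕ j)) ⟩
      ∑[ j < suc N ] (s * f (suc (toℕ j)))             ≈⟨ *-distribˡ-sum {suc N} s (λ j → f (suc (toℕ j))) ⟨
      s * (∑[ j < suc N ] f (suc (toℕ j)))             ≈⟨ *-congˡ (sum-snoc (λ j → f (suc j)) N) ⟩
      -- By periodicity of both factors, the term of index `suc N` wraps around to the missing term
      -- of index 0.
      s * (∑[ j < N ] f (suc (toℕ j)) + f (suc N))     ≈⟨ *-congˡ (+-congˡ (*-cong (uᴺ≈u⁰ i) (η^suc k))) ⟩
      s * (∑[ j < N ] f (suc (toℕ j)) + f 0)           ≈⟨ *-congˡ (+-comm _ _) ⟩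
      s * component k i                                ∎
      where
      s t : Carrier
      s = ζ ^ k
      t = η ^ k

      f : ℕ → Carrier
      f j = u j i * t ^ j

      rearrange : ∀ s t x y → s * t * (x * y) ≈ s * (x * (t * y))
      rearrange = solve 4 (λ s t x y → s :* t :* (x :* y) := s :* (x :* (t :* y))) refl

      shift : ∀ x j → x * t ^ j ≈ s * (x * t ^ suc j)
      shift x j = begin
        x * t ^ j               ≈⟨ *-identityˡ _ ⟨
        1# * (x * t ^ j)        ≈⟨ *-congʳ (^-inverse ζη≈1 k) ⟨
        s * t * (x * t ^ j)     ≈⟨ rearrange s t x (t ^ j) ⟩
        s * (x * (t * t ^ j))   ∎

    -- Orthogonality of the characters of a cyclic group: a nontrivial character sums to 0.
    vanish : ∀ j → 0 ℕ.< j → j ℕ.< suc N → ∑[ k < suc N ] ((η ^ toℕ k) ^ j) ≈ 0#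
    vanish j 0<j j<N = #0∧*≈0⇒≈0 (ζʲ#1 j 0<j j<N) (begin
      (ζ ^ j - 1#) * (∑[ k < suc N ] ((η ^ toℕ k) ^ j))  ≈⟨ *-congˡ (sum-cong-≋ {n = suc N} (λ k → ^-comm η (toℕ k) j)) ⟩
      (ζ ^ j - 1#) * (∑[ k < suc N ] ((η ^ j) ^ toℕ k))  ≈⟨ geometric-sum≈0 (suc N) (^-inverse ζη≈1 j) (η^suc j) ⟩
      0#                                                 ∎)

    sum-components : ∑[ k < suc N ] component (toℕ k) i ≈ u 0 i * suc N · 1#
    sum-components = begin
      ∑[ k < suc N ] ∑[ j < suc N ] (u (toℕ j) i * (η ^ toℕ k) ^ toℕ j)
        ≈⟨ ∑-comm {suc N} {suc N} (λ k j → u (toℕ j) i * (η ^ toℕ k) ^ toℕ j) ⟩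
      ∑[ j < suc N ] ∑[ k < suc N ] (u (toℕ j) i * (η ^ toℕ k) ^ toℕ j)
        ≈⟨ sum-cong-≋ {n = suc N} (λ j → *-distribˡ-sum {suc N} (u (toℕ j) i) (λ k → (η ^ toℕ k) ^ toℕ j)) ⟨
      ∑[ j < suc N ] (u (toℕ j) i * ∑[ k < suc N ] ((η ^ toℕ k) ^ toℕ j))
        -- Only the inner sum for j = 0 survives, and each of its `suc N` terms is 1.
        ≈⟨ +-cong (*-congˡ (sum-replicate (suc N)))
             (trans (sum-cong-≋ {n = N} (λ j → trans
                 (*-congˡ (vanish (suc (toℕ j)) (ℕ.s≤s ℕ.z≤n) (ℕ.s≤s (Fin.toℕ<n j)))) (zeroʳ _)))
               (sum-replicate-zero N)) ⟩
      u 0 i * suc N · 1# + 0#   ≈⟨ +-identityʳ _ ⟩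
      u 0 i * suc N · 1#        ∎

    some : ∃[ k ] component (toℕ {suc N} k) i # 0#
    some = sum#0⇒∃#0 {suc N} (λ k → component (toℕ k) i) (#-congʳ (sym sum-components) (x#0y#0→xy#0 uᵢ#0 N#0))

  -- Where M² acts as s², this is the projection onto the eigenspace of s along that of - s, scaled
  -- by 2 s to avoid division.
  shifted : ∀ {m} → Mat m m → Carrier → Vector Carrier m → Vector Carrier m
  shifted M s v i = (M ⊛ v) i + s * v i

  shifted-eigen : ∀ {m} (M : Mat m m) s v → (M ⊛ (M ⊛ v) ≋ⱽ λ i → s * s * v i) →
                  Eigenvector M s (shifted M s v)
  shifted-eigen M s v MMv i = begin
    (M ⊛ shifted M s v) i                        ≈⟨ ⊛-+ M (M ⊛ v) (λ i → s * v i) i ⟩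
    (M ⊛ (M ⊛ v)) i + (M ⊛ (λ i → s * v i)) i    ≈⟨ +-cong (MMv i) (⊛-* M s v i) ⟩
    s * s * v i + s * (M ⊛ v) i                  ≈⟨ factor s (v i) ((M ⊛ v) i) ⟩
    s * shifted M s v i                          ∎
    where
    factor : ∀ s x y → s * s * x + s * y ≈ s * (y + s * x)
    factor = solve 3 (λ s x y → s :* s :* x :+ s :* y := s :* (y :+ s :* x)) refl

  shifted-preserves-eigen : ∀ {m} (A M : Mat m m) r s v → Eigenvector A r v → Eigenvector A r (M ⊛ v) →
                            Eigenvector A r (shifted M s v)
  shifted-preserves-eigen A M r s v Av AMv i = begin
    (A ⊛ shifted M s v) i                      ≈⟨ ⊛-+ A (M ⊛ v) (λ i → s * v i) i ⟩
    (A ⊛ (M ⊛ v)) i + (A ⊛ (λ i → s * v i)) i  ≈⟨ +-cong (AMv i) (⊛-* A s v i) ⟩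
    r * (M ⊛ v) i + s * (A ⊛ v) i              ≈⟨ +-congˡ (*-congˡ (Av i)) ⟩
    r * (M ⊛ v) i + s * (r * v i)              ≈⟨ factor r s (v i) ((M ⊛ v) i) ⟩
    r * shifted M s v i                        ∎
    where
    factor : ∀ r s x y → r * y + s * (r * x) ≈ r * (y + s * x)
    factor = solve 4 (λ r s x y → r :* y :+ s :* (r :* x) := r :* (y :+ s :* x)) refl

  -- The two projections differ by 2 s v, so they cannot both be small: one of them is apart from 0.
  shifted#0 : 1# + 1# # 0# → ∀ {m} (M : Mat m m) s v → s # 0# → NonZeroⱽ v →
              NonZeroⱽ (shifted M s v) ⊎ NonZeroⱽ (shifted M (- s) v)
  shifted#0 2#0 M s v s#0 (i , vᵢ#0) =
    conclude (+#0⇒#0 (#-congʳ (difference ((M ⊛ v) i) s (v i)) (x#0y#0→xy#0 (x#0y#0→xy#0 2#0 s#0) vᵢ#0)))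
    where
    difference : ∀ y s x → (1# + 1#) * s * x ≈ (y + s * x) + - 1# * (y + - s * x)
    difference = solve 3 (λ y s x →
      (con (1 , 0) :+ con (1 , 0)) :* s :* x := (y :+ s :* x) :+ :- con (1 , 0) :* (y :+ (:- s) :* x)) refl

    conclude : shifted M s v i # 0# ⊎ - 1# * shifted M (- s) v i # 0# →
               NonZeroⱽ (shifted M s v) ⊎ NonZeroⱽ (shifted M (- s) v)
    conclude (inj₁ #0)  = inj₁ (i , #0)
    conclude (inj₂ -#0) = inj₂ (i , *#0⇒#0ʳ (- 1#) -#0)

  x*x≈-x*-x : ∀ x → x * x ≈ - x * - x
  x*x≈-x*-x = solve 1 (λ x → x :* x := :- x :* :- x) refl

  -- Serves both for M = b² and for M = b. The eigenspace of A is preserved because M maps v to an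
  -- eigenvector for the same r.
  split-eigenvector : 1# + 1# # 0# → ∀ {m} (A M : Mat m m) r s v → s # 0# → NonZeroⱽ v →
                      Eigenvector A r v → Eigenvector A r (M ⊛ v) → (M ⊛ (M ⊛ v) ≋ⱽ λ i → s * s * v i) →
                      ∃[ t ] (t ≡ s ⊎ t ≡ - s) ×
                      ∃[ w ] Eigenvector A r w × Eigenvector M t w × NonZeroⱽ w
  split-eigenvector 2#0 A M r s v s#0 v#0 Av AMv MMv = [ plus , minus ]′ (shifted#0 2#0 M s v s#0 v#0)
    where
    plus : NonZeroⱽ (shifted M s v) → _
    plus #0 = s , inj₁ ≡.refl , shifted M s v ,
      shifted-preserves-eigen A M r s v Av AMv , shifted-eigen M s v MMv , #0

    minus : NonZeroⱽ (shifted M (- s) v) → _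
    minus #0 = - s , inj₂ ≡.refl , shifted M (- s) v ,
      shifted-preserves-eigen A M r (- s) v Av AMv ,
      shifted-eigen M (- s) v (λ i → trans (MMv i) (*-congʳ (x*x≈-x*-x s))) , #0

-- Construction and irreducibility of the listed representations.

module MonomialRepresentations (K : HeytingField 0ℓ 0ℓ 0ℓ) (n : ℕ) where

  open HeytingField K hiding (zero)
  open HeytingCommutativeRing heytingCommutativeRing using (commutativeRing)
  open CommutativeRing commutativeRing using (commutativeSemiring)
  open Algebra.Properties.CommutativeSemiring.Exp commutativeSemiring
  open HeytingFieldProperties K
  open Matrices commutativeRing
  open RectangularMatrices commutativeRing
  open Representations K (T₈ₙ n)
  open Eigenvectors K using (NonZeroⱽ)
  open DifferenceSolver commutativeRing using (solve; con; _:+_; _:*_; _:-_; :-_; _:=_)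
  open Relation.Binary.Reasoning.Setoid setoid

  diagonal : Carrier → Carrier → Matrix 2
  diagonal x y = (x ∷ 0# ∷ []) ∷ (0# ∷ y ∷ []) ∷ []

  antidiagonal : Carrier → Carrier → Matrix 2
  antidiagonal x y = (0# ∷ x ∷ []) ∷ (y ∷ 0# ∷ []) ∷ []

  1×1 : Carrier → Matrix 1
  1×1 s = (s ∷ []) ∷ []

  private
    entry₀ : ∀ x y z → x * y + (0# * z + 0#) ≈ x * y
    entry₀ = solve 3 (λ x y z → x :* y :+ (con (0 , 0) :* z :+ con (0 , 0)) := x :* y) refl

    entry₁ : ∀ x y z → 0# * y + (x * z + 0#) ≈ x * z
    entry₁ = solve 3 (λ x y z → con (0 , 0) :* y :+ (x :* z :+ con (0 , 0)) := x :* z) refl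

  diagonal-⊛ : ∀ x y v → diagonal x y ⊛ v ≋ⱽ x * v 0F ∷ y * v 1F ∷ []
  diagonal-⊛ x y v 0F = entry₀ x (v 0F) (v 1F)
  diagonal-⊛ x y v 1F = entry₁ y (v 0F) (v 1F)

  antidiagonal-⊛ : ∀ x y v → antidiagonal x y ⊛ v ≋ⱽ x * v 1F ∷ y * v 0F ∷ []
  antidiagonal-⊛ x y v 0F = entry₁ x (v 0F) (v 1F)
  antidiagonal-⊛ x y v 1F = entry₀ y (v 0F) (v 1F)

  diagonal-⊗-diagonal : ∀ x y z w → diagonal x y ⊗ diagonal z w ≋ diagonal (x * z) (y * w)
  diagonal-⊗-diagonal x y z w 0F 0F = diagonal-⊛ x y (λ i → diagonal z w i 0F) 0F
  diagonal-⊗-diagonal x y z w 0F 1F = trans (diagonal-⊛ x y (λ i → diagonal z w i 1F) 0F) (zeroʳ x)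
  diagonal-⊗-diagonal x y z w 1F 0F = trans (diagonal-⊛ x y (λ i → diagonal z w i 0F) 1F) (zeroʳ y)
  diagonal-⊗-diagonal x y z w 1F 1F = diagonal-⊛ x y (λ i → diagonal z w i 1F) 1F

  antidiagonal-⊗-antidiagonal : ∀ x y z w → antidiagonal x y ⊗ antidiagonal z w ≋ diagonal (x * w) (y * z)
  antidiagonal-⊗-antidiagonal x y z w 0F 0F = antidiagonal-⊛ x y (λ i → antidiagonal z w i 0F) 0F
  antidiagonal-⊗-antidiagonal x y z w 0F 1F = trans (antidiagonal-⊛ x y (λ i → antidiagonal z w i 1F) 0F) (zeroʳ x)
  antidiagonal-⊗-antidiagonal x y z w 1F 0F = trans (antidiagonal-⊛ x y (λ i → antidiagonal z w i 0F) 1F) (zeroʳ y)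
  antidiagonal-⊗-antidiagonal x y z w 1F 1F = antidiagonal-⊛ x y (λ i → antidiagonal z w i 1F) 1F

  diagonal-cong : ∀ {x x′ y y′} → x ≈ x′ → y ≈ y′ → diagonal x y ≋ diagonal x′ y′
  diagonal-cong p q 0F 0F = p
  diagonal-cong p q 0F 1F = refl
  diagonal-cong p q 1F 0F = refl
  diagonal-cong p q 1F 1F = q

  diagonal-1 : diagonal 1# 1# ≋ 1ᴹ
  diagonal-1 0F 0F = refl
  diagonal-1 0F 1F = refl
  diagonal-1 1F 0F = refl
  diagonal-1 1F 1F = refl

  module OneDimensional (s t : Carrier) (s²≈1 : s * s ≈ 1#) (sⁿ≈1 : s ^ n ≈ 1#) (t⁴≈1 : t ^ 4 ≈ 1#) where

    open Algebra.Properties.Monoid.Mult (Group.monoid (GL 1)) using () renaming (_×_ to _·_)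

    invertible₁ : ∀ x y → x * y ≈ 1# → InvertibleMatrix 1
    invertible₁ x y xy≈1 = record
      { matrix   = 1×1 x
      ; inverse  = 1×1 y
      ; inverseˡ = λ { 0F 0F → trans (+-identityʳ _) (trans (*-comm y x) xy≈1) }
      ; inverseʳ = λ { 0F 0F → trans (+-identityʳ _) xy≈1 }
      }

    private
      t⁸≈1 : t ^ 8 ≈ 1#
      t⁸≈1 = trans (^-homo-* t 4 4) (trans (*-cong t⁴≈1 t⁴≈1) (*-identityˡ 1#))

      A B : InvertibleMatrix 1
      A = invertible₁ s s s²≈1
      B = invertible₁ t (t ^ 3) t⁴≈1

      power : ∀ x y p k → matrix (k · invertible₁ x y p) 0F 0F ≈ x ^ k
      power x y p zero    = refl
      power x y p (suc k) = trans (+-identityʳ _) (*-congˡ (power x y p k))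

    open T₈ₙ-Homomorphisms n (GL 1) A B

    representation : Representation 1
    representation = record
      { ⟦_⟧ = eval
      ; isGroupHomomorphism = eval-isGroupHomomorphism (T₈ₙ-relators
          (λ { 0F 0F → trans (power s s s²≈1 n) (trans sⁿ≈1 (sym (trans (power t (t ^ 3) t⁴≈1 4) t⁴≈1))) })
          (λ { 0F 0F → trans (power t (t ^ 3) t⁴≈1 8) t⁸≈1 })
          -- As `s` is its own inverse, ab = ba⁻¹ amounts to commutativity of scalars.
          (λ { 0F 0F → +-congʳ (*-comm s t) }))
      }

    irreducible : IsIrreducible representation
    irreducible = record
      { nonZero = _
      ; simple  = λ { W W-invariant v Wv (0F , v₀#0) w → simple W W-invariant v Wv v₀#0 w }
      }
      where
      simple : ∀ W → IsInvariantSubspace representation W → ∀ v → W v → v 0F # 0# → ∀ w → W w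
      simple W W-invariant v Wv v₀#0 w with #0⇒invertible v₀#0
      ... | y , yv₀≈1 = resp-≈ (λ { 0F → trans (*-assoc (w 0F) y (v 0F)) (trans (*-congˡ yv₀≈1) (*-identityʳ _)) })
                               (*-closed (w 0F * y) Wv)
        where open IsInvariantSubspace W-invariant

  -- Covers both two-dimensional families, which differ in the sign of s. Since b² acts by the
  -- scalar s, the hypotheses on powers express aⁿ = b⁴ and b⁸ = e.
  module TwoDimensional (x y s : Carrier) (xy≈1 : x * y ≈ 1#) (xⁿ≈s² : x ^ n ≈ s * s) (yⁿ≈s² : y ^ n ≈ s * s)
                        (s⁴≈1 : s * s * (s * s) ≈ 1#) where

    open Algebra.Properties.Monoid.Mult (Group.monoid (GL 2)) using () renaming (_×_ to _·_; ×-homo-+ to ·-homo-+)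

    private
      s*s³≈1 : s * (s * (s * s)) ≈ 1#
      s*s³≈1 = trans (sym (*-assoc s s (s * s))) s⁴≈1

      yx≈1 : y * x ≈ 1#
      yx≈1 = trans (*-comm y x) xy≈1

      A B : InvertibleMatrix 2
      A = record
        { matrix   = diagonal x y
        ; inverse  = diagonal y x
        ; inverseˡ = λ i j → trans (diagonal-⊗-diagonal y x x y i j)
                       (trans (diagonal-cong yx≈1 xy≈1 i j) (diagonal-1 i j))
        ; inverseʳ = λ i j → trans (diagonal-⊗-diagonal x y y x i j)
                       (trans (diagonal-cong xy≈1 yx≈1 i j) (diagonal-1 i j))
        }
      B = record
        { matrix   = antidiagonal s 1#
        ; inverse  = antidiagonal 1# (s * (s * s))
        ; inverseˡ = λ i j → trans (antidiagonal-⊗-antidiagonal 1# (s * (s * s)) s 1# i j)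
                       (trans (diagonal-cong (*-identityˡ 1#) (trans (*-comm _ s) s*s³≈1) i j) (diagonal-1 i j))
        ; inverseʳ = λ i j → trans (antidiagonal-⊗-antidiagonal s 1# 1# (s * (s * s)) i j)
                       (trans (diagonal-cong s*s³≈1 (*-identityˡ 1#) i j) (diagonal-1 i j))
        }

      Aᵏ : ∀ k → matrix (k · A) ≋ diagonal (x ^ k) (y ^ k)
      Aᵏ zero    i j = sym (diagonal-1 i j)
      Aᵏ (suc k) i j = trans (⊗-congˡ (diagonal x y) (Aᵏ k) i j) (diagonal-⊗-diagonal x y (x ^ k) (y ^ k) i j)

    B² : antidiagonal s 1# ⊗ antidiagonal s 1# ≋ diagonal s s
    B² i j = trans (antidiagonal-⊗-antidiagonal s 1# s 1# i j)
               (diagonal-cong (*-identityʳ s) (*-identityˡ s) i j)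

    private
      -- The multiple `4 · B` unfolds to the right-nested product B (B (B (B 1))), whose factors are
      -- merged in pairs from the left.
      B²⊗ : ∀ (M : Matrix 2) → antidiagonal s 1# ⊗ (antidiagonal s 1# ⊗ M) ≋ diagonal s s ⊗ M
      B²⊗ M i j = trans (sym (⊗-assoc (antidiagonal s 1#) (antidiagonal s 1#) M i j)) (⊗-congʳ M B² i j)

      B⁴ : matrix (4 · B) ≋ diagonal (s * s) (s * s)
      B⁴ i j = begin
        matrix (4 · B) i j                              ≈⟨ B²⊗ (matrix (2 · B)) i j ⟩
        (diagonal s s ⊗ matrix (2 · B)) i j             ≈⟨ ⊗-congˡ (diagonal s s) (B²⊗ 1ᴹ) i j ⟩
        (diagonal s s ⊗ (diagonal s s ⊗ 1ᴹ)) i j        ≈⟨ ⊗-congˡ (diagonal s s) (⊗-identityʳ (diagonal s s)) i j ⟩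
        (diagonal s s ⊗ diagonal s s) i j               ≈⟨ diagonal-⊗-diagonal s s s s i j ⟩
        diagonal (s * s) (s * s) i j                    ∎

      B⁸ : matrix (8 · B) ≋ 1ᴹ
      B⁸ i j = begin
        matrix (8 · B) i j                                       ≈⟨ ·-homo-+ B 4 4 i j ⟩
        (matrix (4 · B) ⊗ matrix (4 · B)) i j                    ≈⟨ ⊗-cong B⁴ B⁴ i j ⟩
        (diagonal (s * s) (s * s) ⊗ diagonal (s * s) (s * s)) i j ≈⟨ diagonal-⊗-diagonal _ _ _ _ i j ⟩
        diagonal (s * s * (s * s)) (s * s * (s * s)) i j          ≈⟨ diagonal-cong s⁴≈1 s⁴≈1 i j ⟩
        diagonal 1# 1# i j                                       ≈⟨ diagonal-1 i j ⟩
        1ᴹ i j                                                   ∎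

      AB≋BA⁻¹ : diagonal x y ⊗ antidiagonal s 1# ≋ antidiagonal s 1# ⊗ diagonal y x
      AB≋BA⁻¹ 0F 0F = trans (diagonal-⊛ x y (λ i → antidiagonal s 1# i 0F) 0F)
        (trans (trans (zeroʳ x) (sym (zeroʳ s))) (sym (antidiagonal-⊛ s 1# (λ i → diagonal y x i 0F) 0F)))
      AB≋BA⁻¹ 0F 1F = trans (diagonal-⊛ x y (λ i → antidiagonal s 1# i 1F) 0F)
        (trans (*-comm x s) (sym (antidiagonal-⊛ s 1# (λ i → diagonal y x i 1F) 0F)))
      AB≋BA⁻¹ 1F 0F = trans (diagonal-⊛ x y (λ i → antidiagonal s 1# i 0F) 1F)
        (trans (*-comm y 1#) (sym (antidiagonal-⊛ s 1# (λ i → diagonal y x i 0F) 1F)))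
      AB≋BA⁻¹ 1F 1F = trans (diagonal-⊛ x y (λ i → antidiagonal s 1# i 1F) 1F)
        (trans (trans (zeroʳ y) (sym (zeroʳ 1#))) (sym (antidiagonal-⊛ s 1# (λ i → diagonal y x i 1F) 1F)))

    open T₈ₙ-Homomorphisms n (GL 2) A B

    representation : Representation 2
    representation = record
      { ⟦_⟧ = eval
      ; isGroupHomomorphism = eval-isGroupHomomorphism (T₈ₙ-relators
          (λ i j → trans (Aᵏ n i j) (trans (diagonal-cong xⁿ≈s² yⁿ≈s² i j) (sym (B⁴ i j))))
          B⁸ AB≋BA⁻¹)
      }

    -- If v₀ is apart from 0, subtracting y v from a v leaves (x - y) v₀ times the first basis
    -- vector; symmetrically for v₁. Distinct eigenvalues thus isolate one axis, and b exchanges the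
    -- two axes up to a unit.
    irreducible : x - y # 0# → IsIrreducible representation
    irreducible x-y#0 = record { nonZero = _ ; simple = simple }
      where
      simple : ∀ W → IsInvariantSubspace representation W → ∀ v → W v → NonZeroⱽ v → ∀ w → W w
      simple W W-invariant v Wv (i , vᵢ#0) = spanned (basis i vᵢ#0)
        where
        open IsInvariantSubspace W-invariant

        x-y⁻¹ = proj₁ (#0⇒invertible x-y#0)

        spanned : W (1# ∷ 0# ∷ []) × W (0# ∷ 1# ∷ []) → ∀ w → W w
        spanned (We₀ , We₁) w = resp-≈ (λ { 0F → first (w 0F) (w 1F) ; 1F → second (w 0F) (w 1F) })
                                       (+-closed (*-closed (w 0F) We₀) (*-closed (w 1F) We₁))
          where
          first : ∀ x y → x * 1# + y * 0# ≈ x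
          first = solve 2 (λ x y → x :* con (1 , 0) :+ y :* con (0 , 0) := x) refl

          second : ∀ x y → x * 0# + y * 1# ≈ y
          second = solve 2 (λ x y → x :* con (0 , 0) :+ y :* con (1 , 0) := y) refl

        Av-rv : ∀ r → W (λ i → (diagonal x y ⊛ v) i + - r * v i)
        Av-rv r = +-closed (invariant a Wv) (*-closed (- r) Wv)

        e₀→e₁ : W (1# ∷ 0# ∷ []) → W (0# ∷ 1# ∷ [])
        e₀→e₁ We₀ = resp-≈ (λ { 0F → trans (antidiagonal-⊛ s 1# (1# ∷ 0# ∷ []) 0F) (zeroʳ s)
                              ; 1F → trans (antidiagonal-⊛ s 1# (1# ∷ 0# ∷ []) 1F) (*-identityˡ 1#) })
                           (invariant b We₀)

        e₁→e₀ : W (0# ∷ 1# ∷ []) → W (1# ∷ 0# ∷ [])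
        e₁→e₀ We₁ = resp-≈
          (λ { 0F → trans (*-congˡ (antidiagonal-⊛ s 1# (0# ∷ 1# ∷ []) 0F))
                 (trans (*-congˡ (*-identityʳ s)) (trans (*-comm _ s) s*s³≈1))
             ; 1F → trans (*-congˡ (trans (antidiagonal-⊛ s 1# (0# ∷ 1# ∷ []) 1F) (zeroʳ 1#))) (zeroʳ _) })
          -- b sends the second basis vector to s times the first, and s³ is the inverse of s.
          (*-closed (s * (s * s)) (invariant b We₁))

        basis : ∀ i → v i # 0# → W (1# ∷ 0# ∷ []) × W (0# ∷ 1# ∷ [])
        basis 0F v₀#0 = We₀ , e₀→e₁ We₀
          where
          v₀⁻¹ = proj₁ (#0⇒invertible v₀#0)

          first : ∀ p q x y z → p * q * (x * z + - y * z) ≈ (p * (x - y)) * (q * z)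
          first = solve 5 (λ p q x y z → p :* q :* (x :* z :+ (:- y) :* z) := (p :* (x :- y)) :* (q :* z)) refl

          second : ∀ p y z → p * (y * z + - y * z) ≈ 0#
          second = solve 3 (λ p y z → p :* (y :* z :+ (:- y) :* z) := con (0 , 0)) refl

          We₀ : W (1# ∷ 0# ∷ [])
          We₀ = resp-≈
            (λ { 0F → trans (*-congˡ (+-congʳ (diagonal-⊛ x y v 0F))) (trans (first x-y⁻¹ v₀⁻¹ x y (v 0F))
                        (trans (*-cong (proj₂ (#0⇒invertible x-y#0)) (proj₂ (#0⇒invertible v₀#0))) (*-identityˡ 1#)))
               ; 1F → trans (*-congˡ (+-congʳ (diagonal-⊛ x y v 1F))) (second (x-y⁻¹ * v₀⁻¹) y (v 1F)) })
            (*-closed (x-y⁻¹ * v₀⁻¹) (Av-rv y))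
        basis 1F v₁#0 = e₁→e₀ We₁ , We₁
          where
          v₁⁻¹ = proj₁ (#0⇒invertible v₁#0)

          first : ∀ p x z → p * (x * z + - x * z) ≈ 0#
          first = solve 3 (λ p y z → p :* (y :* z :+ (:- y) :* z) := con (0 , 0)) refl

          second : ∀ p q x y z → - p * q * (y * z + - x * z) ≈ (p * (x - y)) * (q * z)
          second = solve 5 (λ p q x y z → (:- p) :* q :* (y :* z :+ (:- x) :* z) := (p :* (x :- y)) :* (q :* z)) refl

          We₁ : W (0# ∷ 1# ∷ [])
          We₁ = resp-≈
            (λ { 0F → trans (*-congˡ (+-congʳ (diagonal-⊛ x y v 0F))) (first (- x-y⁻¹ * v₁⁻¹) x (v 0F))
               ; 1F → trans (*-congˡ (+-congʳ (diagonal-⊛ x y v 1F))) (trans (second x-y⁻¹ v₁⁻¹ x y (v 1F))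
                        (trans (*-cong (proj₂ (#0⇒invertible x-y#0)) (proj₂ (#0⇒invertible v₁#0))) (*-identityˡ 1#))) })
            -- Here a v - x v is (y - x) v₁ times the second basis vector, whence the sign.
            (*-closed (- x-y⁻¹ * v₁⁻¹) (Av-rv x))

module T₈ₙ-Identities (n : ℕ) where

  private
    module P = Presentation Gen
    module T = Group (T₈ₙ n)
  open Relation.Binary.Reasoning.Setoid T.setoid

  ab≈ba⁻¹ : a P.∙ b T.≈ b P.∙ a P.⁻¹
  ab≈ba⁻¹ = begin
    a P.∙ b                         ≈⟨ T.identityˡ (a P.∙ b) ⟨
    P.ε P.∙ (a P.∙ b)               ≈⟨ T.∙-congʳ (T.inverseʳ b) ⟨
    b P.∙ b P.⁻¹ P.∙ (a P.∙ b)      ≈⟨ T.assoc b (b P.⁻¹) (a P.∙ b) ⟩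
    b P.∙ (b P.⁻¹ P.∙ (a P.∙ b))    ≈⟨ T.∙-congˡ (T.assoc (b P.⁻¹) a b) ⟨
    b P.∙ (b P.⁻¹ P.∙ a P.∙ b)      ≈⟨ T.∙-congˡ (P.relator b⁻¹ab=a⁻¹) ⟩
    b P.∙ a P.⁻¹                    ∎

  b²b²≈aⁿ : b P.∙ b P.∙ (b P.∙ b) T.≈ a P.^ n
  b²b²≈aⁿ = P.trans (P.assoc b b (b P.∙ b)) (P.trans
    (T.∙-congˡ (T.∙-congˡ (T.∙-congˡ (P.sym (P.identityʳ b))))) (P.sym (P.relator aⁿ=b⁴)))

-- Classification over a Heyting field with the required roots of unity.

module Classification (K : HeytingField 0ℓ 0ℓ 0ℓ) (n : ℕ) .{{n≢0 : NonZero n}} (2∣n : 2 ∣ n) where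

  open HeytingField K hiding (zero)
  open HeytingCommutativeRing heytingCommutativeRing using (commutativeRing)
  open CommutativeRing commutativeRing using (commutativeSemiring; +-monoid; ring)
  open Algebra.Apartness.Properties.HeytingCommutativeRing heytingCommutativeRing
    using (#-congʳ; x#0y#0→xy#0; 1#0)
  open Algebra.Properties.Ring ring using (-1*x≈-x; -‿involutive)
  open Algebra.Properties.CommutativeSemiring.Exp commutativeSemiring
  open Algebra.Properties.Monoid.Mult +-monoid using () renaming (_×_ to _·_)
  open HeytingFieldProperties K
  open Matrices commutativeRing
  open RectangularMatrices commutativeRing
  open RangeSums commutativeRing
  open Eigenvectors K
  open Representations K (T₈ₙ n)
  open Schur K (T₈ₙ n)
  open MonomialRepresentations K n
  open T₈ₙ-Identities n
  open DifferenceSolver commutativeRing using (solve; con; _:+_; _:*_; _:-_; :-_; _:=_)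
  open Relation.Binary.Reasoning.Setoid setoid
  private
    module P = Presentation Gen
    module T = Group (T₈ₙ n)

    -1*-1≈1 : - 1# * - 1# ≈ 1#
    -1*-1≈1 = trans (-1*x≈-x (- 1#)) (-‿involutive 1#)

  ^-even : ∀ {x} → x * x ≈ 1# → ∀ q → x ^ (q ℕ.* 2) ≈ 1#
  ^-even {x} x²≈1 q = begin
    x ^ (q ℕ.* 2)  ≈⟨ ^-congʳ x (ℕ.*-comm q 2) ⟩
    x ^ (2 ℕ.* q)  ≈⟨ ^-assocʳ x 2 q ⟨
    (x ^ 2) ^ q    ≈⟨ ^-congˡ q (trans (*-congˡ (*-identityʳ x)) x²≈1) ⟩
    1# ^ q         ≈⟨ 1^n≈1 q ⟩
    1#             ∎

  -- Evenness of n is what lets a ↦ -1 satisfy aⁿ = 1, as b⁴ = 1 demands in degree one.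
  ^n≈1 : ∀ {x} → x * x ≈ 1# → x ^ n ≈ 1#
  ^n≈1 {x} x²≈1 = trans (^-congʳ x (_∣_.equality 2∣n)) (^-even x²≈1 (_∣_.quotient 2∣n))

  ^-distinct : ∀ {x y} N → x * y ≈ 1# → (∀ j → 0 ℕ.< j → j ℕ.< N → x ^ j - 1# # 0#) →
               ∀ {i j} → i ℕ.< j → j ℕ.< N → ¬ x ^ i ≈ x ^ j
  ^-distinct {x} {y} N xy≈1 xʲ#1 {i} {j} i<j j<N xⁱ≈xʲ =
    #⇒≉ (xʲ#1 (j ℕ.∸ i) (ℕ.m<n⇒0<n∸m i<j) (ℕ.≤-<-trans (ℕ.m∸n≤m j i) j<N)) (begin
      x ^ (j ℕ.∸ i) - 1#                            ≈⟨ +-congʳ (*-identityˡ _) ⟨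
      1# * x ^ (j ℕ.∸ i) - 1#                       ≈⟨ +-congʳ (*-congʳ (^-inverse xy≈1 i)) ⟨
      x ^ i * y ^ i * x ^ (j ℕ.∸ i) - 1#            ≈⟨ +-congʳ (*-congʳ (*-comm (x ^ i) (y ^ i))) ⟩
      y ^ i * x ^ i * x ^ (j ℕ.∸ i) - 1#            ≈⟨ +-congʳ (*-assoc (y ^ i) (x ^ i) (x ^ (j ℕ.∸ i))) ⟩
      y ^ i * (x ^ i * x ^ (j ℕ.∸ i)) - 1#          ≈⟨ +-congʳ (*-congˡ (^-homo-* x i (j ℕ.∸ i))) ⟨
      y ^ i * x ^ (i ℕ.+ (j ℕ.∸ i)) - 1#            ≈⟨ +-congʳ (*-congˡ (^-congʳ x (ℕ.m+[n∸m]≡n (ℕ.<⇒≤ i<j)))) ⟩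
      y ^ i * x ^ j - 1#                            ≈⟨ +-congʳ (*-congˡ xⁱ≈xʲ) ⟨
      y ^ i * x ^ i - 1#                            ≈⟨ +-congʳ (trans (*-comm (y ^ i) (x ^ i)) (^-inverse xy≈1 i)) ⟩
      1# - 1#                                       ≈⟨ -‿inverseʳ 1# ⟩
      0#                                            ∎)

  ^-injective : ∀ {x y} N → x * y ≈ 1# → (∀ j → 0 ℕ.< j → j ℕ.< N → x ^ j - 1# # 0#) →
                ∀ i j → i ℕ.< N → j ℕ.< N → x ^ i ≈ x ^ j → i ≡ j
  ^-injective {x} {y} N xy≈1 xʲ#1 i j i<N j<N xⁱ≈xʲ with ℕ.<-cmp i j
  ... | tri< i<j _ _ = contradiction xⁱ≈xʲ (^-distinct N xy≈1 xʲ#1 i<j j<N)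
  ... | tri≈ _ i≡j _ = i≡j
  ... | tri> _ _ j<i = contradiction (sym xⁱ≈xʲ) (^-distinct N xy≈1 xʲ#1 j<i i<N)

  -- The complete interface to analysis: ξ is a primitive root of unity of order 2n, ω one of order
  -- 8, and the characteristic is zero.
  module Roots (ξ η ω 𝑖 : Carrier) (ξη≈1 : ξ * η ≈ 1#)
           (ξⁿ≈-1 : ξ ^ n ≈ - 1#) (ω⁴≈-1 : ω ^ 4 ≈ - 1#) (𝑖²≈-1 : 𝑖 * 𝑖 ≈ - 1#)
           (ξʲ#1 : ∀ j → 0 ℕ.< j → j ℕ.< 2 ℕ.* n → ξ ^ j - 1# # 0#)
           (ωʲ#1 : ∀ j → 0 ℕ.< j → j ℕ.< 8 → ω ^ j - 1# # 0#)
           (suc·1#0 : ∀ k → suc k · 1# # 0#) where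

    private
      2#0 : 1# + 1# # 0#
      2#0 = #-congʳ (+-congˡ (+-identityʳ 1#)) (suc·1#0 1)

      1≉-1 : ¬ 1# ≈ - 1#
      1≉-1 1≈-1 = #⇒≉ 2#0 (trans (+-congˡ 1≈-1) (-‿inverseʳ 1#))

      ω⁸≈1 : ω ^ 8 ≈ 1#
      ω⁸≈1 = trans (^-homo-* ω 4 4) (trans (*-cong ω⁴≈-1 ω⁴≈-1) -1*-1≈1)

      2n≡n+n : 2 ℕ.* n ≡ n ℕ.+ n
      2n≡n+n = ≡.cong (n ℕ.+_) (ℕ.+-identityʳ n)

      ξ²ⁿ≈1 : ξ ^ (2 ℕ.* n) ≈ 1#
      ξ²ⁿ≈1 = trans (^-congʳ ξ 2n≡n+n) (trans (^-homo-* ξ n n) (trans (*-cong ξⁿ≈-1 ξⁿ≈-1) -1*-1≈1))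

      ηⁿ≈-1 : η ^ n ≈ - 1#
      ηⁿ≈-1 = begin
        η ^ n                    ≈⟨ *-identityˡ _ ⟨
        1# * η ^ n               ≈⟨ *-congʳ -1*-1≈1 ⟨
        - 1# * - 1# * η ^ n      ≈⟨ *-assoc (- 1#) (- 1#) (η ^ n) ⟩
        - 1# * (- 1# * η ^ n)    ≈⟨ *-congˡ (*-congʳ ξⁿ≈-1) ⟨
        - 1# * (ξ ^ n * η ^ n)   ≈⟨ *-congˡ (^-inverse ξη≈1 n) ⟩
        - 1# * 1#                ≈⟨ *-identityʳ (- 1#) ⟩
        - 1#                     ∎

    -- The same conditionals as in `image-a` and `image-b`, so that the prescribed images of the
    -- generators hold by computation.
    sign root : ℕ → Carrier
    sign j = if even j then 1# else - 1#
    root j = if even j then ω ^ j else ω ^ (j ℕ.∸ 1)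

    -- b² acts on the representations ρ₂ₖ and ρ₃ₖ as cₖ and -cₖ.
    c₂ c₃ : ℕ → Carrier
    c₂ k = if even k then 1# else 𝑖
    c₃ k = if even k then - 1# else - 𝑖

    private
      choose : ∀ {k e} {x y : Carrier} → even k ≡ e → (if even k then x else y) ≡ (if e then x else y)
      choose {x = x} {y} = ≡.cong (if_then x else y)

    sign² : ∀ j → sign j * sign j ≈ 1#
    sign² j = [ (λ (e , _) → trans (reflexive (≡.cong (λ s → s * s) (choose {j} e))) (*-identityˡ 1#))
              , (λ (e , _) → trans (reflexive (≡.cong (λ s → s * s) (choose {j} e))) -1*-1≈1) ]′ (even-or-odd j)

    -- For odd j the exponent is j - 1, again even; hence every value of `root` is a power of ω² and
    -- a fourth root of unity.
    root-even-power : ∀ j → ∃[ q ] root j ≡ ω ^ (q ℕ.* 2)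
    root-even-power j = [ (λ (e , q , j≡2q) → q , ≡.trans (choose {j} e) (≡.cong (ω ^_) j≡2q))
                        , (λ (e , q , j≡1+2q) → q , ≡.trans (choose {j} e) (≡.cong (λ j → ω ^ (j ℕ.∸ 1)) j≡1+2q)) ]′
                        (even-or-odd j)

    root⁴ : ∀ j → root j ^ 4 ≈ 1#
    root⁴ j = begin
      root j ^ 4             ≈⟨ ^-congˡ 4 (reflexive (proj₂ (root-even-power j))) ⟩
      (ω ^ (q ℕ.* 2)) ^ 4    ≈⟨ ^-comm ω (q ℕ.* 2) 4 ⟩
      (ω ^ 4) ^ (q ℕ.* 2)    ≈⟨ ^-congˡ (q ℕ.* 2) ω⁴≈-1 ⟩
      (- 1#) ^ (q ℕ.* 2)     ≈⟨ ^-even -1*-1≈1 q ⟩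
      1#                     ∎
      where q = proj₁ (root-even-power j)

    -- The relation b⁴ = aⁿ, as (ξᵏ)ⁿ = (-1)ᵏ. This is why the entry must switch between 1 and 𝑖
    -- with the parity of k.
    c₂² : ∀ k → c₂ k * c₂ k ≈ (- 1#) ^ k
    c₂² k = [ (λ (e , q , k≡2q) → begin
                c₂ k * c₂ k          ≈⟨ reflexive (≡.cong (λ s → s * s) (choose {k} e)) ⟩
                1# * 1#              ≈⟨ *-identityˡ 1# ⟩
                1#                   ≈⟨ ^-even -1*-1≈1 q ⟨
                (- 1#) ^ (q ℕ.* 2)   ≈⟨ ^-congʳ (- 1#) k≡2q ⟨
                (- 1#) ^ k           ∎)
            , (λ (e , q , k≡1+2q) → begin
                c₂ k * c₂ k                  ≈⟨ reflexive (≡.cong (λ s → s * s) (choose {k} e)) ⟩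
                𝑖 * 𝑖                        ≈⟨ 𝑖²≈-1 ⟩
                - 1#                         ≈⟨ *-identityʳ (- 1#) ⟨
                - 1# * 1#                    ≈⟨ *-congˡ (^-even -1*-1≈1 q) ⟨
                - 1# * (- 1#) ^ (q ℕ.* 2)    ≈⟨ ^-congʳ (- 1#) k≡1+2q ⟨
                (- 1#) ^ k                   ∎) ]′ (even-or-odd k)

    c₃≡-c₂ : ∀ k → c₃ k ≡ - c₂ k
    c₃≡-c₂ k = ≡.sym (if-float -_ (even k))

    c₃² : ∀ k → c₃ k * c₃ k ≈ (- 1#) ^ k
    c₃² k = trans (reflexive (≡.cong (λ s → s * s) (c₃≡-c₂ k))) (trans (sym (x*x≈-x*-x (c₂ k))) (c₂² k))

    c₂#0 : ∀ k → c₂ k # 0#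
    c₂#0 k = invertible⇒#0 (c₂ k * (c₂ k * c₂ k)) (begin
      c₂ k * (c₂ k * c₂ k) * c₂ k    ≈⟨ *-comm _ (c₂ k) ⟩
      c₂ k * (c₂ k * (c₂ k * c₂ k))  ≈⟨ *-assoc (c₂ k) (c₂ k) _ ⟨
      c₂ k * c₂ k * (c₂ k * c₂ k)    ≈⟨ *-cong (c₂² k) (c₂² k) ⟩
      (- 1#) ^ k * (- 1#) ^ k        ≈⟨ ^-inverse -1*-1≈1 k ⟩
      1#                             ∎)

    module ρ₁ (j : Fin 8) =
      OneDimensional (sign (toℕ j)) (root (toℕ j)) (sign² (toℕ j)) (^n≈1 (sign² (toℕ j))) (root⁴ (toℕ j))

    private
      [ξᵏ]ⁿ : ∀ k → (ξ ^ k) ^ n ≈ (- 1#) ^ k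
      [ξᵏ]ⁿ k = trans (^-comm ξ k n) (^-congˡ k ξⁿ≈-1)

      [ηᵏ]ⁿ : ∀ k → (η ^ k) ^ n ≈ (- 1#) ^ k
      [ηᵏ]ⁿ k = trans (^-comm η k n) (^-congˡ k ηⁿ≈-1)

    module ρ₂₃ (k : ℕ) (s : Carrier) (s²≈±1 : s * s ≈ (- 1#) ^ k) =
      TwoDimensional (ξ ^ k) (η ^ k) s (^-inverse ξη≈1 k) (trans ([ξᵏ]ⁿ k) (sym s²≈±1)) (trans ([ηᵏ]ⁿ k) (sym s²≈±1))
        (trans (*-cong s²≈±1 s²≈±1) (^-inverse -1*-1≈1 k))

    ρ : (l : Label n) → Representation (degree l)
    ρ (ρ₁ j)     = ρ₁.representation j
    ρ (ρ₂ k _ _) = ρ₂₃.representation k (c₂ k) (c₂² k)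
    ρ (ρ₃ k _ _) = ρ₂₃.representation k (c₃ k) (c₃² k)

    private
      -- Multiplied by ξᵏ the difference becomes ξ²ᵏ - 1, and 0 < 2k < 2n.
      ξᵏ-ηᵏ#0 : ∀ k → 1 ℕ.≤ k → k ℕ.< n → ξ ^ k - η ^ k # 0#
      ξᵏ-ηᵏ#0 k 0<k k<n = *#0⇒#0ʳ (ξ ^ k) (#-congʳ (begin
        ξ ^ (k ℕ.+ k) - 1#                ≈⟨ +-cong (^-homo-* ξ k k) (-‿cong (sym (^-inverse ξη≈1 k))) ⟩
        ξ ^ k * ξ ^ k - ξ ^ k * η ^ k     ≈⟨ factor (ξ ^ k) (η ^ k) ⟩
        ξ ^ k * (ξ ^ k - η ^ k)           ∎) (ξʲ#1 (k ℕ.+ k) (ℕ.<-≤-trans 0<k (ℕ.m≤m+n k k)) k+k<2n))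
        where
        factor : ∀ x y → x * x - x * y ≈ x * (x - y)
        factor = solve 2 (λ x y → x :* x :- x :* y := x :* (x :- y)) refl

        k+k<2n : k ℕ.+ k ℕ.< 2 ℕ.* n
        k+k<2n = ≡.subst (k ℕ.+ k ℕ.<_) (≡.sym 2n≡n+n) (ℕ.+-mono-< k<n k<n)

    ρ-irreducible : ∀ l → IsIrreducible (ρ l)
    ρ-irreducible (ρ₁ j)         = ρ₁.irreducible j
    ρ-irreducible (ρ₂ k 0<k k<n) = ρ₂₃.irreducible k (c₂ k) (c₂² k)
      -- The bounds in a label are irrelevant; decidability of the order on ℕ recovers usable
      -- proofs.
      (ξᵏ-ηᵏ#0 k (recompute (1 ℕ.≤? k) 0<k) (recompute (k ℕ.<? n) k<n))
    ρ-irreducible (ρ₃ k 0<k k<n) = ρ₂₃.irreducible k (c₃ k) (c₃² k)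
      (ξᵏ-ηᵏ#0 k (recompute (1 ℕ.≤? k) 0<k) (recompute (k ℕ.<? n) k<n))

    -- Pairwise inequivalence of the listed representations.

    private
      -- The value of a fixes the parity of the index, since 1 ≠ -1; within one parity the exponent
      -- of the primitive eighth root ω is determined.
      sign-root-injective : ∀ (i j : Fin 8) → sign (toℕ i) ≈ sign (toℕ j) → root (toℕ i) ≈ root (toℕ j) → i ≡ j
      sign-root-injective i j signᵢ≈signⱼ rootᵢ≈rootⱼ =
        Fin.toℕ-injective (compare (even-or-odd (toℕ i)) (even-or-odd (toℕ j)))
        where
        Parity : ℕ → Set
        Parity k = (even k ≡ true × ∃[ q ] k ≡ q ℕ.* 2) ⊎ (even k ≡ false × ∃[ q ] k ≡ suc (q ℕ.* 2))

        ω-injective : ∀ i j → i ℕ.< 8 → j ℕ.< 8 → ω ^ i ≈ ω ^ j → i ≡ j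
        -- ω⁷ plays the inverse of ω: the power ω⁸ unfolds to ω times ω⁷.
        ω-injective = ^-injective {ω} {ω ^ 7} 8 ω⁸≈1 ωʲ#1

        compare : Parity (toℕ i) → Parity (toℕ j) → toℕ i ≡ toℕ j
        compare (inj₁ (e , _)) (inj₁ (e′ , _)) = ω-injective (toℕ i) (toℕ j) (Fin.toℕ<n i) (Fin.toℕ<n j)
          (trans (reflexive (≡.sym (choose {toℕ i} e))) (trans rootᵢ≈rootⱼ (reflexive (choose {toℕ j} e′))))
        compare (inj₁ (e , _)) (inj₂ (e′ , _)) = contradiction
          (trans (reflexive (≡.sym (choose {toℕ i} e))) (trans signᵢ≈signⱼ (reflexive (choose {toℕ j} e′)))) 1≉-1
        compare (inj₂ (e , _)) (inj₁ (e′ , _)) = contradiction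
          (trans (reflexive (≡.sym (choose {toℕ j} e′))) (trans (sym signᵢ≈signⱼ) (reflexive (choose {toℕ i} e)))) 1≉-1
        compare (inj₂ (e , p , i≡1+2p)) (inj₂ (e′ , q , j≡1+2q)) =
          ≡.trans i≡1+2p (≡.trans (≡.cong suc (ω-injective (p ℕ.* 2) (q ℕ.* 2)
            (below i≡1+2p) (below j≡1+2q) ω²ᵖ≈ω²ᑫ)) (≡.sym j≡1+2q))
          where
          below : ∀ {k : Fin 8} {m} → toℕ k ≡ suc m → m ℕ.< 8
          below {k} k≡1+m = ℕ.<⇒≤ (≡.subst (ℕ._< 8) k≡1+m (Fin.toℕ<n k))

          ω²ᵖ≈ω²ᑫ : ω ^ (p ℕ.* 2) ≈ ω ^ (q ℕ.* 2)
          ω²ᵖ≈ω²ᑫ = begin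
            ω ^ (p ℕ.* 2)       ≡⟨ ≡.cong (λ k → ω ^ (k ℕ.∸ 1)) i≡1+2p ⟨
            ω ^ (toℕ i ℕ.∸ 1)   ≡⟨ choose {toℕ i} e ⟨
            root (toℕ i)        ≈⟨ rootᵢ≈rootⱼ ⟩
            root (toℕ j)        ≡⟨ choose {toℕ j} e′ ⟩
            ω ^ (toℕ j ℕ.∸ 1)   ≡⟨ ≡.cong (λ k → ω ^ (k ℕ.∸ 1)) j≡1+2q ⟩
            ω ^ (q ℕ.* 2)       ∎

      -- For x = ξᵏ and y = ξʰ one has (x y - 1)(x - y) = x y ((x + x⁻¹) - (y + y⁻¹)), and x y =
      -- ξᵏ⁺ʰ is apart from 1 because 0 < k + h < 2n. The added zeros come from unfolding the trace
      -- of a.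
      ξᵏ+ηᵏ-injective : ∀ k h → 1 ℕ.≤ k → k ℕ.< n → h ℕ.< n →
                        ξ ^ k + (η ^ k + 0#) ≈ ξ ^ h + (η ^ h + 0#) → k ≡ h
      ξᵏ+ηᵏ-injective k h 0<k k<n h<n traces =
        ^-injective (2 ℕ.* n) ξη≈1 ξʲ#1 k h (ℕ.<-≤-trans k<n n≤2n) (ℕ.<-≤-trans h<n n≤2n)
          (x-y≈0⇒x≈y (#0∧*≈0⇒≈0 (ξʲ#1 (k ℕ.+ h) (ℕ.<-≤-trans 0<k (ℕ.m≤m+n k h)) k+h<2n) (begin
            (ξ ^ (k ℕ.+ h) - 1#) * (x - y)   ≈⟨ *-congʳ (+-congʳ (^-homo-* ξ k h)) ⟩
            (x * y - 1#) * (x - y)           ≈⟨ expand x y ⟩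
            (x * x * y + y * 1#) - (y * y * x + x * 1#)
              ≈⟨ +-cong (+-congˡ (*-congˡ (^-inverse ξη≈1 k))) (-‿cong (+-congˡ (*-congˡ (^-inverse ξη≈1 h)))) ⟨
            (x * x * y + y * (x * x⁻)) - (y * y * x + x * (y * y⁻))   ≈⟨ collect x y x⁻ y⁻ ⟩
            x * y * ((x + (x⁻ + 0#)) - (y + (y⁻ + 0#)))   ≈⟨ *-congˡ (+-congʳ traces) ⟩
            x * y * ((y + (y⁻ + 0#)) - (y + (y⁻ + 0#)))   ≈⟨ *-congˡ (-‿inverseʳ _) ⟩
            x * y * 0#                       ≈⟨ zeroʳ (x * y) ⟩
            0#                               ∎)))
        where
        x y x⁻ y⁻ : Carrier
        x  = ξ ^ k
        y  = ξ ^ h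
        x⁻ = η ^ k
        y⁻ = η ^ h

        n≤2n : n ℕ.≤ 2 ℕ.* n
        n≤2n = ℕ.m≤m+n n (n ℕ.+ 0)

        k+h<2n : k ℕ.+ h ℕ.< 2 ℕ.* n
        k+h<2n = ≡.subst (k ℕ.+ h ℕ.<_) (≡.sym 2n≡n+n) (ℕ.+-mono-< k<n h<n)

        x-y≈0⇒x≈y : x - y ≈ 0# → x ≈ y
        x-y≈0⇒x≈y p = trans (restore x y) (trans (+-congʳ p) (+-identityˡ y))
          where
          restore : ∀ x y → x ≈ (x - y) + y
          restore = solve 2 (λ x y → x := (x :- y) :+ y) refl

        expand : ∀ x y → (x * y - 1#) * (x - y) ≈ (x * x * y + y * 1#) - (y * y * x + x * 1#)
        expand = solve 2 (λ x y → (x :* y :- con (1 , 0)) :* (x :- y)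
          := (x :* x :* y :+ y :* con (1 , 0)) :- (y :* y :* x :+ x :* con (1 , 0))) refl

        collect : ∀ x y x⁻ y⁻ → (x * x * y + y * (x * x⁻)) - (y * y * x + x * (y * y⁻))
                              ≈ x * y * ((x + (x⁻ + 0#)) - (y + (y⁻ + 0#)))
        collect = solve 4 (λ x y x⁻ y⁻ → (x :* x :* y :+ y :* (x :* x⁻)) :- (y :* y :* x :+ x :* (y :* y⁻))
          := x :* y :* ((x :+ (x⁻ :+ con (0 , 0))) :- (y :+ (y⁻ :+ con (0 , 0))))) refl

      -- For equal indices a has the same trace on both sides and b has trace 0, so b² is compared:
      -- it acts by c₂ and by - c₂, and the traces differ by 4 c₂.
      ρ₂≇ρ₃ : ∀ k h → k ≡ h → ¬ trace (act (ρ₂₃.representation k (c₂ k) (c₂² k)) (b P.∙ b))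
                   ≈ trace (act (ρ₂₃.representation h (c₃ h) (c₃² h)) (b P.∙ b))
      ρ₂≇ρ₃ k .k ≡.refl traces = #⇒≉ (x#0y#0→xy#0 (x#0y#0→xy#0 2#0 2#0) (c₂#0 k)) (begin
        (1# + 1#) * (1# + 1#) * c₂ k                  ≈⟨ expand (c₂ k) ⟩
        (c₂ k + (c₂ k + 0#)) - (- c₂ k + (- c₂ k + 0#)) ≡⟨ ≡.cong (λ c → (c₂ k + (c₂ k + 0#)) - (c + (c + 0#))) (c₃≡-c₂ k) ⟨
        trace (diagonal (c₂ k) (c₂ k)) - trace (diagonal (c₃ k) (c₃ k))
          ≈⟨ +-congʳ (trans (sym (trace-cong (ρ₂₃.B² k (c₂ k) (c₂² k))))
               (trans traces (trace-cong (ρ₂₃.B² k (c₃ k) (c₃² k))))) ⟩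
        trace (diagonal (c₃ k) (c₃ k)) - trace (diagonal (c₃ k) (c₃ k)) ≈⟨ -‿inverseʳ _ ⟩
        0#                                            ∎)
        where
        expand : ∀ x → (1# + 1#) * (1# + 1#) * x ≈ (x + (x + 0#)) - (- x + (- x + 0#))
        expand = solve 1 (λ x → (con (1 , 0) :+ con (1 , 0)) :* (con (1 , 0) :+ con (1 , 0)) :* x
          := (x :+ (x :+ con (0 , 0))) :- (:- x :+ (:- x :+ con (0 , 0)))) refl

      same-eigenvalues : ∀ k h .(0<k : 1 ℕ.≤ k) .(k<n : k ℕ.< n) .(h<n : h ℕ.< n) {s t p q} →
                         ρ₂₃.representation k s p ≅ ρ₂₃.representation h t q → k ≡ h
      same-eigenvalues k h 0<k k<n h<n ρ≅σ = ξᵏ+ηᵏ-injective k h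
        (recompute (1 ℕ.≤? k) 0<k) (recompute (k ℕ.<? n) k<n) (recompute (h ℕ.<? n) h<n) (≅⇒trace ρ≅σ a)

    ρ-injective : ∀ l l′ → ρ l ≅ ρ l′ → l ≡ l′
    ρ-injective (ρ₁ i) (ρ₁ j) ρᵢ≅ρⱼ = ≡.cong ρ₁ (sign-root-injective i j (traces a) (traces b))
      where
      traces : ∀ g → act (ρ (ρ₁ i)) g 0F 0F ≈ act (ρ (ρ₁ j)) g 0F 0F
      traces g = trans (sym (+-identityʳ _)) (trans (≅⇒trace ρᵢ≅ρⱼ g) (+-identityʳ _))
    ρ-injective (ρ₂ k 0<k k<n) (ρ₂ h 0<h h<n) ρ≅ρ′ = cong-ρ₂ (same-eigenvalues k h 0<k k<n h<n ρ≅ρ′)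
      where
      cong-ρ₂ : k ≡ h → ρ₂ k 0<k k<n ≡ ρ₂ h 0<h h<n
      cong-ρ₂ ≡.refl = ≡.refl
    ρ-injective (ρ₃ k 0<k k<n) (ρ₃ h 0<h h<n) ρ≅ρ′ = cong-ρ₃ (same-eigenvalues k h 0<k k<n h<n ρ≅ρ′)
      where
      cong-ρ₃ : k ≡ h → ρ₃ k 0<k k<n ≡ ρ₃ h 0<h h<n
      cong-ρ₃ ≡.refl = ≡.refl
    ρ-injective (ρ₂ k 0<k k<n) (ρ₃ h 0<h h<n) ρ≅ρ′ =
      contradiction (≅⇒trace ρ≅ρ′ (b P.∙ b)) (ρ₂≇ρ₃ k h (same-eigenvalues k h 0<k k<n h<n ρ≅ρ′))
    ρ-injective (ρ₃ k 0<k k<n) (ρ₂ h 0<h h<n) ρ≅ρ′ =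
      contradiction (sym (≅⇒trace ρ≅ρ′ (b P.∙ b))) (ρ₂≇ρ₃ h k (≡.sym (same-eigenvalues k h 0<k k<n h<n ρ≅ρ′)))
    ρ-injective (ρ₁ _) (ρ₂ _ _ _) ()
    ρ-injective (ρ₁ _) (ρ₃ _ _ _) ()
    ρ-injective (ρ₂ _ _ _) (ρ₁ _) ()
    ρ-injective (ρ₃ _ _ _) (ρ₁ _) ()

    -- Completeness: every irreducible representation is equivalent to a listed one.

    module _ {m} (σ : Representation m) (σ-irreducible : IsIrreducible σ) where

      private
        A B : Mat m m
        A = act σ a
        B = act σ b

        infixr 8 _∙ᵥ_

        _∙ᵥ_ : P.Word → Vector Carrier m → Vector Carrier m
        g ∙ᵥ v = act σ g ⊛ v

        ∙ᵥ-assoc : ∀ g h v → (g P.∙ h) ∙ᵥ v ≋ⱽ g ∙ᵥ h ∙ᵥ v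
        ∙ᵥ-assoc g h v i = trans (⊛-congʳ v (act-∙ σ g h) i) (⊛-assoc (act σ g) (act σ h) v i)

        ∙ᵥ-congʳ : ∀ {g h} → g T.≈ h → ∀ v → g ∙ᵥ v ≋ⱽ h ∙ᵥ v
        ∙ᵥ-congʳ g≈h v = ⊛-congʳ v (act-cong σ g≈h)

        ∙ᵥ-congˡ : ∀ g {v w} → v ≋ⱽ w → g ∙ᵥ v ≋ⱽ g ∙ᵥ w
        ∙ᵥ-congˡ g = ⊛-congˡ (act σ g)

        ε∙ᵥ : ∀ v → P.ε ∙ᵥ v ≋ⱽ v
        ε∙ᵥ v i = trans (⊛-congʳ v (act-ε σ) i) (⊛-identityˡ v i)

        ⁻¹∙ᵥ : ∀ g v → (g P.⁻¹) ∙ᵥ g ∙ᵥ v ≋ⱽ v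
        ⁻¹∙ᵥ g v i = trans (sym (∙ᵥ-assoc (g P.⁻¹) g v i)) (trans (∙ᵥ-congʳ (T.inverseˡ g) v i) (ε∙ᵥ v i))

        eigenvalue-power : ∀ {s v} → Eigenvector A s v → ∀ k → (a P.^ k) ∙ᵥ v ≋ⱽ λ i → s ^ k * v i
        eigenvalue-power {v = v} Av zero i = trans (ε∙ᵥ v i) (sym (*-identityˡ (v i)))
        eigenvalue-power {s} {v} Av (suc k) i = begin
          ((a P.^ suc k) ∙ᵥ v) i           ≈⟨ ∙ᵥ-assoc a (a P.^ k) v i ⟩
          (a ∙ᵥ (a P.^ k) ∙ᵥ v) i          ≈⟨ ∙ᵥ-congˡ a (eigenvalue-power Av k) i ⟩
          (a ∙ᵥ (λ i → s ^ k * v i)) i     ≈⟨ ⊛-* A (s ^ k) v i ⟩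
          s ^ k * (A ⊛ v) i                ≈⟨ *-congˡ (Av i) ⟩
          s ^ k * (s * v i)                ≈⟨ *-assoc (s ^ k) s (v i) ⟨
          s ^ k * s * v i                  ≈⟨ *-congʳ (*-comm (s ^ k) s) ⟩
          s ^ suc k * v i                  ∎

        B-inverts-eigenvalue : ∀ {s t v} → s * t ≈ 1# → Eigenvector A s v → Eigenvector A t (B ⊛ v)
        B-inverts-eigenvalue {s} {t} {v} st≈1 Av i = begin
          (a ∙ᵥ b ∙ᵥ v) i                  ≈⟨ ∙ᵥ-assoc a b v i ⟨
          ((a P.∙ b) ∙ᵥ v) i               ≈⟨ ∙ᵥ-congʳ ab≈ba⁻¹ v i ⟩
          ((b P.∙ a P.⁻¹) ∙ᵥ v) i          ≈⟨ ∙ᵥ-assoc b (a P.⁻¹) v i ⟩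
          (b ∙ᵥ (a P.⁻¹) ∙ᵥ v) i           ≈⟨ ∙ᵥ-congˡ b a⁻¹v i ⟩
          (b ∙ᵥ (λ i → t * v i)) i         ≈⟨ ⊛-* B t v i ⟩
          t * (B ⊛ v) i                    ∎
          where
          v≋tAv : v ≋ⱽ λ i → t * (A ⊛ v) i
          v≋tAv i = begin
            v i              ≈⟨ *-identityˡ (v i) ⟨
            1# * v i         ≈⟨ *-congʳ (trans (*-comm t s) st≈1) ⟨
            t * s * v i      ≈⟨ *-assoc t s (v i) ⟩
            t * (s * v i)    ≈⟨ *-congˡ (Av i) ⟨
            t * (A ⊛ v) i    ∎

          a⁻¹v : (a P.⁻¹) ∙ᵥ v ≋ⱽ λ i → t * v i
          a⁻¹v i = begin
            ((a P.⁻¹) ∙ᵥ v) i                          ≈⟨ ∙ᵥ-congˡ (a P.⁻¹) v≋tAv i ⟩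
            ((a P.⁻¹) ∙ᵥ (λ i → t * (A ⊛ v) i)) i      ≈⟨ ⊛-* (act σ (a P.⁻¹)) t (A ⊛ v) i ⟩
            t * ((a P.⁻¹) ∙ᵥ a ∙ᵥ v) i                 ≈⟨ *-congˡ (⁻¹∙ᵥ a v i) ⟩
            t * v i                                    ∎

        b²-preserves-eigenvalue : ∀ {s t v} → s * t ≈ 1# → Eigenvector A s v →
                                  Eigenvector A s (act σ (b P.∙ b) ⊛ v)
        b²-preserves-eigenvalue {s} {t} {v} st≈1 Av i = begin
          (a ∙ᵥ (b P.∙ b) ∙ᵥ v) i     ≈⟨ ∙ᵥ-congˡ a (∙ᵥ-assoc b b v) i ⟩
          (a ∙ᵥ b ∙ᵥ b ∙ᵥ v) i        ≈⟨ B-inverts-eigenvalue (trans (*-comm t s) st≈1) (B-inverts-eigenvalue st≈1 Av) i ⟩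
          s * (b ∙ᵥ b ∙ᵥ v) i         ≈⟨ *-congˡ (∙ᵥ-assoc b b v i) ⟨
          s * ((b P.∙ b) ∙ᵥ v) i      ∎

        -- On the s-eigenspace of a, b⁴ = aⁿ is the scalar sⁿ. A square root t of it is exactly what
        -- `split-eigenvector` requires in order to diagonalize b².
        b⁴-scales : ∀ {s t v} → t * t ≈ s ^ n → Eigenvector A s v →
                    act σ (b P.∙ b) ⊛ (act σ (b P.∙ b) ⊛ v) ≋ⱽ λ i → t * t * v i
        b⁴-scales {s} {t} {v} t²≈sⁿ Av i = begin
          ((b P.∙ b) ∙ᵥ (b P.∙ b) ∙ᵥ v) i          ≈⟨ ∙ᵥ-assoc (b P.∙ b) (b P.∙ b) v i ⟨
          ((b P.∙ b P.∙ (b P.∙ b)) ∙ᵥ v) i         ≈⟨ ∙ᵥ-congʳ b²b²≈aⁿ v i ⟩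
          ((a P.^ n) ∙ᵥ v) i                       ≈⟨ eigenvalue-power Av n i ⟩
          s ^ n * v i                              ≈⟨ *-congʳ t²≈sⁿ ⟨
          t * t * v i                              ∎

        intertwines : ∀ {d} (ρ : Representation d) (V : Mat m d) →
                      Intertwines ρ σ V a → Intertwines ρ σ V b → ∀ g → Intertwines ρ σ V g
        intertwines ρ V p q (P.gen ‵a) = p
        intertwines ρ V p q (P.gen ‵b) = q
        intertwines ρ V p q P.ε = intertwines-ε ρ σ V
        intertwines ρ V p q (g P.∙ h) = intertwines-∙ ρ σ V (intertwines ρ V p q g) (intertwines ρ V p q h)
        intertwines ρ V p q (g P.⁻¹) = intertwines-⁻¹ ρ σ V (intertwines ρ V p q g)

        eigenvector-of-A : ∃[ k ] ∃[ v ] k ℕ.< 2 ℕ.* n × Eigenvector A (ξ ^ k) v × NonZeroⱽ v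
        eigenvector-of-A =
          fourier A (2 ℕ.* n) {{ℕ.m*n≢0 2 n}} ξ η ξη≈1 ξ²ⁿ≈1 ξʲ#1 2n#0 (λ j → (a P.^ j) ∙ᵥ e₀)
            (λ j i → sym (∙ᵥ-assoc a (a P.^ j) e₀ i))
            (λ i → ∙ᵥ-congʳ (P.relator a²ⁿ=e) e₀ i)
            (i₀ , #-congʳ (trans (sym e₀ᵢ≈1) (sym (ε∙ᵥ e₀ i₀))) 1#0)
          where
          2n#0 : (2 ℕ.* n) · 1# # 0#
          2n#0 = ≡.subst (λ k → k · 1# # 0#) (ℕ.suc-pred (2 ℕ.* n) {{ℕ.m*n≢0 2 n}}) (suc·1#0 (ℕ.pred (2 ℕ.* n)))

          first : ∀ m → NonZero m → Fin m
          first (suc m) _ = 0F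

          i₀ : Fin m
          i₀ = first m (IsIrreducible.nonZero σ-irreducible)

          e₀ : Vector Carrier m
          e₀ i = 1ᴹ i i₀

          e₀ᵢ≈1 : e₀ i₀ ≈ 1#
          e₀ᵢ≈1 = reflexive (≡.cong (if_then 1# else 0#) (dec-true (i₀ Fin.≟ i₀) ≡.refl))

        HasLabel : Carrier → Carrier → Set
        HasLabel s t = ∃[ j ] s ≈ sign (toℕ {8} j) × t ≈ root (toℕ j)

        common-eigenvector : ∀ {s t v} → Eigenvector A s v → Eigenvector B t v → NonZeroⱽ v → HasLabel s t →
                             ∃[ l ] σ ≅ ρ l
        common-eigenvector {v = v} Av Bv (i , vᵢ#0) (j , s≈ , t≈) =
          ρ₁ j , schur suc·1#0 V (intertwines (ρ (ρ₁ j)) V (column Av s≈) (column Bv t≈))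
                   (ρ-irreducible (ρ₁ j)) σ-irreducible (i , 0F , vᵢ#0)
          where
          V : Mat m 1
          V i _ = v i

          column : ∀ {M s x} → Eigenvector M s v → s ≈ x → V ⊗ 1×1 x ≋ M ⊗ V
          column {M} {s} {x} Mv s≈x i 0F = begin
            v i * x + 0#   ≈⟨ +-identityʳ _ ⟩
            v i * x        ≈⟨ *-congˡ s≈x ⟨
            v i * s        ≈⟨ *-comm (v i) s ⟩
            s * v i        ≈⟨ Mv i ⟨
            (M ⊛ v) i      ∎

        module _ {s : Carrier} (s²≈1 : s * s ≈ 1#) where

          one-dimensional′ : ∀ t c w → c * c ≈ t → c # 0# → Eigenvector A s w → Eigenvector (act σ (b P.∙ b)) t w →
                             NonZeroⱽ w → HasLabel s c → HasLabel s (- c) → ∃[ l ] σ ≅ ρ l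
          one-dimensional′ t c w c²≈t c#0 Aw b²w w#0 label label⁻ =
            conclude (split-eigenvector 2#0 A B s c w c#0 w#0 Aw (B-inverts-eigenvalue s²≈1 Aw) (λ i → begin
              (b ∙ᵥ b ∙ᵥ w) i      ≈⟨ ∙ᵥ-assoc b b w i ⟨
              ((b P.∙ b) ∙ᵥ w) i   ≈⟨ b²w i ⟩
              t * w i              ≈⟨ *-congʳ c²≈t ⟨
              c * c * w i          ∎))
            where
            conclude : (∃[ r ] (r ≡ c ⊎ r ≡ - c) × ∃[ u ] Eigenvector A s u × Eigenvector B r u × NonZeroⱽ u) →
                       ∃[ l ] σ ≅ ρ l
            conclude (_ , inj₁ ≡.refl , u , Au , Bu , u#0) = common-eigenvector Au Bu u#0 label
            conclude (_ , inj₂ ≡.refl , u , Au , Bu , u#0) = common-eigenvector Au Bu u#0 label⁻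

          -- As s = ± 1 and n is even, b⁴ acts by 1. So b² takes the value 1 or -1, and b one of ± 1
          -- or ± ω², because ω² is a square root of -1. The label arguments cover these four
          -- outcomes.
          one-dimensional : ∀ {v} → Eigenvector A s v → NonZeroⱽ v →
            HasLabel s 1# → HasLabel s (- 1#) → HasLabel s (ω ^ 2) → HasLabel s (- (ω ^ 2)) → ∃[ l ] σ ≅ ρ l
          one-dimensional {v} Av v#0 l₁ l₋₁ l₂ l₋₂ =
            conclude (split-eigenvector 2#0 A (act σ (b P.∙ b)) s 1# v 1#0 v#0 Av (b²-preserves-eigenvalue s²≈1 Av)
              (b⁴-scales (trans (*-identityˡ 1#) (sym (^n≈1 s²≈1))) Av))
            where
            ω²ω²≈-1 : ω ^ 2 * ω ^ 2 ≈ - 1#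
            ω²ω²≈-1 = trans (sym (^-homo-* ω 2 2)) ω⁴≈-1

            ω²#0 : ω ^ 2 # 0#
            ω²#0 = invertible⇒#0 (ω ^ 6) (trans (sym (^-homo-* ω 6 2)) ω⁸≈1)

            conclude : (∃[ t ] (t ≡ 1# ⊎ t ≡ - 1#) ×
                         ∃[ w ] Eigenvector A s w × Eigenvector (act σ (b P.∙ b)) t w × NonZeroⱽ w) →
                       ∃[ l ] σ ≅ ρ l
            conclude (_ , inj₁ ≡.refl , w , Aw , b²w , w#0) =
              one-dimensional′ 1# 1# w (*-identityˡ 1#) 1#0 Aw b²w w#0 l₁ l₋₁
            conclude (_ , inj₂ ≡.refl , w , Aw , b²w , w#0) =
              one-dimensional′ (- 1#) (ω ^ 2) w ω²ω²≈-1 ω²#0 Aw b²w w#0 l₂ l₋₂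

        ω⁶≈-ω² : - (ω ^ 2) ≈ ω ^ 6
        ω⁶≈-ω² = sym (trans (^-homo-* ω 4 2) (trans (*-congʳ ω⁴≈-1) (-1*x≈-x (ω ^ 2))))

        A-fixes : ∀ {v} → Eigenvector A 1# v → NonZeroⱽ v → ∃[ l ] σ ≅ ρ l
        A-fixes Av v#0 = one-dimensional (*-identityˡ 1#) Av v#0
          -- The values 1, -1, ω², - ω² of b are the powers of ω with exponents 0, 4, 2, 6.
          (0F , refl , refl) (4F , refl , sym ω⁴≈-1) (2F , refl , refl) (6F , refl , ω⁶≈-ω²)

        A-negates : ∀ {v} → Eigenvector A (- 1#) v → NonZeroⱽ v → ∃[ l ] σ ≅ ρ l
        A-negates Av v#0 = one-dimensional -1*-1≈1 Av v#0
          -- Same exponents 0, 4, 2, 6, each belonging to the odd label one larger.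
          (1F , refl , refl) (5F , refl , sym ω⁴≈-1) (3F , refl , refl) (7F , refl , ω⁶≈-ω²)

        module _ (k : ℕ) (0<k : 1 ℕ.≤ k) (k<n : k ℕ.< n) where

          -- Open in s, so that ρ₂ₖ and ρ₃ₖ are treated at once. The second column of V is b v,
          -- which b sends to b² v = s v; this matches the entry s of the antidiagonal matrix.
          two-dimensional′ : ∀ {s p v} → Eigenvector A (ξ ^ k) v → Eigenvector (act σ (b P.∙ b)) s v → NonZeroⱽ v →
                             IsIrreducible (ρ₂₃.representation k s p) → σ ≅ ρ₂₃.representation k s p
          two-dimensional′ {s} {p} {v} Av b²v (i , vᵢ#0) irreducible =
            schur suc·1#0 V (intertwines (ρ₂₃.representation k s p) V VA≋AV VB≋BV)
              irreducible σ-irreducible (i , 0F , vᵢ#0)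
            where
            V : Mat m 2
            V i 0F = v i
            V i 1F = (B ⊛ v) i

            first : ∀ x y z → x * z + (y * 0# + 0#) ≈ z * x
            first = solve 3 (λ x y z → x :* z :+ (y :* con (0 , 0) :+ con (0 , 0)) := z :* x) refl

            second : ∀ x y z → x * 0# + (y * z + 0#) ≈ z * y
            second = solve 3 (λ x y z → x :* con (0 , 0) :+ (y :* z :+ con (0 , 0)) := z :* y) refl

            VA≋AV : V ⊗ diagonal (ξ ^ k) (η ^ k) ≋ A ⊗ V
            VA≋AV i 0F = trans (first (v i) ((B ⊛ v) i) (ξ ^ k)) (sym (Av i))
            VA≋AV i 1F = trans (second (v i) ((B ⊛ v) i) (η ^ k)) (sym (B-inverts-eigenvalue (^-inverse ξη≈1 k) Av i))

            VB≋BV : V ⊗ antidiagonal s 1# ≋ B ⊗ V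
            VB≋BV i 0F = trans (second (v i) ((B ⊛ v) i) 1#) (*-identityˡ _)
            VB≋BV i 1F = trans (first (v i) ((B ⊛ v) i) s) (trans (sym (b²v i)) (∙ᵥ-assoc b b v i))

          two-dimensional : ∀ {v} → Eigenvector A (ξ ^ k) v → NonZeroⱽ v → ∃[ l ] σ ≅ ρ l
          two-dimensional {v} Av v#0 =
            conclude (split-eigenvector 2#0 A (act σ (b P.∙ b)) (ξ ^ k) (c₂ k) v (c₂#0 k) v#0 Av
              (b²-preserves-eigenvalue (^-inverse ξη≈1 k) Av) (b⁴-scales (trans (c₂² k) (sym ([ξᵏ]ⁿ k))) Av))
            where
            conclude : (∃[ t ] (t ≡ c₂ k ⊎ t ≡ - c₂ k) ×
                         ∃[ w ] Eigenvector A (ξ ^ k) w × Eigenvector (act σ (b P.∙ b)) t w × NonZeroⱽ w) →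
                       ∃[ l ] σ ≅ ρ l
            conclude (_ , inj₁ ≡.refl , w , Aw , b²w , w#0) =
              ρ₂ k 0<k k<n , two-dimensional′ Aw b²w w#0 (ρ-irreducible (ρ₂ k 0<k k<n))
            conclude (_ , inj₂ ≡.refl , w , Aw , b²w , w#0) =
              ρ₃ k 0<k k<n , two-dimensional′ Aw
                (λ i → trans (b²w i) (*-congʳ (reflexive (≡.sym (c₃≡-c₂ k))))) w#0 (ρ-irreducible (ρ₃ k 0<k k<n))

        conclude : (∃[ k ] ∃[ v ] k ℕ.< 2 ℕ.* n × Eigenvector A (ξ ^ k) v × NonZeroⱽ v) → ∃[ l ] σ ≅ ρ l
        conclude (zero , v , _ , Av , v#0) = A-fixes Av v#0
        conclude (k@(suc _) , v , k<2n , Av , v#0) = cases (ℕ.<-cmp k n)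
          where
          cases : _ → ∃[ l ] σ ≅ ρ l
          cases (tri< k<n _ _) = two-dimensional k (ℕ.s≤s ℕ.z≤n) k<n Av v#0
          cases (tri≈ _ k≡n _) = A-negates (λ i → trans (Av i) (*-congʳ (trans (^-congʳ ξ k≡n) ξⁿ≈-1))) v#0
          cases (tri> _ _ n<k) = two-dimensional (2 ℕ.* n ℕ.∸ k) (ℕ.m<n⇒0<n∸m k<2n) 2n-k<n
            (λ i → trans (B-inverts-eigenvalue (^-inverse ξη≈1 k) Av i) (*-congʳ ηᵏ≈ξ²ⁿ⁻ᵏ))
            -- b v is nonzero because b⁻¹ maps it to the nonzero vector v.
            (NonZeroⱽ-preimage (act σ (b P.⁻¹)) (B ⊛ v) (proj₁ v#0 , #-congʳ (sym (⁻¹∙ᵥ b v (proj₁ v#0))) (proj₂ v#0)))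
            where
            2n-k<n : 2 ℕ.* n ℕ.∸ k ℕ.< n
            2n-k<n = ℕ.+-cancelˡ-< k _ _ (≡.subst₂ ℕ._<_ (≡.sym (ℕ.m+[n∸m]≡n (ℕ.<⇒≤ k<2n))) ≡.refl
              (≡.subst (ℕ._< k ℕ.+ n) (≡.sym 2n≡n+n) (ℕ.+-monoˡ-< n n<k)))

            ηᵏ≈ξ²ⁿ⁻ᵏ : η ^ k ≈ ξ ^ (2 ℕ.* n ℕ.∸ k)
            ηᵏ≈ξ²ⁿ⁻ᵏ = begin
              η ^ k                                          ≈⟨ *-identityˡ _ ⟨
              1# * η ^ k                                     ≈⟨ *-congʳ ξ²ⁿ≈1 ⟨
              ξ ^ (2 ℕ.* n) * η ^ k                          ≈⟨ *-congʳ (^-congʳ ξ (ℕ.m∸n+n≡m (ℕ.<⇒≤ k<2n))) ⟨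
              ξ ^ (2 ℕ.* n ℕ.∸ k ℕ.+ k) * η ^ k              ≈⟨ *-congʳ (^-homo-* ξ (2 ℕ.* n ℕ.∸ k) k) ⟩
              ξ ^ (2 ℕ.* n ℕ.∸ k) * ξ ^ k * η ^ k            ≈⟨ *-assoc _ _ _ ⟩
              ξ ^ (2 ℕ.* n ℕ.∸ k) * (ξ ^ k * η ^ k)          ≈⟨ *-congˡ (^-inverse ξη≈1 k) ⟩
              ξ ^ (2 ℕ.* n ℕ.∸ k) * 1#                       ≈⟨ *-identityʳ _ ⟩
              ξ ^ (2 ℕ.* n ℕ.∸ k)                            ∎

      ρ-exhaustive : ∃[ l ] σ ≅ ρ l
      ρ-exhaustive = conclude eigenvector-of-A

    ρ-isCompleteListOfIrreducibles : IsCompleteListOfIrreducibles ρ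
    ρ-isCompleteListOfIrreducibles = record
      { irreducible        = ρ-irreducible
      ; without-repetition = ρ-injective
      ; complete           = ρ-exhaustive
      }

-- Cauchy products and the recurrence of the exponential series.

module Convolution (R : CommutativeRing 0ℓ 0ℓ) where

  open CommutativeRing R hiding (zero)
  open Algebra.Properties.Semiring.Sum semiring
  open Algebra.Properties.Semiring.Mult semiring using () renaming (_×_ to _·_)
  open DifferenceSolver R using (solve; con; _:+_; _:*_; _:=_)
  open Relation.Binary.Reasoning.Setoid setoid

  Sequence : Set
  Sequence = ℕ → Carrier

  partial-sum : Sequence → Sequence
  partial-sum f N = ∑[ k < N ] f (toℕ k)

  -- ∑ fⱼ gₖ over j + k = s.
  conv : Sequence → Sequence → Sequence
  conv f g zero    = f 0 * g 0
  conv f g (suc s) = f 0 * g (suc s) + conv (f ∘ suc) g s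

  -- ∑ fⱼ gₖ over j + k < N.
  triangle : Sequence → Sequence → Sequence
  triangle f g zero    = 0#
  triangle f g (suc N) = f 0 * partial-sum g (suc N) + triangle (f ∘ suc) g N

  conv-congˡ : ∀ {f f′} g → (∀ k → f k ≈ f′ k) → ∀ s → conv f g s ≈ conv f′ g s
  conv-congˡ g f≈f′ zero    = *-congʳ (f≈f′ 0)
  conv-congˡ g f≈f′ (suc s) = +-cong (*-congʳ (f≈f′ 0)) (conv-congˡ g (f≈f′ ∘ suc) s)

  conv-scaleˡ : ∀ x f g s → conv (λ k → x * f k) g s ≈ x * conv f g s
  conv-scaleˡ x f g zero    = *-assoc x (f 0) (g 0)
  conv-scaleˡ x f g (suc s) =
    trans (+-cong (*-assoc x (f 0) (g (suc s))) (conv-scaleˡ x (f ∘ suc) g s)) (sym (distribˡ x _ _))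

  -- The same triangle of products is summed once by rows and once by diagonals.
  triangle≈sum-conv : ∀ f g N → triangle f g N ≈ partial-sum (conv f g) N
  triangle≈sum-conv f g zero    = refl
  triangle≈sum-conv f g (suc N) = begin
    f 0 * (g 0 + partial-sum (g ∘ suc) N) + triangle (f ∘ suc) g N
      ≈⟨ +-cong (distribˡ (f 0) (g 0) _) (triangle≈sum-conv (f ∘ suc) g N) ⟩
    (f 0 * g 0 + f 0 * partial-sum (g ∘ suc) N) + partial-sum (conv (f ∘ suc) g) N
      ≈⟨ +-congʳ (+-congˡ (*-distribˡ-sum {N} (f 0) (λ k → g (suc (toℕ k))))) ⟩
    (f 0 * g 0 + partial-sum (λ k → f 0 * g (suc k)) N) + partial-sum (conv (f ∘ suc) g) N
      ≈⟨ +-assoc _ _ _ ⟩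
    f 0 * g 0 + (partial-sum (λ k → f 0 * g (suc k)) N + partial-sum (conv (f ∘ suc) g) N)
      ≈⟨ +-congˡ (∑-distrib-+ {N} (λ k → f 0 * g (suc (toℕ k))) (λ k → conv (f ∘ suc) g (toℕ k))) ⟨
    f 0 * g 0 + partial-sum (conv f g ∘ suc) N  ∎

  -- The Leibniz rule for the derivation f ↦ (k fₖ)ₖ; the offset makes the induction work.
  leibniz : ∀ o f g s → conv (λ k → (o ℕ.+ k) · 1# * f k) g s + conv f (λ k → k · 1# * g k) s
                      ≈ (o ℕ.+ s) · 1# * conv f g s
  leibniz o f g zero    = base ((o ℕ.+ 0) · 1#) (f 0) (g 0)
    where
    base : ∀ o x y → o * x * y + x * (0# * y) ≈ o * (x * y)
    base = solve 3 (λ o x y → o :* x :* y :+ x :* (con (0 , 0) :* y) := o :* (x :* y)) refl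
  leibniz o f g (suc s) = begin
    ((o ℕ.+ 0) · 1# * x * y + conv (λ k → (o ℕ.+ suc k) · 1# * f (suc k)) g s) + (x * (suc s · 1# * y) + c₂)
      ≈⟨ +-congʳ (+-cong (*-congʳ (*-congʳ (·-congˡ (ℕ.+-identityʳ o))))
           (conv-congˡ g (λ k → *-congʳ {f (suc k)} (·-congˡ (ℕ.+-suc o k))) s)) ⟩
    (o · 1# * x * y + c₁) + (x * (suc s · 1# * y) + c₂)    ≈⟨ collect (o · 1#) (suc s · 1#) x y c₁ c₂ ⟩
    (o · 1# + suc s · 1#) * (x * y) + (c₁ + c₂)            ≈⟨ +-congˡ (leibniz (suc o) (f ∘ suc) g s) ⟩
    (o · 1# + suc s · 1#) * (x * y) + (suc o ℕ.+ s) · 1# * conv (f ∘ suc) g s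
      ≈⟨ +-cong (*-congʳ (sym (·-homo-+ 1# o (suc s)))) (*-congʳ (·-congˡ (≡.sym (ℕ.+-suc o s)))) ⟩
    (o ℕ.+ suc s) · 1# * (x * y) + (o ℕ.+ suc s) · 1# * conv (f ∘ suc) g s  ≈⟨ distribˡ _ _ _ ⟨
    (o ℕ.+ suc s) · 1# * conv f g (suc s)  ∎
    where
    open Algebra.Properties.Monoid.Mult +-monoid using () renaming (×-homo-+ to ·-homo-+; ×-congˡ to ·-congˡ)
    x = f 0
    y = g (suc s)
    c₁ = conv (λ k → (suc o ℕ.+ k) · 1# * f (suc k)) g s
    c₂ = conv (f ∘ suc) (λ k → k · 1# * g k) s

    collect : ∀ o s x y c₁ c₂ → (o * x * y + c₁) + (x * (s * y) + c₂) ≈ (o + s) * (x * y) + (c₁ + c₂)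
    collect = solve 6 (λ o s x y c₁ c₂ →
      (o :* x :* y :+ c₁) :+ (x :* (s :* y) :+ c₂) := (o :+ s) :* (x :* y) :+ (c₁ :+ c₂)) refl

  -- Meant for g = (k hₖ)ₖ with h exponential: its term at 0 vanishes, so the convolution at s + 1
  -- involves only the shifted terms, and these are w times those of h.
  conv-shiftʳ : ∀ w f g g′ → g 0 ≈ 0# → (∀ k → g (suc k) ≈ w * g′ k) → ∀ s → conv f g (suc s) ≈ w * conv f g′ s
  conv-shiftʳ w f g g′ g₀≈0 g≈wg′ zero = begin
    f 0 * g 1 + f 1 * g 0             ≈⟨ +-cong (*-congˡ (g≈wg′ 0)) (*-congˡ g₀≈0) ⟩
    f 0 * (w * g′ 0) + f 1 * 0#       ≈⟨ base (f 0) (f 1) w (g′ 0) ⟩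
    w * (f 0 * g′ 0)                  ∎
    where
    base : ∀ x y w z → x * (w * z) + y * 0# ≈ w * (x * z)
    base = solve 4 (λ x y w z → x :* (w :* z) :+ y :* con (0 , 0) := w :* (x :* z)) refl
  conv-shiftʳ w f g g′ g₀≈0 g≈wg′ (suc s) = begin
    f 0 * g (suc (suc s)) + conv (f ∘ suc) g (suc s)
      ≈⟨ +-cong (*-congˡ (g≈wg′ (suc s))) (conv-shiftʳ w (f ∘ suc) g g′ g₀≈0 g≈wg′ s) ⟩
    f 0 * (w * g′ (suc s)) + w * conv (f ∘ suc) g′ s       ≈⟨ step (f 0) w (g′ (suc s)) (conv (f ∘ suc) g′ s) ⟩
    w * (f 0 * g′ (suc s) + conv (f ∘ suc) g′ s)           ∎
    where
    step : ∀ x w y c → x * (w * y) + w * c ≈ w * (x * y + c)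
    step = solve 4 (λ x w y c → x :* (w :* y) :+ w :* c := w :* (x :* y :+ c)) refl

  -- The recurrence of zᵏ / k!.
  record IsExponential (z : Carrier) (f : Sequence) : Set where
    field
      f₀≈1 : f 0 ≈ 1#
      step : ∀ k → suc k · 1# * f (suc k) ≈ z * f k

  -- The product rule: the Cauchy product satisfies the differential equation of exp ((z + w) X),
  -- stated for coefficients. This takes the place of the binomial theorem, since the recurrence has
  -- a unique solution.
  conv-isExponential : ∀ {z w f g} → IsExponential z f → IsExponential w g → IsExponential (z + w) (conv f g)
  conv-isExponential {z} {w} {f} {g} f-exp g-exp = record
    { f₀≈1 = trans (*-cong F.f₀≈1 G.f₀≈1) (*-identityˡ 1#)
    ; step = λ s → begin
        suc s · 1# * conv f g (suc s)                                          ≈⟨ leibniz 0 f g (suc s) ⟨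
        (0# * f 0 * g (suc s) + conv (λ k → suc k · 1# * f (suc k)) g s) + conv f (λ k → k · 1# * g k) (suc s)
          ≈⟨ +-cong (trans (+-congʳ (vanish (f 0) (g (suc s)))) (+-identityˡ _))
               (conv-shiftʳ w f (λ k → k · 1# * g k) g (zeroˡ (g 0)) G.step s) ⟩
        conv (λ k → suc k · 1# * f (suc k)) g s + w * conv f g s    ≈⟨ +-congʳ (conv-congˡ g F.step s) ⟩
        conv (λ k → z * f k) g s + w * conv f g s                   ≈⟨ +-congʳ (conv-scaleˡ z f g s) ⟩
        z * conv f g s + w * conv f g s                             ≈⟨ distribʳ (conv f g s) z w ⟨
        (z + w) * conv f g s                                        ∎
    }
    where
    module F = IsExponential f-exp
    module G = IsExponential g-exp

    vanish : ∀ x y → 0# * x * y ≈ 0#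
    vanish x y = trans (*-congʳ (zeroˡ x)) (zeroˡ y)

  module _ (cancel : ∀ k {x y} → suc k · 1# * x ≈ suc k · 1# * y → x ≈ y) where

    exponential-unique : ∀ {z f g} → IsExponential z f → IsExponential z g → ∀ k → f k ≈ g k
    exponential-unique {z} {f} {g} f-exp g-exp = unique
      where
      module F = IsExponential f-exp
      module G = IsExponential g-exp

      unique : ∀ k → f k ≈ g k
      unique zero    = trans F.f₀≈1 (sym G.f₀≈1)
      unique (suc k) = cancel k (trans (F.step k) (trans (*-congˡ (unique k)) (sym (G.step k))))

    triangle-exponential : ∀ {z w f g h} → IsExponential z f → IsExponential w g → IsExponential (z + w) h →
                           ∀ N → triangle f g N ≈ partial-sum h N
    triangle-exponential {f = f} {g} {h} f-exp g-exp h-exp N = trans (triangle≈sum-conv f g N)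
      (sum-cong-≋ {n = N} (λ k → exponential-unique (conv-isExponential f-exp g-exp) h-exp (toℕ k)))

-- Order and powers of one half in the real numbers.

module OrderProperties (ℛ : RealNumbers) where

  open RealNumbers ℛ hiding (zero)
  open OrderedFieldProperties ℛ
  open CommutativeRing commutativeRing using (commutativeSemiring; semiring)
  open Algebra.Properties.CommutativeSemiring.Exp commutativeSemiring
  open Algebra.Properties.Semiring.Mult semiring using (×1-homo-*)
  open DifferenceSolver commutativeRing using (solve; con; _:+_; _:*_; _:-_; :-_; _:=_)
  open Relation.Binary.Reasoning.Setoid setoid

  infix 4 _≤_

  -- As a negation, this order gets transitivity from cotransitivity of `_<_` and antisymmetry from
  -- tightness of apartness.
  _≤_ : Carrier → Carrier → Set
  x ≤ y = ¬ y < x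

  ≤-reflexive : ∀ {x y} → x ≈ y → x ≤ y
  ≤-reflexive x≈y = <-irrefl (sym x≈y)

  ≤-refl : ∀ {x} → x ≤ x
  ≤-refl = ≤-reflexive refl

  <⇒≤ : ∀ {x y} → x < y → x ≤ y
  <⇒≤ x<y y<x = <-irrefl refl (<-trans x<y y<x)

  ≤-trans : ∀ {x y z} → x ≤ y → y ≤ z → x ≤ z
  ≤-trans {y = y} x≤y y≤z z<x = [ y≤z , x≤y ]′ (<-cotrans z<x y)

  ≤-<-trans : ∀ {x y z} → x ≤ y → y < z → x < z
  ≤-<-trans {x} x≤y y<z = [ (λ y<x → contradiction y<x x≤y) , (λ x<z → x<z) ]′ (<-cotrans y<z x)

  ≤-antisym : ∀ {x y} → x ≤ y → y ≤ x → x ≈ y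
  ≤-antisym x≤y y≤x = proj₁ (tight _ _) λ x#y → [ y≤x , x≤y ]′ (#⇒<⊎> x#y)

  ≤-resp : ∀ {x x′ y y′} → x ≈ x′ → y ≈ y′ → x ≤ y → x′ ≤ y′
  ≤-resp x≈x′ y≈y′ x≤y = ≤-trans (≤-reflexive (sym x≈x′)) (≤-trans x≤y (≤-reflexive y≈y′))

  +-cancelʳ-< : ∀ z {x y} → x + z < y + z → x < y
  +-cancelʳ-< z {x} {y} x+z<y+z =
    <-respˡ-≈ (cancel x z) (<-respʳ-≈ (cancel y z) (+-monoˡ-< (- z) x+z<y+z))
    where
    cancel : ∀ x z → x + z + - z ≈ x
    cancel = solve 2 (λ x z → x :+ z :+ :- z := x) refl

  +-monoˡ-≤ : ∀ z {x y} → x ≤ y → x + z ≤ y + z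
  +-monoˡ-≤ z x≤y y+z<x+z = x≤y (+-cancelʳ-< z y+z<x+z)

  +-mono-≤ : ∀ {x y u v} → x ≤ y → u ≤ v → x + u ≤ y + v
  +-mono-≤ {x} {y} {u} {v} x≤y u≤v =
    ≤-trans (+-monoˡ-≤ u x≤y) (≤-resp (+-comm u y) (+-comm v y) (+-monoˡ-≤ y u≤v))

  x≤y⇒0≤y-x : ∀ {x y} → x ≤ y → 0# ≤ y - x
  x≤y⇒0≤y-x {x} x≤y = ≤-resp (-‿inverseʳ x) refl (+-monoˡ-≤ (- x) x≤y)

  0≤y-x⇒x≤y : ∀ {x y} → 0# ≤ y - x → x ≤ y
  0≤y-x⇒x≤y {x} {y} 0≤y-x = ≤-resp (+-identityˡ x) (restore x y) (+-monoˡ-≤ x 0≤y-x)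
    where
    restore : ∀ x y → (y - x) + x ≈ y
    restore = solve 2 (λ x y → (y :- x) :+ x := y) refl

  +-nonNegative : ∀ {x y} → 0# ≤ x → 0# ≤ y → 0# ≤ x + y
  +-nonNegative 0≤x 0≤y = ≤-resp (+-identityˡ 0#) refl (+-mono-≤ 0≤x 0≤y)

  -- The goal is a negation, so x y < 0 may be assumed. It forces both factors to be apart from 0,
  -- hence positive.
  *-nonNegative : ∀ {x y} → 0# ≤ x → 0# ≤ y → 0# ≤ x * y
  *-nonNegative {x} {y} 0≤x 0≤y xy<0 =
    <-irrefl refl (<-trans (*-positive (positive 0≤x x#0) (positive 0≤y y#0)) xy<0)
    where
    positive : ∀ {z} → 0# ≤ z → z # 0# → 0# < z
    positive 0≤z z#0 = [ (λ z<0 → contradiction z<0 0≤z) , (λ 0<z → 0<z) ]′ (#⇒<⊎> z#0)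

    x#0 : x # 0#
    x#0 = *#0⇒#0ˡ (<⇒# xy<0)

    y#0 : y # 0#
    y#0 = *#0⇒#0ˡ (#-congʳ (*-comm x y) (<⇒# xy<0))

  *-monoʳ-≤ : ∀ {x y z} → 0# ≤ z → x ≤ y → z * x ≤ z * y
  *-monoʳ-≤ {x} {y} {z} 0≤z x≤y =
    0≤y-x⇒x≤y (≤-resp refl (distrib- x y z) (*-nonNegative 0≤z (x≤y⇒0≤y-x x≤y)))
    where
    distrib- : ∀ x y z → z * (y - x) ≈ z * y - z * x
    distrib- = solve 3 (λ x y z → z :* (y :- x) := z :* y :- z :* x) refl

  *-monoʳ-< : ∀ {x y z} → 0# < z → x < y → z * x < z * y
  *-monoʳ-< {x} {y} {z} 0<z x<y = <-respˡ-≈ (left x z) (<-respʳ-≈ (right x y z)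
    (+-monoˡ-< (z * x) (*-positive 0<z (<-respˡ-≈ (-‿inverseʳ x) (+-monoˡ-< (- x) x<y)))))
    where
    left : ∀ x z → 0# + z * x ≈ z * x
    left x z = +-identityˡ _

    right : ∀ x y z → z * (y - x) + z * x ≈ z * y
    right = solve 3 (λ x y z → z :* (y :- x) :+ z :* x := z :* y) refl

  half-nonNegative : ∀ {x} → 0# ≤ x + x → 0# ≤ x
  half-nonNegative {x} 0≤2x x<0 =
    0≤2x (<-trans (<-respʳ-≈ (+-identityˡ x) (+-monoˡ-< x x<0)) x<0)

  0≤1 : 0# ≤ 1#
  0≤1 = <⇒≤ 0<1

  inverse-nonNegative : ∀ {x y} → 0# ≤ x → y * x ≈ 1# → 0# ≤ y
  inverse-nonNegative {x} {y} 0≤x yx≈1 y<0 =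
    *-nonNegative (<⇒≤ (0<-x y<0)) 0≤x (<-respˡ-≈ (sym -yx≈-1) -1<0)
    where
    open Algebra.Properties.Ring (CommutativeRing.ring commutativeRing) using (-‿distribˡ-*)

    -yx≈-1 : - y * x ≈ - 1#
    -yx≈-1 = trans (sym (-‿distribˡ-* y x)) (-‿cong yx≈1)

    -1<0 : - 1# < 0#
    -1<0 = <-respˡ-≈ (+-identityˡ _) (<-respʳ-≈ (-‿inverseʳ 1#) (+-monoˡ-< (- 1#) 0<1))

  inverse-positive : ∀ {x y} → 0# ≤ x → y * x ≈ 1# → 0# < y
  inverse-positive {x} {y} 0≤x yx≈1 =
    [ (λ y<0 → contradiction y<0 (inverse-nonNegative 0≤x yx≈1)) , (λ 0<y → 0<y) ]′
      (#⇒<⊎> (invertible⇒#0 x (trans (*-comm x y) yx≈1)))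

  ·1-mono-< : ∀ {j k} → j ℕ.< k → j · 1# < k · 1#
  ·1-mono-< {zero}  {suc k} _ = 0<suc k
  ·1-mono-< {suc j} {suc k} (ℕ.s≤s j<k) =
    <-respˡ-≈ (+-comm (j · 1#) 1#) (<-respʳ-≈ (+-comm (k · 1#) 1#) (+-monoˡ-< 1# (·1-mono-< j<k)))

  ·1-nonNegative : ∀ k → 0# ≤ k · 1#
  ·1-nonNegative zero    = ≤-refl
  ·1-nonNegative (suc k) = <⇒≤ (0<suc k)

  ·1-mono-≤ : ∀ {j k} → j ℕ.≤ k → j · 1# ≤ k · 1#
  ·1-mono-≤ {k = k} ℕ.z≤n = ·1-nonNegative k
  ·1-mono-≤ (ℕ.s≤s j≤k) = +-mono-≤ ≤-refl (·1-mono-≤ j≤k)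

  ^-nonNegative : ∀ {x} → 0# ≤ x → ∀ k → 0# ≤ x ^ k
  ^-nonNegative 0≤x zero    = 0≤1
  ^-nonNegative 0≤x (suc k) = *-nonNegative 0≤x (^-nonNegative 0≤x k)

  ·1-homo-^ : ∀ m k → (m ℕ.^ k) · 1# ≈ (m · 1#) ^ k
  ·1-homo-^ m zero    = +-identityʳ 1#
  ·1-homo-^ m (suc k) = trans (×1-homo-* m (m ℕ.^ k)) (*-congˡ (·1-homo-^ m k))

  ½ : Carrier
  ½ = proj₁ (recip 2)

  ½*2≈1 : ½ * (1# + 1#) ≈ 1#
  ½*2≈1 = trans (*-congˡ (+-congˡ (sym (+-identityʳ 1#)))) (proj₂ (recip 2))

  ½+½≈1 : ½ + ½ ≈ 1#
  ½+½≈1 = trans (double ½) ½*2≈1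
    where
    double : ∀ x → x + x ≈ x * (1# + 1#)
    double = solve 1 (λ x → x :+ x := x :* (con (1 , 0) :+ con (1 , 0))) refl

  0≤½ : 0# ≤ ½
  0≤½ = half-nonNegative (≤-resp refl (sym ½+½≈1) 0≤1)

  ½≤1 : ½ ≤ 1#
  ½≤1 = 0≤y-x⇒x≤y (≤-resp refl (trans (sym (cancel ½)) (+-congʳ ½+½≈1)) 0≤½)
    where
    cancel : ∀ x → (x + x) - x ≈ x
    cancel = solve 1 (λ x → (x :+ x) :- x := x) refl

  0≤½^ : ∀ p → 0# ≤ ½ ^ p
  0≤½^ = ^-nonNegative 0≤½

  ½^≤1 : ∀ p → ½ ^ p ≤ 1#
  ½^≤1 zero    = ≤-refl
  ½^≤1 (suc p) = ≤-trans (≤-resp refl (*-identityʳ ½) (*-monoʳ-≤ 0≤½ (½^≤1 p))) ½≤1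

  -- The one growth estimate of the development: it shows that powers of ½ become arbitrarily small,
  -- absorbs constant factors, and bounds k 4⁻ᵏ.
  k·½^k≤1 : ∀ k → k · 1# * ½ ^ k ≤ 1#
  k·½^k≤1 zero    = ≤-resp (sym (zeroˡ 1#)) refl 0≤1
  k·½^k≤1 (suc k) = ≤-resp (sym (expand ½ (k · 1#) (½ ^ k))) ½*2≈1
    (*-monoʳ-≤ 0≤½ (+-mono-≤ (½^≤1 k) (k·½^k≤1 k)))
    where
    expand : ∀ h k x → (1# + k) * (h * x) ≈ h * (x + k * x)
    expand = solve 3 (λ h k x → (con (1 , 0) :+ k) :* (h :* x) := h :* (x :+ k :* x)) refl

  ½^suc : ∀ p → ½ ^ suc p + ½ ^ suc p ≈ ½ ^ p
  ½^suc p = trans (sym (distribʳ (½ ^ p) ½ ½)) (trans (*-congʳ ½+½≈1) (*-identityˡ _))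

  0<½^ : ∀ p → 0# < ½ ^ p
  0<½^ p = [ (λ p<0 → contradiction p<0 (0≤½^ p)) , (λ 0<p → 0<p) ]′
    (#⇒<⊎> (invertible⇒#0 ((1# + 1#) ^ p) (^-inverse (trans (*-comm _ ½) ½*2≈1) p)))
    where open RangeSums commutativeRing using (^-inverse)

  -- With k > ε⁻¹ one has ½ᵏ < ½ᵏ ε k, and this is at most ε because k ½ᵏ ≤ 1.
  ½^-archimedean : ∀ {ε} → 0# < ε → ∃[ p ] ½ ^ p < ε
  ½^-archimedean {ε} 0<ε with #0⇒invertible (#-sym (<⇒# 0<ε))
  ... | ε⁻¹ , ε⁻¹ε≈1 with archimedean ε⁻¹
  ...   | k , ε⁻¹<k = k ,
    <-respˡ-≈ (trans (*-congˡ (trans (*-comm ε ε⁻¹) ε⁻¹ε≈1)) (*-identityʳ _))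
      (≤-resp-< (*-monoʳ-< (0<½^ k) (*-monoʳ-< 0<ε ε⁻¹<k)))
    where
    ≤-resp-< : ∀ {x} → x < ½ ^ k * (ε * k · 1#) → x < ε
    ≤-resp-< x<y = [ (λ x<ε → x<ε) , (λ ε<y → contradiction ε<y bound) ]′ (<-cotrans x<y ε)
      where
      rearrange : ∀ h e k → e * (k * h) ≈ h * (e * k)
      rearrange = solve 3 (λ h e k → e :* (k :* h) := h :* (e :* k)) refl

      bound : ½ ^ k * (ε * k · 1#) ≤ ε
      bound = ≤-resp (rearrange (½ ^ k) ε (k · 1#)) (*-identityʳ ε) (*-monoʳ-≤ (<⇒≤ 0<ε) (k·½^k≤1 k))

module RealAlgebra (ℛ : RealNumbers) where

  open RealNumbers ℛ public hiding (zero)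
  open CommutativeRing commutativeRing public using (commutativeSemiring; semiring; +-monoid; ring)
  open Algebra.Properties.CommutativeSemiring.Exp commutativeSemiring public
  open Algebra.Properties.Semiring.Mult semiring public using (×1-homo-*)
  open Algebra.Properties.Ring ring public using (-0#≈0#; -‿involutive; -‿distribˡ-*; -‿+-comm)
  open DifferenceSolver commutativeRing public using (solve; con; _:+_; _:*_; _:-_; :-_; _:=_)

module ComplexAlgebra (ℛ : RealNumbers) where

  open ComplexNumbers ℛ using (ℂ-commutativeRing)
  open CommutativeRing ℂ-commutativeRing public
  open Algebra.Properties.Monoid.Mult +-monoid public using () renaming (_×_ to _·_)
  open Algebra.Properties.CommutativeSemiring.Exp commutativeSemiring public
  open Algebra.Properties.Ring ring public using (-1*x≈-x; -‿distribʳ-*; -‿involutive)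
  open DifferenceSolver ℂ-commutativeRing public using (solve; con; _:+_; _:*_; _:-_; :-_; _:=_)

-- Norm bounds and limits of complex sequences.

module ComplexBounds (ℛ : RealNumbers) where

  open ComplexNumbers ℛ
  open OrderProperties ℛ
  private
    module ℝ = RealAlgebra ℛ
    module ℂᴿ = ComplexAlgebra ℛ
  open ℝ using (_⟶_; _·_) renaming (Carrier to ℝ)
  open ℂᴿ using (_-_)

  -- Bounds are relations, which spares the construction of an absolute value as a real number.
  ∣_∣≤_ : ℝ → ℝ → Set
  ∣ x ∣≤ a = x ≤ a × ℝ.- x ≤ a

  ∣∣≤-resp : ∀ {x y a b} → x ℝ.≈ y → a ℝ.≈ b → ∣ x ∣≤ a → ∣ y ∣≤ b
  ∣∣≤-resp x≈y a≈b (p , q) = ≤-resp x≈y a≈b p , ≤-resp (ℝ.-‿cong x≈y) a≈b q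

  ∣∣≤-weaken : ∀ {x a b} → a ≤ b → ∣ x ∣≤ a → ∣ x ∣≤ b
  ∣∣≤-weaken a≤b (p , q) = ≤-trans p a≤b , ≤-trans q a≤b

  ∣∣≤-nonNegative : ∀ {x a} → ∣ x ∣≤ a → ℝ.0# ≤ a
  ∣∣≤-nonNegative {x} (p , q) = half-nonNegative (≤-resp (ℝ.-‿inverseʳ x) ℝ.refl (+-mono-≤ p q))

  ∣∣≤-0 : ∀ {a} → ℝ.0# ≤ a → ∣ ℝ.0# ∣≤ a
  ∣∣≤-0 0≤a = 0≤a , ≤-resp (ℝ.sym ℝ.-0#≈0#) ℝ.refl 0≤a

  ∣∣≤-self : ∀ {x} → ℝ.0# ≤ x → ∣ x ∣≤ x
  ∣∣≤-self {x} 0≤x = ≤-refl , ≤-trans (≤-resp (ℝ.+-identityˡ (ℝ.- x)) (ℝ.-‿inverseʳ x) (+-monoˡ-≤ (ℝ.- x) 0≤x)) 0≤x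

  ∣∣≤-neg : ∀ {x a} → ∣ x ∣≤ a → ∣ ℝ.- x ∣≤ a
  ∣∣≤-neg {x} (p , q) = q , ≤-resp (ℝ.sym (ℝ.-‿involutive x)) ℝ.refl p

  ∣∣≤-+ : ∀ {x y a b} → ∣ x ∣≤ a → ∣ y ∣≤ b → ∣ x ℝ.+ y ∣≤ (a ℝ.+ b)
  ∣∣≤-+ {x} {y} (p , q) (r , s) = +-mono-≤ p r , ≤-resp (ℝ.-‿+-comm x y) ℝ.refl (+-mono-≤ q s)

  private
    -- 2 (a b - x y) is a sum of products of nonnegative numbers.
    *-upper : ∀ {x y a b} → ∣ x ∣≤ a → ∣ y ∣≤ b → x ℝ.* y ≤ a ℝ.* b
    *-upper {x} {y} {a} {b} (p , q) (r , s) = 0≤y-x⇒x≤y (half-nonNegative (≤-resp ℝ.refl (ℝ.sym (identity x y a b))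
      (+-nonNegative (*-nonNegative (x≤y⇒0≤y-x p) (x≤y⇒0≤y-x s)) (*-nonNegative (x≤y⇒0≤y-x q) (x≤y⇒0≤y-x r)))))
      where
      identity : ∀ x y a b → (a ℝ.* b ℝ.- x ℝ.* y) ℝ.+ (a ℝ.* b ℝ.- x ℝ.* y)
               ℝ.≈ (a ℝ.- x) ℝ.* (b ℝ.- ℝ.- y) ℝ.+ (a ℝ.- ℝ.- x) ℝ.* (b ℝ.- y)
      identity = ℝ.solve 4 (λ x y a b →
        (a ℝ.:* b ℝ.:- x ℝ.:* y) ℝ.:+ (a ℝ.:* b ℝ.:- x ℝ.:* y) ℝ.:=
        (a ℝ.:- x) ℝ.:* (b ℝ.:- (ℝ.:- y)) ℝ.:+ (a ℝ.:- (ℝ.:- x)) ℝ.:* (b ℝ.:- y)) ℝ.refl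

  ∣∣≤-* : ∀ {x y a b} → ∣ x ∣≤ a → ∣ y ∣≤ b → ∣ x ℝ.* y ∣≤ (a ℝ.* b)
  ∣∣≤-* {x} {y} p q = *-upper p q , ≤-resp (ℝ.sym (ℝ.-‿distribˡ-* x y)) ℝ.refl (*-upper (∣∣≤-neg p) q)

  -- The norm |re z| + |im z|, which is submultiplicative.
  record ∥_∥≤_ (z : ℂ) (r : ℝ) : Set where
    constructor bounded
    field
      {α β} : ℝ
      ∣re∣≤ : ∣ re z ∣≤ α
      ∣im∣≤ : ∣ im z ∣≤ β
      α+β≈r : α ℝ.+ β ℝ.≈ r

  ∥∥≤-resp : ∀ {z w r s} → z ≈ w → r ℝ.≈ s → ∥ z ∥≤ r → ∥ w ∥≤ s
  ∥∥≤-resp (p , q) r≈s (bounded x y e) =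
    bounded (∣∣≤-resp p ℝ.refl x) (∣∣≤-resp q ℝ.refl y) (ℝ.trans e r≈s)

  ∥∥≤-weaken : ∀ {z r s} → r ≤ s → ∥ z ∥≤ r → ∥ z ∥≤ s
  -- The parts must add up to the bound exactly, so all the slack goes to the real part: α ≤ s - β.
  ∥∥≤-weaken {r = r} {s} r≤s (bounded {α} {β} x y e) = bounded
    (∣∣≤-weaken (≤-resp (ℝ.trans (ℝ.+-congʳ (ℝ.sym e)) (cancel α β)) ℝ.refl (+-monoˡ-≤ (ℝ.- β) r≤s)) x) y (restore s β)
    where
    cancel : ∀ α β → (α ℝ.+ β) ℝ.+ ℝ.- β ℝ.≈ α
    cancel = ℝ.solve 2 (λ α β → (α ℝ.:+ β) ℝ.:+ ℝ.:- β ℝ.:= α) ℝ.refl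

    restore : ∀ s β → (s ℝ.+ ℝ.- β) ℝ.+ β ℝ.≈ s
    restore = ℝ.solve 2 (λ s β → (s ℝ.:+ ℝ.:- β) ℝ.:+ β ℝ.:= s) ℝ.refl

  ∣re∣≤r : ∀ {z r} → ∥ z ∥≤ r → ∣ re z ∣≤ r
  ∣re∣≤r (bounded {α} {β} x y e) =
    ∣∣≤-weaken (≤-resp (ℝ.+-identityʳ α) e (+-mono-≤ ≤-refl (∣∣≤-nonNegative y))) x

  ∣im∣≤r : ∀ {z r} → ∥ z ∥≤ r → ∣ im z ∣≤ r
  ∣im∣≤r (bounded {α} {β} x y e) =
    ∣∣≤-weaken (≤-resp (ℝ.+-identityˡ β) e (+-mono-≤ (∣∣≤-nonNegative x) ≤-refl)) y

  ∥∥≤-nonNegative : ∀ {z r} → ∥ z ∥≤ r → ℝ.0# ≤ r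
  ∥∥≤-nonNegative p = ∣∣≤-nonNegative (∣re∣≤r p)

  ∥∥≤-+ : ∀ {z w r s} → ∥ z ∥≤ r → ∥ w ∥≤ s → ∥ z + w ∥≤ (r ℝ.+ s)
  ∥∥≤-+ (bounded {α} {β} x y e) (bounded {γ} {δ} x′ y′ e′) =
    bounded (∣∣≤-+ x x′) (∣∣≤-+ y y′) (ℝ.trans (regroup α β γ δ) (ℝ.+-cong e e′))
    where
    regroup : ∀ α β γ δ → (α ℝ.+ γ) ℝ.+ (β ℝ.+ δ) ℝ.≈ (α ℝ.+ β) ℝ.+ (γ ℝ.+ δ)
    regroup = ℝ.solve 4 (λ α β γ δ → (α ℝ.:+ γ) ℝ.:+ (β ℝ.:+ δ) ℝ.:= (α ℝ.:+ β) ℝ.:+ (γ ℝ.:+ δ)) ℝ.refl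

  ∥∥≤-neg : ∀ {z r} → ∥ z ∥≤ r → ∥ - z ∥≤ r
  ∥∥≤-neg (bounded x y e) = bounded (∣∣≤-neg x) (∣∣≤-neg y) e

  ∥∥≤-* : ∀ {z w r s} → ∥ z ∥≤ r → ∥ w ∥≤ s → ∥ z * w ∥≤ (r ℝ.* s)
  ∥∥≤-* (bounded {α} {β} x y e) (bounded {γ} {δ} x′ y′ e′) = bounded
    (∣∣≤-+ (∣∣≤-* x x′) (∣∣≤-neg (∣∣≤-* y y′))) (∣∣≤-+ (∣∣≤-* x y′) (∣∣≤-* y x′))
    (ℝ.trans (expand α β γ δ) (ℝ.*-cong e e′))
    where
    expand : ∀ α β γ δ → (α ℝ.* γ ℝ.+ β ℝ.* δ) ℝ.+ (α ℝ.* δ ℝ.+ β ℝ.* γ) ℝ.≈ (α ℝ.+ β) ℝ.* (γ ℝ.+ δ)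
    expand = ℝ.solve 4 (λ α β γ δ →
      (α ℝ.:* γ ℝ.:+ β ℝ.:* δ) ℝ.:+ (α ℝ.:* δ ℝ.:+ β ℝ.:* γ) ℝ.:= (α ℝ.:+ β) ℝ.:* (γ ℝ.:+ δ)) ℝ.refl

  ∥∥≤-0 : ∀ {r} → ℝ.0# ≤ r → ∥ 0# ∥≤ r
  ∥∥≤-0 {r} 0≤r = bounded (∣∣≤-0 0≤r) (∣∣≤-0 ≤-refl) (ℝ.+-identityʳ r)

  ∥∥≤-real : ∀ {x} → ℝ.0# ≤ x → ∥ x +i ℝ.0# ∥≤ x
  ∥∥≤-real {x} 0≤x = bounded (∣∣≤-self 0≤x) (∣∣≤-0 ≤-refl) (ℝ.+-identityʳ x)

  ∥∥≤-^ : ∀ {z r} → ∥ z ∥≤ r → ∀ k → ∥ z ^ k ∥≤ (r ℝ.^ k)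
  ∥∥≤-^ p zero    = ∥∥≤-real 0≤1
  ∥∥≤-^ p (suc k) = ∥∥≤-* p (∥∥≤-^ p k)

  ∣∣≤-archimedean : ∀ x → ∃[ k ] ∣ x ∣≤ (k · ℝ.1#)
  ∣∣≤-archimedean x =
    let j , x<j  = ℝ.archimedean x
        k , -x<k = ℝ.archimedean (ℝ.- x) in
    j ℕ.+ k ,
    ≤-trans (<⇒≤ x<j) (·1-mono-≤ (ℕ.m≤m+n j k)) , ≤-trans (<⇒≤ -x<k) (·1-mono-≤ (ℕ.m≤n+m k j))

  ∥∥≤-archimedean : ∀ z → ∃[ k ] ∥ z ∥≤ (k · ℝ.1#)
  ∥∥≤-archimedean z =
    let j , p = ∣∣≤-archimedean (re z)
        k , q = ∣∣≤-archimedean (im z) in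
    j ℕ.+ k , bounded p q (ℝ.sym (·-homo-+ ℝ.1# j k))
    where open Algebra.Properties.Monoid.Mult ℝ.+-monoid using () renaming (×-homo-+ to ·-homo-+)

  -- Testing against powers of ½ alone turns the halving of an ε into the successor of an exponent.
  Null : (ℕ → ℂ) → Set
  Null x = ∀ p → ∃[ N ] ∀ k → N ℕ.≤ k → ∥ x k ∥≤ (½ ℝ.^ p)

  Null-resp : ∀ {x y} → (∀ k → x k ≈ y k) → Null x → Null y
  Null-resp x≈y null p = let N , bound = null p in N , λ k N≤k → ∥∥≤-resp (x≈y k) ℝ.refl (bound k N≤k)

  Null-+ : ∀ {x y} → Null x → Null y → Null (λ k → x k + y k)
  Null-+ x-null y-null p =
    let M , x-bound = x-null (suc p)
        N , y-bound = y-null (suc p) in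
    M ℕ.+ N , λ k M+N≤k → ∥∥≤-resp ℂᴿ.refl (½^suc p)
    (∥∥≤-+ (x-bound k (ℕ.≤-trans (ℕ.m≤m+n M N) M+N≤k)) (y-bound k (ℕ.≤-trans (ℕ.m≤n+m N M) M+N≤k)))

  Null-neg : ∀ {x} → Null x → Null (λ k → - x k)
  Null-neg null p = let N , bound = null p in N , λ k N≤k → ∥∥≤-neg (bound k N≤k)

  Null-* : ∀ {x y} → Null x → Null y → Null (λ k → x k * y k)
  Null-* x-null y-null p =
    let M , x-bound = x-null p
        -- The exponent 0 gives the bound 1, so the product inherits the bound of the first factor.
        N , y-bound = y-null 0 in
    M ℕ.+ N , λ k M+N≤k → ∥∥≤-resp ℂᴿ.refl (ℝ.*-identityʳ _)
    (∥∥≤-* (x-bound k (ℕ.≤-trans (ℕ.m≤m+n M N) M+N≤k)) (y-bound k (ℕ.≤-trans (ℕ.m≤n+m N M) M+N≤k)))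

  k≤2^k : ∀ k → k ℕ.≤ 2 ℕ.^ k
  k≤2^k zero    = ℕ.z≤n
  k≤2^k (suc k) = ≡.subst (suc k ℕ.≤_) (≡.cong (2 ℕ.^ k ℕ.+_) (≡.sym (ℕ.+-identityʳ (2 ℕ.^ k))))
    (ℕ.+-mono-≤ {1} (ℕ.m^n>0 2 k) (k≤2^k k))

  -- A constant factor k is paid for by k further halvings.
  ½^-absorbs : ∀ k p → k · ℝ.1# ℝ.* ½ ℝ.^ (k ℕ.+ p) ≤ ½ ℝ.^ p
  ½^-absorbs k p = ≤-resp (reorder (½ ℝ.^ p) (½ ℝ.^ k) (k · ℝ.1#) (ℝ.^-homo-* ½ k p)) (ℝ.*-identityʳ _)
    (*-monoʳ-≤ (0≤½^ p) (k·½^k≤1 k))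
    where
    reorder : ∀ x y z {w} → w ℝ.≈ y ℝ.* x → x ℝ.* (z ℝ.* y) ℝ.≈ z ℝ.* w
    reorder x y z w≈ = ℝ.trans (identity x y z) (ℝ.*-congˡ (ℝ.sym w≈))
      where
      identity : ∀ x y z → x ℝ.* (z ℝ.* y) ℝ.≈ z ℝ.* (y ℝ.* x)
      identity = ℝ.solve 3 (λ x y z → x ℝ.:* (z ℝ.:* y) ℝ.:= z ℝ.:* (y ℝ.:* x)) ℝ.refl

  Null-constˡ : ∀ w {x} → Null x → Null (λ k → w * x k)
  Null-constˡ w null p =
    let R , w-bound = ∥∥≤-archimedean w
        N , x-bound = null (R ℕ.+ p) in
    N , λ k N≤k → ∥∥≤-weaken (½^-absorbs R p) (∥∥≤-* w-bound (x-bound k N≤k))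

  Null-const⇒≈0 : ∀ {z} → Null (const z) → z ≈ 0#
  Null-const⇒≈0 {z} null = vanishes (λ p → ∣re∣≤r (proj₂ (null p) _ ℕ.≤-refl))
                         , vanishes (λ p → ∣im∣≤r (proj₂ (null p) _ ℕ.≤-refl))
    where
    vanishes : ∀ {x} → (∀ p → ∣ x ∣≤ (½ ℝ.^ p)) → x ℝ.≈ ℝ.0#
    vanishes {x} small = ≤-antisym (nonPositive (proj₁ ∘ small))
      (≤-resp ℝ.refl (ℝ.-‿involutive x)
        (≤-resp ℝ.-0#≈0# ℝ.refl (-‿mono (nonPositive (proj₂ ∘ small)))))
      where
      nonPositive : ∀ {y} → (∀ p → y ≤ ½ ℝ.^ p) → y ≤ ℝ.0#
      nonPositive y≤ 0<y = let p , ½^p<y = ½^-archimedean 0<y in y≤ p ½^p<y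

      -‿mono : ∀ {x y} → x ≤ y → ℝ.- y ≤ ℝ.- x
      -‿mono {x} {y} x≤y = ≤-resp (left x y) (right x y) (+-monoˡ-≤ (ℝ.- x ℝ.+ ℝ.- y) x≤y)
        where
        left : ∀ x y → x ℝ.+ (ℝ.- x ℝ.+ ℝ.- y) ℝ.≈ ℝ.- y
        left = ℝ.solve 2 (λ x y → x ℝ.:+ (ℝ.:- x ℝ.:+ ℝ.:- y) ℝ.:= ℝ.:- y) ℝ.refl

        right : ∀ x y → y ℝ.+ (ℝ.- x ℝ.+ ℝ.- y) ℝ.≈ ℝ.- x
        right = ℝ.solve 2 (λ x y → y ℝ.:+ (ℝ.:- x ℝ.:+ ℝ.:- y) ℝ.:= ℝ.:- x) ℝ.refl

  ⟶ℂ⇒Null : ∀ {s l} → s ⟶ℂ l → Null (λ k → s k - l)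
  ⟶ℂ⇒Null {s} {l} (re-limit , im-limit) p =
    let M , re-close = re-limit (½ ℝ.^ suc p) (0<½^ (suc p))
        N , im-close = im-limit (½ ℝ.^ suc p) (0<½^ (suc p)) in
    M ℕ.+ N , λ k M+N≤k → bounded
      (close (re-close k (ℕ.≤-trans (ℕ.m≤m+n M N) M+N≤k)))
      (close (im-close k (ℕ.≤-trans (ℕ.m≤n+m N M) M+N≤k))) (½^suc p)
    where
    close : ∀ {x y ε} → (x ℝ.- y ℝ.< ε) × (y ℝ.- x ℝ.< ε) → ∣ x ℝ.- y ∣≤ ε
    close {x} {y} (p , q) = <⇒≤ p , ≤-resp (flip x y) ℝ.refl (<⇒≤ q)
      where
      flip : ∀ x y → y ℝ.- x ℝ.≈ ℝ.- (x ℝ.- y)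
      flip = ℝ.solve 2 (λ x y → y ℝ.:- x ℝ.:= ℝ.:- (x ℝ.:- y)) ℝ.refl

  Null⇒⟶ℂ : ∀ {s l} → Null (λ k → s k - l) → s ⟶ℂ l
  Null⇒⟶ℂ {s} {l} null = limit re (λ _ _ → ℝ.refl) ∣re∣≤r , limit im (λ _ _ → ℝ.refl) ∣im∣≤r
    where
    limit : (f : ℂ → ℝ) → (∀ z w → f (z - w) ℝ.≈ f z ℝ.- f w) → (∀ {z r} → ∥ z ∥≤ r → ∣ f z ∣≤ r) →
            (f ∘ s) ⟶ f l
    limit f homo bound ε 0<ε =
      let p , ½^p<ε = ½^-archimedean 0<ε
          N , small = null p in
      N , λ k N≤k → let u , v = ∣∣≤-resp (homo (s k) l) ℝ.refl (bound (small k N≤k)) in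
      ≤-<-trans u ½^p<ε , ≤-<-trans (≤-resp (flip (f (s k)) (f l)) ℝ.refl v) ½^p<ε
      where
      flip : ∀ x y → ℝ.- (x ℝ.- y) ℝ.≈ y ℝ.- x
      flip = ℝ.solve 2 (λ x y → ℝ.:- (x ℝ.:- y) ℝ.:= y ℝ.:- x) ℝ.refl

  ⟶ℂ-unique : ∀ {s l m} → s ⟶ℂ l → s ⟶ℂ m → l ≈ m
  ⟶ℂ-unique {s} {l} {m} p q = ℂᴿ.trans (ℂᴿ.sym (ℂᴿ.+-identityʳ l)) (ℂᴿ.trans (ℂᴿ.+-congˡ (ℂᴿ.sym m-l≈0)) (cancel l m))
    where
    open DifferenceSolver ℂ-commutativeRing using (solve; _:+_; _:-_; :-_; _:=_)

    cancel : ∀ l m → l + (m - l) ≈ m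
    cancel = solve 2 (λ l m → l :+ (m :- l) := m) ℂᴿ.refl

    difference : ∀ s l m → (s - l) + - (s - m) ≈ m - l
    difference = solve 3 (λ s l m → (s :- l) :+ :- (s :- m) := m :- l) ℂᴿ.refl

    m-l≈0 : m - l ≈ 0#
    m-l≈0 = Null-const⇒≈0 (Null-resp (λ k → difference (s k) l m) (Null-+ (⟶ℂ⇒Null p) (Null-neg (⟶ℂ⇒Null q))))

  Null-product : ∀ {x y : ℕ → ℂ} {u v} → Null (λ k → x k - u) → Null (λ k → y k - v) → Null (λ k → x k * y k - u * v)
  Null-product {x} {y} {u} {v} p q = Null-resp (λ k → identity (x k) (y k) u v)
    (Null-+ (Null-* {x-u} {y-v} p q) (Null-+ (Null-constˡ v {x-u} p) (Null-constˡ u {y-v} q)))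
    where
    x-u y-v : ℕ → ℂ
    x-u k = x k - u
    y-v k = y k - v

    open DifferenceSolver ℂ-commutativeRing using (solve; _:+_; _:*_; _:-_; :-_; _:=_)

    identity : ∀ x y u v → (x - u) * (y - v) + (v * (x - u) + u * (y - v)) ≈ x * y - u * v
    identity = solve 4 (λ x y u v →
      (x :- u) :* (y :- v) :+ (v :* (x :- u) :+ u :* (y :- v)) := x :* y :- u :* v) ℂᴿ.refl

-- The functional equation of the exponential.

module ComplexExponential (ℛ : RealNumbers) where

  open ComplexNumbers ℛ
  open OrderProperties ℛ
  open OrderedFieldProperties ℛ using (recip)
  open ComplexBounds ℛ
  private
    module ℝ = RealAlgebra ℛ
    module ℂᴿ = ComplexAlgebra ℛ
  open ℝ using (_·_) renaming (Carrier to ℝ)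
  open ℂᴿ using (_-_)
  open Convolution ℂ-commutativeRing
  open RangeSums ℂ-commutativeRing using (sum-snoc)
  private module ℝ-Reasoning = Relation.Binary.Reasoning.Setoid (CommutativeRing.setoid ℝ.commutativeRing)
  private module ℂ-Reasoning = Relation.Binary.Reasoning.Setoid ℂᴿ.setoid

  real : ℝ → ℂ
  real x = x +i ℝ.0#

  real-* : ∀ x z → real x * z ≈ (re z ℝ.* x) +i (im z ℝ.* x)
  real-* x z = first x (re z) (im z) , second x (re z) (im z)
    where
    first : ∀ x a b → x ℝ.* a ℝ.- ℝ.0# ℝ.* b ℝ.≈ a ℝ.* x
    first = ℝ.solve 3 (λ x a b → x ℝ.:* a ℝ.:- ℝ.con (0 , 0) ℝ.:* b ℝ.:= a ℝ.:* x) ℝ.refl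

    second : ∀ x a b → x ℝ.* b ℝ.+ ℝ.0# ℝ.* a ℝ.≈ b ℝ.* x
    second = ℝ.solve 3 (λ x a b → x ℝ.:* b ℝ.:+ ℝ.con (0 , 0) ℝ.:* a ℝ.:= b ℝ.:* x) ℝ.refl

  real-homo-* : ∀ x y → real x * real y ≈ real (x ℝ.* y)
  real-homo-* x y = ℂᴿ.trans (real-* x (real y)) (ℝ.*-comm y x , ℝ.zeroˡ x)

  ·1≈real : ∀ k → k ℂᴿ.· 1# ≈ real (k · ℝ.1#)
  ·1≈real zero    = ℂᴿ.refl
  ·1≈real (suc k) = ℂᴿ.trans (ℂᴿ.+-congˡ (·1≈real k)) (ℝ.refl , ℝ.+-identityˡ ℝ.0#)

  ·1-cancelˡ : ∀ k {z w} → suc k ℂᴿ.· 1# * z ≈ suc k ℂᴿ.· 1# * w → z ≈ w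
  ·1-cancelˡ k {z} {w} kz≈kw = ℂᴿ.trans (ℂᴿ.sym (cancel z)) (ℂᴿ.trans (ℂᴿ.*-congˡ kz≈kw) (cancel w))
    where
    y : ℝ
    y = proj₁ (recip (suc k))

    cancel : ∀ z → real y * (suc k ℂᴿ.· 1# * z) ≈ z
    cancel z = begin
      real y * (suc k ℂᴿ.· 1# * z)          ≈⟨ ℂᴿ.*-assoc (real y) (suc k ℂᴿ.· 1#) z ⟨
      real y * suc k ℂᴿ.· 1# * z            ≈⟨ ℂᴿ.*-congʳ (ℂᴿ.*-congˡ {real y} (·1≈real (suc k))) ⟩
      real y * real (suc k · ℝ.1#) * z      ≈⟨ ℂᴿ.*-congʳ (real-homo-* y (suc k · ℝ.1#)) ⟩
      real (y ℝ.* suc k · ℝ.1#) * z         ≈⟨ ℂᴿ.*-congʳ (proj₂ (recip (suc k)) , ℝ.refl) ⟩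
      1# * z                                ≈⟨ ℂᴿ.*-identityˡ z ⟩
      z                                     ∎
      where open ℂ-Reasoning

  1/_! : ℕ → ℝ
  1/ k ! = proj₁ (recip (k !) {{k ℕ.!≢0}})

  1/!-inverse : ∀ k → 1/ k ! ℝ.* (k !) · ℝ.1# ℝ.≈ ℝ.1#
  1/!-inverse k = proj₂ (recip (k !) {{k ℕ.!≢0}})

  1/!-suc : ∀ k → suc k · ℝ.1# ℝ.* 1/ suc k ! ℝ.≈ 1/ k !
  1/!-suc k = begin
    s ℝ.* r′                           ≈⟨ ℝ.*-identityʳ _ ⟨
    s ℝ.* r′ ℝ.* ℝ.1#                  ≈⟨ ℝ.*-congˡ (1/!-inverse k) ⟨
    s ℝ.* r′ ℝ.* (r ℝ.* f)             ≈⟨ rearrange s r′ r f ⟩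
    r ℝ.* (r′ ℝ.* (s ℝ.* f))           ≈⟨ ℝ.*-congˡ (ℝ.*-congˡ (ℝ.×1-homo-* (suc k) (k !))) ⟨
    r ℝ.* (r′ ℝ.* (suc k !) · ℝ.1#)    ≈⟨ ℝ.*-congˡ (1/!-inverse (suc k)) ⟩
    r ℝ.* ℝ.1#                         ≈⟨ ℝ.*-identityʳ r ⟩
    r                                  ∎
    where
    open ℝ-Reasoning
    r r′ s f : ℝ
    r  = 1/ k !
    r′ = 1/ suc k !
    s  = suc k · ℝ.1#
    f  = (k !) · ℝ.1#

    rearrange : ∀ s r′ r f → s ℝ.* r′ ℝ.* (r ℝ.* f) ℝ.≈ r ℝ.* (r′ ℝ.* (s ℝ.* f))
    rearrange = ℝ.solve 4 (λ s r′ r f → s ℝ.:* r′ ℝ.:* (r ℝ.:* f) ℝ.:= r ℝ.:* (r′ ℝ.:* (s ℝ.:* f))) ℝ.refl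

  0≤1/! : ∀ k → ℝ.0# ≤ 1/ k !
  0≤1/! k = inverse-nonNegative (·1-nonNegative (k !)) (1/!-inverse k)

  expTerm≈ : ∀ z k → expTerm z k ≈ real (1/ k !) * z ^ k
  expTerm≈ z k = ℂᴿ.sym (real-* (1/ k !) (z ^ k))

  expTerm-cong : ∀ {z w} → z ≈ w → ∀ k → expTerm z k ≈ expTerm w k
  expTerm-cong z≈w k = ℝ.*-congʳ (proj₁ (ℂᴿ.^-congˡ k z≈w)) , ℝ.*-congʳ (proj₂ (ℂᴿ.^-congˡ k z≈w))

  expTerm-isExponential : ∀ z → IsExponential z (expTerm z)
  expTerm-isExponential z = record
    { f₀≈1 = ℂᴿ.trans (expTerm≈ z 0) (ℂᴿ.trans (ℂᴿ.*-identityʳ _)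
               (ℝ.trans (ℝ.sym (ℝ.*-identityʳ _))
                 (ℝ.trans (ℝ.*-congˡ (ℝ.sym (ℝ.+-identityʳ ℝ.1#))) (1/!-inverse 0)) , ℝ.refl))
    ; step = λ k → begin
        suc k ℂᴿ.· 1# * expTerm z (suc k)
          ≈⟨ ℂᴿ.*-cong (·1≈real (suc k)) (expTerm≈ z (suc k)) ⟩
        real (suc k · ℝ.1#) * (real (1/ suc k !) * (z * z ^ k))
          ≈⟨ rearrange (real (suc k · ℝ.1#)) (real (1/ suc k !)) z (z ^ k) ⟩
        z * (real (suc k · ℝ.1#) * real (1/ suc k !) * z ^ k)
          ≈⟨ ℂᴿ.*-congˡ (ℂᴿ.*-congʳ (real-homo-* (suc k · ℝ.1#) (1/ suc k !))) ⟩
        z * (real (suc k · ℝ.1# ℝ.* 1/ suc k !) * z ^ k)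
          ≈⟨ ℂᴿ.*-congˡ (ℂᴿ.*-congʳ (1/!-suc k , ℝ.refl)) ⟩
        z * (real (1/ k !) * z ^ k)   ≈⟨ ℂᴿ.*-congˡ (expTerm≈ z k) ⟨
        z * expTerm z k               ∎
    }
    where
    open ℂ-Reasoning

    rearrange : ∀ s r z p → s * (r * (z * p)) ≈ z * (s * r * p)
    rearrange = ℂᴿ.solve 4 (λ s r z p → s ℂᴿ.:* (r ℂᴿ.:* (z ℂᴿ.:* p)) ℂᴿ.:= z ℂᴿ.:* (s ℂᴿ.:* r ℂᴿ.:* p)) ℂᴿ.refl

  -- A ratio of ½ ½ leaves, in k ¼ᵏ, one power of ½ to compensate k and another that tends to 0.
  ¼ : ℝ
  ¼ = ½ ℝ.* ½

  0≤¼^ : ∀ k → ℝ.0# ≤ ¼ ℝ.^ k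
  0≤¼^ = ^-nonNegative (*-nonNegative 0≤½ 0≤½)

  -- The offset o allows the tail of f to be bounded with the same constant C, as the induction in
  -- `triangle-error` needs.
  GeometricallyBounded : ℝ → ℕ → Sequence → Set
  GeometricallyBounded C o f = ∀ k → ∥ f k ∥≤ (C ℝ.* ¼ ℝ.^ (o ℕ.+ k))

  -- Up to k = n the power nⁿ suffices; beyond n, each further factor n is at most the new factor of
  -- the factorial.
  n^k≤n^n*k! : ∀ n .{{_ : NonZero n}} k → n ℕ.^ k ℕ.≤ n ℕ.^ n ℕ.* k !
  n^k≤n^n*k! n zero = ≡.subst (1 ℕ.≤_) (≡.sym (ℕ.*-identityʳ (n ℕ.^ n))) (ℕ.m^n>0 n n)
  n^k≤n^n*k! n (suc k) with ℕ.≤-total (suc k) n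
  ... | inj₁ 1+k≤n = ℕ.≤-trans (ℕ.^-monoʳ-≤ n 1+k≤n) (ℕ.m≤m*n (n ℕ.^ n) (suc k !) {{suc k ℕ.!≢0}})
  ... | inj₂ n≤1+k = ≡.subst (n ℕ.^ suc k ℕ.≤_) (x∙yz≈y∙xz (suc k) (n ℕ.^ n) (k !))
    (ℕ.*-mono-≤ n≤1+k (n^k≤n^n*k! n k))
    where open import Algebra.Properties.CommutativeSemigroup ℕ.*-commutativeSemigroup using (x∙yz≈y∙xz)

  -- With M ≥ |z| and n = 4 M: |zᵏ / k!| ≤ Mᵏ / k! = 4⁻ᵏ nᵏ / k! ≤ 4⁻ᵏ nⁿ.
  expTerm-bounded : ∀ z → ∃[ C ] GeometricallyBounded C 0 (expTerm z)
  expTerm-bounded z = (n ℕ.^ n) · ℝ.1# , λ k → ∥∥≤-resp (ℂᴿ.sym (expTerm≈ z k)) ℝ.refl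
    (∥∥≤-weaken (bound k) (∥∥≤-* (∥∥≤-real (0≤1/! k)) (∥∥≤-^ ∥z∥≤M k)))
    where
    M n : ℕ
    M = suc (proj₁ (∥∥≤-archimedean z))
    n = M ℕ.* 4

    M·1 = M · ℝ.1#

    ∥z∥≤M : ∥ z ∥≤ M·1
    ∥z∥≤M = ∥∥≤-weaken (·1-mono-≤ (ℕ.n≤1+n (proj₁ (∥∥≤-archimedean z)))) (proj₂ (∥∥≤-archimedean z))

    M≈¼n : M·1 ℝ.≈ ¼ ℝ.* n · ℝ.1#
    M≈¼n = begin
      M·1                                       ≈⟨ ℝ.*-identityʳ M·1 ⟨
      M·1 ℝ.* ℝ.1#                              ≈⟨ ℝ.*-congˡ (ℝ.*-identityˡ ℝ.1#) ⟨
      M·1 ℝ.* (ℝ.1# ℝ.* ℝ.1#)                   ≈⟨ ℝ.*-congˡ (ℝ.*-cong ½*2≈1 ½*2≈1) ⟨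
      M·1 ℝ.* (½ ℝ.* (ℝ.1# ℝ.+ ℝ.1#) ℝ.* (½ ℝ.* (ℝ.1# ℝ.+ ℝ.1#)))  ≈⟨ rearrange M·1 ½ ⟩
      ¼ ℝ.* (M·1 ℝ.* 4 · ℝ.1#)                  ≈⟨ ℝ.*-congˡ (ℝ.×1-homo-* M 4) ⟨
      ¼ ℝ.* n · ℝ.1#                            ∎
      where
      open ℝ-Reasoning

      rearrange : ∀ m h → m ℝ.* (h ℝ.* (ℝ.1# ℝ.+ ℝ.1#) ℝ.* (h ℝ.* (ℝ.1# ℝ.+ ℝ.1#))) ℝ.≈
                  h ℝ.* h ℝ.* (m ℝ.* 4 · ℝ.1#)
      rearrange = ℝ.solve 2 (λ m h → let one = ℝ.con (1 , 0) in
        m ℝ.:* (h ℝ.:* (one ℝ.:+ one) ℝ.:* (h ℝ.:* (one ℝ.:+ one))) ℝ.:=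
        h ℝ.:* h ℝ.:* (m ℝ.:* (one ℝ.:+ (one ℝ.:+ (one ℝ.:+ (one ℝ.:+ ℝ.con (0 , 0))))))) ℝ.refl

    bound : ∀ k → 1/ k ! ℝ.* M·1 ℝ.^ k ≤ (n ℕ.^ n) · ℝ.1# ℝ.* ¼ ℝ.^ k
    bound k = ≤-resp left right (*-monoʳ-≤ (*-nonNegative (0≤¼^ k) (0≤1/! k)) (·1-mono-≤ (n^k≤n^n*k! n k)))
      where
      open ℝ-Reasoning
      r = 1/ k !

      left : ¼ ℝ.^ k ℝ.* r ℝ.* (n ℕ.^ k) · ℝ.1# ℝ.≈ r ℝ.* M·1 ℝ.^ k
      left = begin
        ¼ ℝ.^ k ℝ.* r ℝ.* (n ℕ.^ k) · ℝ.1#           ≈⟨ ℝ.*-congˡ (·1-homo-^ n k) ⟩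
        ¼ ℝ.^ k ℝ.* r ℝ.* (n · ℝ.1#) ℝ.^ k           ≈⟨ swap (¼ ℝ.^ k) r ((n · ℝ.1#) ℝ.^ k) ⟩
        r ℝ.* (¼ ℝ.^ k ℝ.* (n · ℝ.1#) ℝ.^ k)         ≈⟨ ℝ.*-congˡ (ℝ.^-distrib-* ¼ (n · ℝ.1#) k) ⟨
        r ℝ.* (¼ ℝ.* n · ℝ.1#) ℝ.^ k                 ≈⟨ ℝ.*-congˡ (ℝ.^-congˡ k M≈¼n) ⟨
        r ℝ.* M·1 ℝ.^ k                              ∎
        where
        swap : ∀ x y z → x ℝ.* y ℝ.* z ℝ.≈ y ℝ.* (x ℝ.* z)
        swap = ℝ.solve 3 (λ x y z → x ℝ.:* y ℝ.:* z ℝ.:= y ℝ.:* (x ℝ.:* z)) ℝ.refl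

      right : ¼ ℝ.^ k ℝ.* r ℝ.* (n ℕ.^ n ℕ.* k !) · ℝ.1# ℝ.≈ (n ℕ.^ n) · ℝ.1# ℝ.* ¼ ℝ.^ k
      right = begin
        ¼ ℝ.^ k ℝ.* r ℝ.* (n ℕ.^ n ℕ.* k !) · ℝ.1#                ≈⟨ ℝ.*-congˡ (ℝ.×1-homo-* (n ℕ.^ n) (k !)) ⟩
        ¼ ℝ.^ k ℝ.* r ℝ.* ((n ℕ.^ n) · ℝ.1# ℝ.* (k !) · ℝ.1#)     ≈⟨ swap (¼ ℝ.^ k) r ((n ℕ.^ n) · ℝ.1#) ((k !) · ℝ.1#) ⟩
        (n ℕ.^ n) · ℝ.1# ℝ.* ¼ ℝ.^ k ℝ.* (r ℝ.* (k !) · ℝ.1#)     ≈⟨ ℝ.*-congˡ (1/!-inverse k) ⟩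
        (n ℕ.^ n) · ℝ.1# ℝ.* ¼ ℝ.^ k ℝ.* ℝ.1#                     ≈⟨ ℝ.*-identityʳ _ ⟩
        (n ℕ.^ n) · ℝ.1# ℝ.* ¼ ℝ.^ k                              ∎
        where
        swap : ∀ x r y z → x ℝ.* r ℝ.* (y ℝ.* z) ℝ.≈ y ℝ.* x ℝ.* (r ℝ.* z)
        swap = ℝ.solve 4 (λ x r y z → x ℝ.:* r ℝ.:* (y ℝ.:* z) ℝ.:= y ℝ.:* x ℝ.:* (r ℝ.:* z)) ℝ.refl

  -- The constant 2 C is chosen to close the induction: 2 C 4⁻ᵐ⁻¹ + C 4⁻ᵐ = (½ + 1) C 4⁻ᵐ, which is
  -- at most 2 C 4⁻ᵐ.
  partial-sum-tail : ∀ {C g} → GeometricallyBounded C 0 g → ∀ d m →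
                     ∥ partial-sum g (m ℕ.+ d) - partial-sum g m ∥≤ ((C ℝ.+ C) ℝ.* ¼ ℝ.^ m)
  partial-sum-tail {C} {g} g-bounded zero m = ∥∥≤-resp
    (ℂᴿ.sym (ℂᴿ.trans (ℂᴿ.+-congʳ (ℂᴿ.reflexive (≡.cong (partial-sum g) (ℕ.+-identityʳ m))))
                      (ℂᴿ.-‿inverseʳ (partial-sum g m))))
    (ℝ.sym (ℝ.distribʳ (¼ ℝ.^ m) C C))
    (∥∥≤-0 (+-nonNegative (∥∥≤-nonNegative (g-bounded m)) (∥∥≤-nonNegative (g-bounded m))))
  partial-sum-tail {C} {g} g-bounded (suc d) m = ∥∥≤-resp difference ℝ.refl
    (∥∥≤-weaken absorb (∥∥≤-+ (partial-sum-tail g-bounded d (suc m)) (g-bounded m)))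
    where
    G : Sequence
    G = partial-sum g

    difference : (G (suc m ℕ.+ d) - G (suc m)) + g m ≈ G (m ℕ.+ suc d) - G m
    difference = begin
      (G (suc m ℕ.+ d) - G (suc m)) + g m      ≈⟨ ℂᴿ.+-congʳ (ℂᴿ.+-congˡ (ℂᴿ.-‿cong (sum-snoc g m))) ⟩
      (G (suc m ℕ.+ d) - (G m + g m)) + g m    ≈⟨ cancel (G (suc m ℕ.+ d)) (G m) (g m) ⟩
      G (suc m ℕ.+ d) - G m                    ≡⟨ ≡.cong (λ k → G k - G m) (ℕ.+-suc m d) ⟨
      G (m ℕ.+ suc d) - G m                    ∎
      where
      open ℂ-Reasoning

      cancel : ∀ x y z → (x - (y + z)) + z ≈ x - y
      cancel = ℂᴿ.solve 3 (λ x y z → (x ℂᴿ.:- (y ℂᴿ.:+ z)) ℂᴿ.:+ z ℂᴿ.:= x ℂᴿ.:- y) ℂᴿ.refl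

    X : ℝ
    X = C ℝ.* ¼ ℝ.^ m

    0≤X : ℝ.0# ≤ X
    0≤X = ∥∥≤-nonNegative (g-bounded m)

    absorb : (C ℝ.+ C) ℝ.* ¼ ℝ.^ suc m ℝ.+ X ≤ (C ℝ.+ C) ℝ.* ¼ ℝ.^ m
    absorb = ≤-resp left (ℝ.sym (ℝ.distribʳ (¼ ℝ.^ m) C C))
      (≤-resp ℝ.refl (ℝ.+-congʳ (ℝ.*-identityʳ X)) (+-monoˡ-≤ X (*-monoʳ-≤ 0≤X ½≤1)))
      where
      regroup : ∀ c h p → (c ℝ.* p) ℝ.* (h ℝ.* (h ℝ.+ h)) ℝ.≈ (c ℝ.+ c) ℝ.* (h ℝ.* h ℝ.* p)
      regroup = ℝ.solve 3 (λ c h p → (c ℝ.:* p) ℝ.:* (h ℝ.:* (h ℝ.:+ h)) ℝ.:= (c ℝ.:+ c) ℝ.:* (h ℝ.:* h ℝ.:* p)) ℝ.refl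

      left : X ℝ.* ½ ℝ.+ X ℝ.≈ (C ℝ.+ C) ℝ.* ¼ ℝ.^ suc m ℝ.+ X
      left = ℝ.+-congʳ (ℝ.trans (ℝ.*-congˡ (ℝ.sym (ℝ.trans (ℝ.*-congˡ ½+½≈1) (ℝ.*-identityʳ ½)))) (regroup C ½ (¼ ℝ.^ m)))

  -- Each of the N rows of the square exceeds the triangle by a term of f times a tail of g, a
  -- product bounded by C (2 D) ¼ᴺ⁺ᵒ. Removing the row of `f 0` lowers N and raises o, so N + o
  -- stays fixed; this is why the partial sum of g runs to N + o, and why all rows share one bound.
  triangle-error : ∀ {C D f g} o → GeometricallyBounded C o f → GeometricallyBounded D 0 g → ∀ N →
                   ∥ partial-sum f N * partial-sum g (N ℕ.+ o) - triangle f g N ∥≤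
                   (N · ℝ.1# ℝ.* (C ℝ.* (D ℝ.+ D) ℝ.* ¼ ℝ.^ (N ℕ.+ o)))
  triangle-error {C} {D} {f} {g} o f-bounded g-bounded zero =
    ∥∥≤-resp (ℂᴿ.sym (vanish (partial-sum g o))) (ℝ.sym (ℝ.zeroˡ _)) (∥∥≤-0 ≤-refl)
    where
    vanish : ∀ x → 0# * x - 0# ≈ 0#
    vanish = ℂᴿ.solve 1 (λ x → ℂᴿ.con (0 , 0) ℂᴿ.:* x ℂᴿ.:- ℂᴿ.con (0 , 0) ℂᴿ.:= ℂᴿ.con (0 , 0)) ℂᴿ.refl
  triangle-error {C} {D} {f} {g} o f-bounded g-bounded (suc N) = ∥∥≤-resp split bound
    (∥∥≤-+ (∥∥≤-* (f-bounded 0) (partial-sum-tail g-bounded o (suc N)))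
           (triangle-error (suc o) (λ k → ∥∥≤-resp ℂᴿ.refl (ℝ.*-congˡ (ℝ.^-congʳ ¼ (ℕ.+-suc o k))) (f-bounded (suc k)))
             g-bounded N))
    where
    F′ G T′ : Sequence
    F′ = partial-sum (f ∘ suc)
    G  = partial-sum g
    T′ = triangle (f ∘ suc) g

    split : f 0 * (G (suc N ℕ.+ o) - G (suc N)) + (F′ N * G (N ℕ.+ suc o) - T′ N)
          ≈ (f 0 + F′ N) * G (suc N ℕ.+ o) - (f 0 * G (suc N) + T′ N)
    split = begin
      f 0 * (G (suc N ℕ.+ o) - G (suc N)) + (F′ N * G (N ℕ.+ suc o) - T′ N)
        ≡⟨ ≡.cong (λ k → f 0 * (G (suc N ℕ.+ o) - G (suc N)) + (F′ N * G k - T′ N)) (ℕ.+-suc N o) ⟩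
      f 0 * (G (suc N ℕ.+ o) - G (suc N)) + (F′ N * G (suc N ℕ.+ o) - T′ N)
        ≈⟨ identity (f 0) (F′ N) (G (suc N ℕ.+ o)) (G (suc N)) (T′ N) ⟩
      (f 0 + F′ N) * G (suc N ℕ.+ o) - (f 0 * G (suc N) + T′ N)  ∎
      where
      open ℂ-Reasoning

      identity : ∀ x y u v t → x * (u - v) + (y * u - t) ≈ (x + y) * u - (x * v + t)
      identity = ℂᴿ.solve 5 (λ x y u v t →
        x ℂᴿ.:* (u ℂᴿ.:- v) ℂᴿ.:+ (y ℂᴿ.:* u ℂᴿ.:- t) ℂᴿ.:= (x ℂᴿ.:+ y) ℂᴿ.:* u ℂᴿ.:- (x ℂᴿ.:* v ℂᴿ.:+ t)) ℂᴿ.refl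

    bound : (C ℝ.* ¼ ℝ.^ (o ℕ.+ 0)) ℝ.* ((D ℝ.+ D) ℝ.* ¼ ℝ.^ suc N)
            ℝ.+ N · ℝ.1# ℝ.* (C ℝ.* (D ℝ.+ D) ℝ.* ¼ ℝ.^ (N ℕ.+ suc o))
          ℝ.≈ suc N · ℝ.1# ℝ.* (C ℝ.* (D ℝ.+ D) ℝ.* ¼ ℝ.^ (suc N ℕ.+ o))
    bound = begin
      (C ℝ.* ¼ ℝ.^ (o ℕ.+ 0)) ℝ.* ((D ℝ.+ D) ℝ.* q) ℝ.+ N · ℝ.1# ℝ.* (C ℝ.* (D ℝ.+ D) ℝ.* ¼ ℝ.^ (N ℕ.+ suc o))
        ≈⟨ ℝ.+-cong (ℝ.*-congʳ (ℝ.*-congˡ (ℝ.^-congʳ ¼ (ℕ.+-identityʳ o))))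
             (ℝ.*-congˡ (ℝ.*-congˡ (ℝ.trans (ℝ.^-congʳ ¼ (ℕ.+-suc N o)) (ℝ.^-homo-* ¼ (suc N) o)))) ⟩
      (C ℝ.* p) ℝ.* ((D ℝ.+ D) ℝ.* q) ℝ.+ N · ℝ.1# ℝ.* (C ℝ.* (D ℝ.+ D) ℝ.* (q ℝ.* p))
        ≈⟨ identity C D p q (N · ℝ.1#) ⟩
      suc N · ℝ.1# ℝ.* (C ℝ.* (D ℝ.+ D) ℝ.* (q ℝ.* p))
        ≈⟨ ℝ.*-congˡ (ℝ.*-congˡ (ℝ.^-homo-* ¼ (suc N) o)) ⟨
      suc N · ℝ.1# ℝ.* (C ℝ.* (D ℝ.+ D) ℝ.* ¼ ℝ.^ (suc N ℕ.+ o))  ∎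
      where
      open ℝ-Reasoning
      p q : ℝ
      p = ¼ ℝ.^ o
      q = ¼ ℝ.^ suc N

      identity : ∀ c d p q n → (c ℝ.* p) ℝ.* ((d ℝ.+ d) ℝ.* q) ℝ.+ n ℝ.* (c ℝ.* (d ℝ.+ d) ℝ.* (q ℝ.* p))
                 ℝ.≈ (ℝ.1# ℝ.+ n) ℝ.* (c ℝ.* (d ℝ.+ d) ℝ.* (q ℝ.* p))
      identity = ℝ.solve 5 (λ c d p q n →
        (c ℝ.:* p) ℝ.:* ((d ℝ.:+ d) ℝ.:* q) ℝ.:+ n ℝ.:* (c ℝ.:* (d ℝ.:+ d) ℝ.:* (q ℝ.:* p)) ℝ.:=
        (ℝ.con (1 , 0) ℝ.:+ n) ℝ.:* (c ℝ.:* (d ℝ.:+ d) ℝ.:* (q ℝ.:* p))) ℝ.refl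

  ½^-antitone : ∀ {j k} → j ℕ.≤ k → ½ ℝ.^ k ≤ ½ ℝ.^ j
  ½^-antitone {k = k} ℕ.z≤n = ½^≤1 k
  ½^-antitone (ℕ.s≤s j≤k)   = *-monoʳ-≤ 0≤½ (½^-antitone j≤k)

  -- Since k 2⁻ᵏ ≤ 1, k 4⁻ᵏ ≤ 2⁻ᵏ.
  k·¼^k-null : ∀ B → ℝ.0# ≤ B → ∀ p → ∃[ N ] ∀ k → N ℕ.≤ k → k · ℝ.1# ℝ.* (B ℝ.* ¼ ℝ.^ k) ≤ ½ ℝ.^ p
  k·¼^k-null B 0≤B p = R ℕ.+ p , λ k R+p≤k →
    ≤-trans (≤-resp (left k) (ℝ.*-identityʳ _) (*-monoʳ-≤ (*-nonNegative 0≤B (0≤½^ k)) (k·½^k≤1 k)))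
   (≤-trans (*-monoʳ-≤ 0≤B (½^-antitone R+p≤k))
   (≤-trans (≤-resp (ℝ.*-comm _ B) (ℝ.*-comm _ _) (*-monoʳ-≤ (0≤½^ (R ℕ.+ p)) (proj₁ (proj₂ (∣∣≤-archimedean B)))))
            (½^-absorbs R p)))
    where
    R : ℕ
    R = proj₁ (∣∣≤-archimedean B)

    left : ∀ k → (B ℝ.* ½ ℝ.^ k) ℝ.* (k · ℝ.1# ℝ.* ½ ℝ.^ k) ℝ.≈ k · ℝ.1# ℝ.* (B ℝ.* ¼ ℝ.^ k)
    left k = ℝ.trans (regroup B (½ ℝ.^ k) (k · ℝ.1#)) (ℝ.*-congˡ (ℝ.*-congˡ (ℝ.sym (ℝ.^-distrib-* ½ ½ k))))
      where
      regroup : ∀ b h k → (b ℝ.* h) ℝ.* (k ℝ.* h) ℝ.≈ k ℝ.* (b ℝ.* (h ℝ.* h))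
      regroup = ℝ.solve 3 (λ b h k → (b ℝ.:* h) ℝ.:* (k ℝ.:* h) ℝ.:= k ℝ.:* (b ℝ.:* (h ℝ.:* h))) ℝ.refl

  expSum : ℂ → Sequence
  expSum z = partial-sum (expTerm z)

  expSum-cong : ∀ {z w} → z ≈ w → ∀ N → expSum z N ≈ expSum w N
  expSum-cong z≈w N = sum-cong-≋ {n = N} (λ k → expTerm-cong z≈w (toℕ k))
    where open Algebra.Properties.Semiring.Sum ℂᴿ.semiring using (sum-cong-≋)

  IsExp-cong : ∀ {z w u v} → z ≈ w → u ≈ v → IsExp z u → IsExp w v
  IsExp-cong {z} {w} {u} {v} z≈w u≈v z-exp = Null⇒⟶ℂ (Null-resp
    (λ N → ℂᴿ.+-cong (expSum-cong z≈w N) (ℂᴿ.-‿cong u≈v)) (⟶ℂ⇒Null {expSum z} {u} z-exp))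

  expSum-product-error : ∀ z w → Null (λ N → expSum z N * expSum w N - expSum (z + w) N)
  expSum-product-error z w p =
    let C , z-bounded = expTerm-bounded z
        D , w-bounded = expTerm-bounded w
        0≤C  = ℝ-nonNegative z-bounded
        0≤D  = ℝ-nonNegative w-bounded
        N , small = k·¼^k-null (C ℝ.* (D ℝ.+ D)) (*-nonNegative 0≤C (+-nonNegative 0≤D 0≤D)) p in
    N , λ k N≤k → ∥∥≤-weaken (small k N≤k) (∥∥≤-resp (error k) (index k) (triangle-error 0 z-bounded w-bounded k))
    where
    ℝ-nonNegative : ∀ {C f} → GeometricallyBounded C 0 f → ℝ.0# ≤ C
    ℝ-nonNegative {C} f-bounded = ≤-resp ℝ.refl (ℝ.*-identityʳ C) (∥∥≤-nonNegative (f-bounded 0))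

    error : ∀ k → expSum z k * expSum w (k ℕ.+ 0) - triangle (expTerm z) (expTerm w) k
                ≈ expSum z k * expSum w k - expSum (z + w) k
    error k = ℂᴿ.+-cong
      (ℂᴿ.*-congˡ {expSum z k} (ℂᴿ.reflexive (≡.cong (expSum w) (ℕ.+-identityʳ k))))
      (ℂᴿ.-‿cong (triangle-exponential ·1-cancelˡ (expTerm-isExponential z) (expTerm-isExponential w)
        (expTerm-isExponential (z + w)) k))

    index : ∀ k {B} → k · ℝ.1# ℝ.* (B ℝ.* ¼ ℝ.^ (k ℕ.+ 0)) ℝ.≈ k · ℝ.1# ℝ.* (B ℝ.* ¼ ℝ.^ k)
    index k = ℝ.*-congˡ (ℝ.*-congˡ (ℝ.^-congʳ ¼ (ℕ.+-identityʳ k)))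

  IsExp-+ : ∀ {z w u v} → IsExp z u → IsExp w v → IsExp (z + w) (u * v)
  IsExp-+ {z} {w} {u} {v} z-exp w-exp = Null⇒⟶ℂ (Null-resp
    (λ N → identity (expSum z N * expSum w N) (u * v) (expSum (z + w) N))
    (Null-+ (Null-product {expSum z} {expSum w} {u} {v} (⟶ℂ⇒Null {expSum z} {u} z-exp) (⟶ℂ⇒Null {expSum w} {v} w-exp))
            (Null-neg (expSum-product-error z w))))
    where
    identity : ∀ x l e → (x - l) + - (x - e) ≈ e - l
    identity = ℂᴿ.solve 3 (λ x l e → (x ℂᴿ.:- l) ℂᴿ.:+ ℂᴿ.:- (x ℂᴿ.:- e) ℂᴿ.:= e ℂᴿ.:- l) ℂᴿ.refl

  IsExp-unique : ∀ {z u v} → IsExp z u → IsExp z v → u ≈ v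
  IsExp-unique {z} {u} {v} = ⟶ℂ-unique {expSum z} {u} {v}

  IsExp-0 : IsExp 0# 1#
  -- The empty partial sum is 0, so the estimate starts at index 1, from which on the partial sums
  -- equal 1.
  IsExp-0 = Null⇒⟶ℂ {expSum 0#} {1#} λ p → 1 , λ { (suc k) _ →
    ∥∥≤-resp {0#} (ℂᴿ.sym (ℂᴿ.trans (ℂᴿ.+-congʳ (expSum≈1 k)) (ℂᴿ.-‿inverseʳ 1#))) ℝ.refl (∥∥≤-0 (0≤½^ p)) }
    where
    open Algebra.Properties.Semiring.Sum ℂᴿ.semiring using (sum-cong-≋; sum-replicate-zero)

    vanish : ∀ k → expTerm 0# (suc k) ≈ 0#
    vanish k = ℂᴿ.trans (expTerm≈ 0# (suc k))
      (ℂᴿ.trans (ℂᴿ.*-congˡ {real (1/ suc k !)} (ℂᴿ.zeroˡ (0# ^ k))) (ℂᴿ.zeroʳ (real (1/ suc k !))))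

    expSum≈1 : ∀ k → expSum 0# (suc k) ≈ 1#
    expSum≈1 k = ℂᴿ.trans (ℂᴿ.+-cong (IsExponential.f₀≈1 (expTerm-isExponential 0#))
      (ℂᴿ.trans (sum-cong-≋ {n = k} (λ j → vanish (toℕ j))) (sum-replicate-zero k))) (ℂᴿ.+-identityʳ 1#)

  IsExp-· : ∀ {z u} → IsExp z u → ∀ j → IsExp (j ℂᴿ.· z) (u ^ j)
  IsExp-· z-exp zero    = IsExp-0
  IsExp-· z-exp (suc j) = IsExp-+ z-exp (IsExp-· z-exp j)

  conj : ℂ → ℂ
  conj z = re z +i (ℝ.- im z)

  conj-homo-+ : ∀ z w → conj (z + w) ≈ conj z + conj w
  conj-homo-+ z w = ℝ.refl , negate (im z) (im w)
    where
    negate : ∀ x y → ℝ.- (x ℝ.+ y) ℝ.≈ ℝ.- x ℝ.+ ℝ.- y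
    negate = ℝ.solve 2 (λ x y → ℝ.:- (x ℝ.:+ y) ℝ.:= ℝ.:- x ℝ.:+ ℝ.:- y) ℝ.refl

  conj-homo-* : ∀ z w → conj (z * w) ≈ conj z * conj w
  conj-homo-* z w = first (re z) (im z) (re w) (im w) , second (re z) (im z) (re w) (im w)
    where
    first : ∀ a b c d → a ℝ.* c ℝ.- b ℝ.* d ℝ.≈ a ℝ.* c ℝ.- (ℝ.- b) ℝ.* (ℝ.- d)
    first = ℝ.solve 4 (λ a b c d → a ℝ.:* c ℝ.:- b ℝ.:* d ℝ.:= a ℝ.:* c ℝ.:- (ℝ.:- b) ℝ.:* (ℝ.:- d)) ℝ.refl

    second : ∀ a b c d → ℝ.- (a ℝ.* d ℝ.+ b ℝ.* c) ℝ.≈ a ℝ.* (ℝ.- d) ℝ.+ (ℝ.- b) ℝ.* c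
    second = ℝ.solve 4 (λ a b c d → ℝ.:- (a ℝ.:* d ℝ.:+ b ℝ.:* c) ℝ.:= a ℝ.:* (ℝ.:- d) ℝ.:+ (ℝ.:- b) ℝ.:* c) ℝ.refl

  conj-1 : conj 1# ≈ 1#
  conj-1 = ℝ.refl , ℝ.-0#≈0#

  conj-^ : ∀ z k → conj (z ^ k) ≈ conj z ^ k
  conj-^ z zero    = conj-1
  conj-^ z (suc k) = ℂᴿ.trans (conj-homo-* z (z ^ k)) (ℂᴿ.*-congˡ {conj z} (conj-^ z k))

  -- The coefficients 1 / k! are real, so conjugation commutes with the partial sums, and it
  -- preserves norm bounds.
  IsExp-conj : ∀ {z u} → IsExp z u → IsExp (conj z) (conj u)
  IsExp-conj {z} {u} z-exp = Null⇒⟶ℂ {expSum (conj z)} {conj u} λ p →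
    let N , small = ⟶ℂ⇒Null {expSum z} {u} z-exp p in
    N , λ k N≤k → ∥∥≤-resp
      (ℂᴿ.trans (conj-homo-+ (expSum z k) (- u)) (ℂᴿ.+-congʳ (conj-expSum k))) ℝ.refl (∥∥≤-conj (small k N≤k))
    where
    ∥∥≤-conj : ∀ {z r} → ∥ z ∥≤ r → ∥ conj z ∥≤ r
    ∥∥≤-conj (bounded x y e) = bounded x (∣∣≤-neg y) e

    conj-expTerm : ∀ k → conj (expTerm z k) ≈ expTerm (conj z) k
    conj-expTerm k = ℂᴿ.trans (ℝ.refl , ℝ.-‿distribˡ-* (im (z ^ k)) (1/ k !))
      (ℝ.*-congʳ (proj₁ (conj-^ z k)) , ℝ.*-congʳ (proj₂ (conj-^ z k)))

    conj-sum : ∀ f g → (∀ k → conj (f k) ≈ g k) → ∀ N → conj (partial-sum f N) ≈ partial-sum g N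
    conj-sum f g f≈g zero    = ℝ.refl , ℝ.-0#≈0#
    conj-sum f g f≈g (suc N) = ℂᴿ.trans (conj-homo-+ (f 0) (partial-sum (f ∘ suc) N))
      (ℂᴿ.+-cong (f≈g 0) (conj-sum (f ∘ suc) (g ∘ suc) (f≈g ∘ suc) N))

    conj-expSum : ∀ N → conj (expSum z N) ≈ expSum (conj z) N
    conj-expSum = conj-sum (expTerm z) (expTerm (conj z)) conj-expTerm

-- Primitivity of the root of unity exp (𝐢 π / n).

module RootsOfUnity (ℛ : RealNumbers) where

  open ComplexNumbers ℛ
  open OrderProperties ℛ
  open OrderedFieldProperties ℛ using (recip; _/_; 0<suc; #-congʳ; -‿#0)
  open ComplexExponential ℛ
  open HeytingFieldProperties ℂ-heytingField using (#0∧*≈0⇒≈0; ¬#⇒≈)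
  private
    module ℝ = RealAlgebra ℛ
    module ℂᴿ = ComplexAlgebra ℛ
  open ℝ using (_·_) renaming (Carrier to ℝ)
  open ℂᴿ using (_-_)

  suc·1#0 : ∀ k → suc k ℂᴿ.· 1# # 0#
  suc·1#0 k = inj₁ (#-congʳ (ℝ.sym (proj₁ (·1≈real (suc k)))) (ℝ.#-sym (ℝ.<⇒# (0<suc k))))

  ·-imaginary : ∀ j θ → j ℂᴿ.· (ℝ.0# +i θ) ≈ ℝ.0# +i (θ ℝ.* j · ℝ.1#)
  ·-imaginary zero    θ = ℝ.refl , ℝ.sym (ℝ.zeroʳ θ)
  ·-imaginary (suc j) θ = ℂᴿ.trans (ℂᴿ.+-congˡ {ℝ.0# +i θ} (·-imaginary j θ)) (ℝ.+-identityˡ ℝ.0# , expand θ (j · ℝ.1#))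
    where
    expand : ∀ θ k → θ ℝ.+ θ ℝ.* k ℝ.≈ θ ℝ.* (ℝ.1# ℝ.+ k)
    expand = ℝ.solve 2 (λ θ k → θ ℝ.:+ θ ℝ.:* k ℝ.:= θ ℝ.:* (ℝ.con (1 , 0) ℝ.:+ k)) ℝ.refl

  -- Conjugation turns 𝐢 θ into its negative, so the product is a value of exp at 0.
  IsExp-imaginary⇒unit : ∀ {θ u} → IsExp (ℝ.0# +i θ) u → u * conj u ≈ 1#
  IsExp-imaginary⇒unit {θ} {u} θ-exp =
    IsExp-unique {0#} (IsExp-cong (ℝ.+-identityˡ ℝ.0# , ℝ.-‿inverseʳ θ) ℂᴿ.refl (IsExp-+ θ-exp (IsExp-conj θ-exp))) IsExp-0

  module _ {π} (π-isPi : IsPi π) (n : ℕ) .{{n≢0 : NonZero n}} (2∣n : 2 ∣ n)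
           {ζ} (ζ-exp : IsExp (ℝ.0# +i (π / n)) ζ) where

    private
      θ : ℝ
      θ = π / n

      0<θ : ℝ.0# ℝ.< θ
      0<θ = ℝ.*-positive (IsPi.positive π-isPi) (inverse-positive (·1-nonNegative n) (proj₂ (recip n)))

      θn≈π : θ ℝ.* n · ℝ.1# ℝ.≈ π
      θn≈π = ℝ.trans (ℝ.*-assoc π (proj₁ (recip n)) (n · ℝ.1#))
        (ℝ.trans (ℝ.*-congˡ (proj₂ (recip n))) (ℝ.*-identityʳ π))

      ζʲ-exp : ∀ j → IsExp (ℝ.0# +i (θ ℝ.* j · ℝ.1#)) (ζ ^ j)
      ζʲ-exp j = IsExp-cong (·-imaginary j θ) ℂᴿ.refl (IsExp-· ζ-exp j)

      ζⁿ-exp : IsExp (ℝ.0# +i π) (ζ ^ n)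
      ζⁿ-exp = IsExp-cong (ℝ.refl , θn≈π) ℂᴿ.refl (ζʲ-exp n)

      -- This imaginary part is sin (j π / n), and 0 < j π / n < π.
      im-ζʲ#0 : ∀ j → 0 ℕ.< j → j ℕ.< n → im (ζ ^ j) ℝ.# ℝ.0#
      im-ζʲ#0 j 0<j j<n = IsPi.least π-isPi (θ ℝ.* j · ℝ.1#) (im (ζ ^ j))
        (ℝ.<-respˡ-≈ (ℝ.zeroʳ θ) (*-monoʳ-< 0<θ (·1-mono-< 0<j)))
        (ℝ.<-respʳ-≈ θn≈π (*-monoʳ-< 0<θ (·1-mono-< j<n)))
        (re (ζ ^ j) , ζʲ-exp j)

      im-ζⁿ≈0 : im (ζ ^ n) ℝ.≈ ℝ.0#
      im-ζⁿ≈0 = proj₂ (IsExp-unique {ℝ.0# +i π} ζⁿ-exp (proj₂ (IsPi.zero-sin π-isPi)))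

      ζⁿζⁿ≈1 : ζ ^ n * ζ ^ n ≈ 1#
      ζⁿζⁿ≈1 = ℂᴿ.trans (ℂᴿ.*-congˡ {ζ ^ n} ζⁿ-real) (IsExp-imaginary⇒unit ζⁿ-exp)
        where
        ζⁿ-real : ζ ^ n ≈ conj (ζ ^ n)
        ζⁿ-real = ℝ.refl , ℝ.trans im-ζⁿ≈0 (ℝ.trans (ℝ.sym ℝ.-0#≈0#) (ℝ.-‿cong (ℝ.sym im-ζⁿ≈0)))

      im#0⇒-1#0 : ∀ {z} → im z ℝ.# ℝ.0# → z - 1# # 0#
      im#0⇒-1#0 {z} im#0 = inj₂ (#-congʳ (ℝ.sym (ℝ.trans (ℝ.+-congˡ ℝ.-0#≈0#) (ℝ.+-identityʳ (im z)))) im#0)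

      difference-of-squares : ∀ z → (z - 1#) * (z + 1#) ≈ z * z - 1#
      difference-of-squares = ℂᴿ.solve 1 (λ z → (z ℂᴿ.:- ℂᴿ.con (1 , 0)) ℂᴿ.:* (z ℂᴿ.:+ ℂᴿ.con (1 , 0))
        ℂᴿ.:= z ℂᴿ.:* z ℂᴿ.:- ℂᴿ.con (1 , 0)) ℂᴿ.refl

      -1#0∧²≈1⇒+1≈0 : ∀ {z} → z - 1# # 0# → z * z ≈ 1# → z + 1# ≈ 0#
      -1#0∧²≈1⇒+1≈0 {z} z-1#0 z²≈1 = #0∧*≈0⇒≈0 z-1#0
        (ℂᴿ.trans (difference-of-squares z) (ℂᴿ.trans (ℂᴿ.+-congʳ z²≈1) (ℂᴿ.-‿inverseʳ 1#)))

      -- Otherwise exp (𝐢 π / 2) would be a square root of 1, hence real.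
      ζⁿ≉1 : ¬ ζ ^ n ≈ 1#
      ζⁿ≉1 ζⁿ≈1 = ℝ.#-irrefl (ℝ.trans (ℝ.sym (ℝ.+-identityʳ _)) (proj₂ ζ^q+1≈0)) im#0
        where
        q : ℕ
        q = _∣_.quotient 2∣n

        n≡q+q : n ≡ q ℕ.+ q
        n≡q+q = ≡.trans (_∣_.equality 2∣n) (≡.trans (ℕ.*-comm q 2) (≡.cong (q ℕ.+_) (ℕ.+-identityʳ q)))

        0<q : 0 ℕ.< q
        0<q = ℕ.n≢0⇒n>0 λ q≡0 → ℕ.≢-nonZero⁻¹ n (≡.trans n≡q+q (≡.cong₂ ℕ._+_ q≡0 q≡0))

        im#0 : im (ζ ^ q) ℝ.# ℝ.0#
        im#0 = im-ζʲ#0 q 0<q (≡.subst (q ℕ.<_) (≡.sym n≡q+q) (ℕ.m<m+n q 0<q))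

        ζ^q+1≈0 : ζ ^ q + 1# ≈ 0#
        ζ^q+1≈0 = -1#0∧²≈1⇒+1≈0 (im#0⇒-1#0 im#0)
          (ℂᴿ.trans (ℂᴿ.sym (ℂᴿ.^-homo-* ζ q q)) (ℂᴿ.trans (ℂᴿ.^-congʳ ζ (≡.sym n≡q+q)) ζⁿ≈1))

      +1≈0⇒≈-1 : ∀ {z} → z + 1# ≈ 0# → z ≈ - 1#
      +1≈0⇒≈-1 {z} z+1≈0 = ℂᴿ.trans (cancel z) (ℂᴿ.trans (ℂᴿ.+-congʳ z+1≈0) (ℂᴿ.+-identityˡ (- 1#)))
        where
        cancel : ∀ z → z ≈ (z + 1#) - 1#
        cancel = ℂᴿ.solve 1 (λ z → z ℂᴿ.:= (z ℂᴿ.:+ ℂᴿ.con (1 , 0)) ℂᴿ.:- ℂᴿ.con (1 , 0)) ℂᴿ.refl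

    -- In (ζⁿ - 1)(ζⁿ + 1) = 0 the first factor cannot be cancelled directly, because ζⁿ ≠ 1 is
    -- known only as a negation. Instead the second is assumed apart from 0 and cancelled, which
    -- gives the contradiction ζⁿ = 1; tightness concludes.
    ζⁿ≈-1 : ζ ^ n ≈ - 1#
    ζⁿ≈-1 = +1≈0⇒≈-1 (¬#⇒≈ λ ζⁿ+1#0 → ζⁿ≉1 (-1≈0⇒≈1 (#0∧*≈0⇒≈0 ζⁿ+1#0
      (ℂᴿ.trans (ℂᴿ.*-comm (ζ ^ n + 1#) (ζ ^ n - 1#)) (ℂᴿ.trans (difference-of-squares (ζ ^ n))
        (ℂᴿ.trans (ℂᴿ.+-congʳ ζⁿζⁿ≈1) (ℂᴿ.-‿inverseʳ 1#)))))))
      where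
      -1≈0⇒≈1 : ∀ {z} → z - 1# ≈ 0# → z ≈ 1#
      -1≈0⇒≈1 {z} z-1≈0 = ℂᴿ.trans (cancel z) (ℂᴿ.trans (ℂᴿ.+-congʳ z-1≈0) (ℂᴿ.+-identityˡ 1#))
        where
        cancel : ∀ z → z ≈ (z - 1#) + 1#
        cancel = ℂᴿ.solve 1 (λ z → z ℂᴿ.:= (z ℂᴿ.:- ℂᴿ.con (1 , 0)) ℂᴿ.:+ ℂᴿ.con (1 , 0)) ℂᴿ.refl

    -- Away from j = n the imaginary part is apart from 0, as ζʲ = - ζʲ⁻ⁿ reduces n < j < 2n to
    -- exponents below n. At j = n the difference is -2.
    ζʲ-1#0 : ∀ j → 0 ℕ.< j → j ℕ.< 2 ℕ.* n → ζ ^ j - 1# # 0#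
    ζʲ-1#0 j 0<j j<2n with ℕ.<-cmp j n
    ... | tri< j<n _ _ = im#0⇒-1#0 (im-ζʲ#0 j 0<j j<n)
    ... | tri≈ _ ≡.refl _ = inj₁ (#-congʳ (ℝ.+-congʳ (ℝ.sym (proj₁ ζⁿ≈-1))) -1-1#0)
      where
      -1-1#0 : ℝ.- ℝ.1# ℝ.- ℝ.1# ℝ.# ℝ.0#
      -1-1#0 = -‿#0 (#-congʳ (double ℝ.1#) (ℝ.#-sym (ℝ.<⇒# (0<suc 1))))
        where
        double : ∀ x → x ℝ.+ (x ℝ.+ ℝ.0#) ℝ.≈ ℝ.- (ℝ.- x ℝ.- x)
        double = ℝ.solve 1 (λ x → x ℝ.:+ (x ℝ.:+ ℝ.con (0 , 0)) ℝ.:= ℝ.:- (ℝ.:- x ℝ.:- x)) ℝ.refl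
    ... | tri> _ _ n<j = im#0⇒-1#0 (#-congʳ (ℝ.sym (proj₂ ζʲ≈-ζʲ⁻ⁿ)) (-‿#0 (#-congʳ (ℝ.sym (ℝ.-‿involutive _))
        (im-ζʲ#0 (j ℕ.∸ n) (ℕ.m<n⇒0<n∸m n<j) j∸n<n))))
      where
      j∸n<n : j ℕ.∸ n ℕ.< n
      j∸n<n = ℕ.+-cancelˡ-< n _ _ (≡.subst₂ ℕ._<_ (≡.sym (ℕ.m+[n∸m]≡n (ℕ.<⇒≤ n<j)))
        (≡.cong (n ℕ.+_) (ℕ.+-identityʳ n)) j<2n)

      ζʲ≈-ζʲ⁻ⁿ : ζ ^ j ≈ - (ζ ^ (j ℕ.∸ n))
      ζʲ≈-ζʲ⁻ⁿ = ℂᴿ.trans (ℂᴿ.^-congʳ ζ (≡.sym (ℕ.m+[n∸m]≡n (ℕ.<⇒≤ n<j))))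
        (ℂᴿ.trans (ℂᴿ.^-homo-* ζ n (j ℕ.∸ n)) (ℂᴿ.trans (ℂᴿ.*-congʳ ζⁿ≈-1) (ℂᴿ.-1*x≈-x (ζ ^ (j ℕ.∸ n)))))

-- The classification over the complex numbers.

lemma2p8 :
    (ℛ : RealNumbers) →
    let open ComplexNumbers ℛ
        open OrderedFieldProperties ℛ using (_/_)
        open Matrices ℂ-commutativeRing using (_≈ᴹ_) in
    (n : ℕ) .{{_ : NonZero n}} → 2 ∣ n →
    let open Representations ℂ-heytingField (T₈ₙ n) in
    (π : RealNumbers.Carrier ℛ) → IsPi π →
    (ω ξ : ℂ) →
    IsExp (RealNumbers.0# ℛ +i (π / 4)) ω →
    IsExp (RealNumbers.0# ℛ +i (π / n)) ξ →
    Σ[ ξ⁻¹ ∈ ℂ ] (ξ * ξ⁻¹ ≈ 1#) ×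
    (Σ[ ρ ∈ ((l : Label n) → Representation (degree l)) ]
      (∀ l → (act (ρ l) a ≈ᴹ image-a ℛ ω ξ ξ⁻¹ l) × (act (ρ l) b ≈ᴹ image-b ℛ ω ξ ξ⁻¹ l)) ×
      IsCompleteListOfIrreducibles ρ)
lemma2p8 ℛ n 2∣n π π-isPi ω ξ ω-exp ξ-exp = ξ⁻¹ , ξξ⁻¹≈1 , ρ , images , ρ-isCompleteListOfIrreducibles
  where
  open ComplexNumbers ℛ
  open Matrices ℂ-commutativeRing using (_≈ᴹ_)
  open Representations ℂ-heytingField (T₈ₙ n)
  open RootsOfUnity ℛ
  module ℂᴿ = ComplexAlgebra ℛ

  ξⁿ≈-1 : ξ ^ n ≈ - 1#
  ξⁿ≈-1 = ζⁿ≈-1 π-isPi n 2∣n ξ-exp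

  -- ω is the instance 4 of the same family exp (𝐢 π / n), so ω⁴ = -1 and its order 8 come from the
  -- lemmas used for ξ.
  2∣4 : 2 ∣ 4
  2∣4 = divides 2 ≡.refl

  ξ⁻¹ : ℂ
  -- From ξⁿ = -1, so the inverse is a polynomial expression in ξ.
  ξ⁻¹ = - (ξ ^ ℕ.pred n)

  ξξ⁻¹≈1 : ξ * ξ⁻¹ ≈ 1#
  ξξ⁻¹≈1 = ℂᴿ.trans (ℂᴿ.sym (ℂᴿ.-‿distribʳ-* ξ (ξ ^ ℕ.pred n)))
    (ℂᴿ.trans (ℂᴿ.-‿cong (ℂᴿ.trans (ℂᴿ.^-congʳ ξ (ℕ.suc-pred n)) ξⁿ≈-1)) (ℂᴿ.-‿involutive 1#))

  𝐢²≈-1 : 𝐢 * 𝐢 ≈ - 1#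
  𝐢²≈-1 = ℝ.trans (ℝ.+-congʳ (ℝ.zeroˡ ℝ.0#)) (ℝ.trans (ℝ.+-identityˡ _) (ℝ.-‿cong (ℝ.*-identityˡ ℝ.1#)))
        , ℝ.trans (ℝ.+-cong (ℝ.zeroˡ ℝ.1#) (ℝ.zeroʳ ℝ.1#)) (ℝ.trans (ℝ.+-identityˡ ℝ.0#) (ℝ.sym ℝ.-0#≈0#))
    where module ℝ = RealAlgebra ℛ

  open Classification.Roots ℂ-heytingField n 2∣n ξ ξ⁻¹ ω 𝐢 ξξ⁻¹≈1 ξⁿ≈-1 (ζⁿ≈-1 π-isPi 4 2∣4 ω-exp) 𝐢²≈-1
    (ζʲ-1#0 π-isPi n 2∣n ξ-exp) (ζʲ-1#0 π-isPi 4 2∣4 ω-exp) suc·1#0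

  images : ∀ l → (act (ρ l) a ≈ᴹ image-a ℛ ω ξ ξ⁻¹ l) × (act (ρ l) b ≈ᴹ image-b ℛ ω ξ ξ⁻¹ l)
  images (ρ₁ _)     = (λ _ _ → ℂᴿ.refl) , (λ _ _ → ℂᴿ.refl)
  images (ρ₂ _ _ _) = (λ _ _ → ℂᴿ.refl) , (λ _ _ → ℂᴿ.refl)
  images (ρ₃ _ _ _) = (λ _ _ → ℂᴿ.refl) , (λ _ _ → ℂᴿ.refl)
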